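{- Let $q=p^f$ be a power of a prime $p$, let $r>1$, and let $\mathbf{s}=(s_1,\ldots,s_r)$ with all $s_i<0$ integers. Then $\zeta(\mathbf{s})=0$ if and only if $\mathbf{s}$ is a trivial zero, i.e. if and only if there exists $1\le i\le r-1$ with $r-i>L_{ -s_i}$.
   Context: $\mathbb{F}_q$ is the field with $q=p^f$ elements, $A=\mathbb{F}_q[t]$, $K_\infty=\mathbb{F}_q((1/t))$, $A_{d+}$ is the set of monic polynomials in $A$ of degree $d$, and $S_d(s)=\sum_{a\in A_{d+}}a^{ -s}$. For $\mathbf{s}=(s_1,\ldots,s_r)\in\mathbb{Z}^r$, the multizeta value is $\zeta(\mathbf{s})=\sum_{d_1>d_2>\cdots>d_r\ge0}S_{d_1}(s_1)\cdots S_{d_r}(s_r)\in K_\infty$ (for negative $s_i$ only finitely many terms are nonzero). For a positive integer $k$ with base-$q$ expansion $k=a_0+a_1q+\cdots+a_nq^n$, $l(k)=\sum_i a_i$ and $L_k=\min_{0\le i\le f-1} l(kp^i)/(q-1)$. A tuple $\mathbf{s}$ of negative integers with $r>1$ and $\zeta(\mathbf{s})=0$ is called a trivial zero if there is $1\le i\le r-1$ with $r-i>L_{ -s_i}$. -}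

module Defs where

open import Level using (0ℓ)
open import Algebra.Bundles using (CommutativeRing)
import Data.Nat as ℕ
open ℕ using (ℕ; zero; suc)
open import Data.Nat.DivMod using (_/_; _%_)
open import Data.Nat.Primality using (Prime)
open import Data.Fin using (Fin; toℕ)
open import Data.Vec as Vec using (Vec; []; _∷_)
open import Data.List as List using (List; []; _∷_; _++_; [_]; concatMap; foldr; allFin; applyUpTo)
open import Data.List.Relation.Unary.All using (All)
open import Data.Product using (∃; _×_; _,_)
open import Relation.Nullary using (¬_)
open import Relation.Binary.PropositionalEquality using (_≡_)
open import Data.Integer as ℤ using (ℤ; +_; ∣_∣)
import Data.Rational as ℚ

record FiniteField : Set₁ where
  field
    commRing : CommutativeRing 0ℓ 0ℓ
  open CommutativeRing commRing public
  field
    1≉0     : ¬ (1# ≈ 0#)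
    inverse : ∀ x → ¬ (x ≈ 0#) → ∃ λ y → (x * y) ≈ 1#
    p       : ℕ
    f       : ℕ
    q       : ℕ
    p-prime : Prime p
    f≥1     : 1 ℕ.≤ f
    q≡p^f   : q ≡ p ℕ.^ f
    enum    : Fin q → Carrier
    enum-injective  : ∀ i j → enum i ≈ enum j → i ≡ j
    enum-surjective : ∀ x → ∃ λ i → enum i ≈ x

-- Base-b digit sum l(k) (sum of base-b digits of k), for bases b ≥ 2.
-- The fuel argument n ≥ k guarantees termination (k / b < k for k > 0).

digitSum′ : (m : ℕ) → (fuel k : ℕ) → ℕ
digitSum′ m zero    k = 0
digitSum′ m (suc n) k = (k % suc (suc m)) ℕ.+ digitSum′ m n (k / suc (suc m))

digitSum : (b k : ℕ) → ℕ
digitSum zero          k = 0   -- unused (bases are ≥ 2)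
digitSum (suc zero)    k = 0
digitSum (suc (suc m)) k = digitSum′ m k k

module _ (F : FiniteField) where
  open FiniteField F

  l : ℕ → ℕ
  l k = digitSum q k

  -- min_{0 ≤ j ≤ f-1} l(k p^j)   (f ≥ 1, so the j = 0 term is present)
  minl : ℕ → ℕ
  minl k = foldr ℕ._⊓_ (l k) (applyUpTo (λ j → l (k ℕ.* (p ℕ.^ j))) f)

  -- L_k = min_{0 ≤ j ≤ f-1} l(k p^j) / (q - 1)   (q ≥ 2 always)
  L : ℕ → ℚ.ℚ
  L k with q
  ... | zero        = ℚ.0ℚ
  ... | suc zero    = ℚ.0ℚ
  ... | suc (suc m) = (+ minl k) ℚ./ suc m

  -- A = F_q[t], polynomials as coefficient lists (constant term first).

  Poly : Set
  Poly = List Carrier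

  _⊕_ : Poly → Poly → Poly
  []      ⊕ Q       = Q
  (a ∷ P) ⊕ []      = a ∷ P
  (a ∷ P) ⊕ (b ∷ Q) = (a + b) ∷ (P ⊕ Q)

  _⊗_ : Poly → Poly → Poly
  []      ⊗ Q = []
  (a ∷ P) ⊗ Q = List.map (a *_) Q ⊕ (0# ∷ (P ⊗ Q))

  one : Poly
  one = [ 1# ]

  _^ₚ_ : Poly → ℕ → Poly
  P ^ₚ zero  = one
  P ^ₚ suc k = P ⊗ (P ^ₚ k)

  Σₚ : List Poly → Poly
  Σₚ = foldr _⊕_ []

  IsZero : Poly → Set
  IsZero P = All (_≈ 0#) P

  allVecs : (d : ℕ) → List (Vec Carrier d)
  allVecs zero    = [ [] ]
  allVecs (suc d) = concatMap (λ i → List.map (enum i ∷_) (allVecs d)) (allFin q)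

  monic : (d : ℕ) → List Poly
  monic d = List.map (λ v → Vec.toList v ++ [ 1# ]) (allVecs d)

  S- : (d k : ℕ) → Poly
  S- d k = Σₚ (List.map (_^ₚ k) (monic d))

  -- Truncated multizeta for s = (-k₁, …, -k_r):
  --   Z (k₁ ∷ … ∷ k_r) N = Σ_{N > d₁ > d₂ > ⋯ > d_r ≥ 0} S_{d₁}(-k₁) ⋯ S_{d_r}(-k_r)
  Z : List ℕ → ℕ → Poly
  Z []       N = one
  Z (k ∷ ks) N = Σₚ (applyUpTo (λ d → S- d k ⊗ Z ks d) N)

  -- ζ(s) = lim_{N→∞} Z ks N in K_∞.  Since every nonzero polynomial has
  -- |P|_∞ ≥ 1, this limit is 0 iff the partial sums are eventually 0.
  ζ≡0 : List ℕ → Set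
  ζ≡0 ks = ∃ λ N₀ → ∀ N → N₀ ℕ.≤ N → IsZero (Z ks N)

  -- s = (s₁, …, s_r) is a trivial zero shape: ∃ 1 ≤ i ≤ r-1 with r - i > L_{-s_i}.
  -- Here i is 0-based (Fin r), so the paper's index is toℕ i + 1.
  TrivialZeroCondition : (r : ℕ) → Vec ℤ r → Set
  TrivialZeroCondition r s =
    ∃ λ (i : Fin r) → (suc (toℕ i) ℕ.≤ r ℕ.∸ 1)
      × (L ∣ Vec.lookup s i ∣ ℚ.< ((+ (r ℕ.∸ suc (toℕ i))) ℚ./ 1))

  negList : {r : ℕ} → Vec ℤ r → List ℕ
  negList s = Vec.toList (Vec.map ∣_∣ s)

{-# OPTIONS --safe #-}

-- Expand the k-th powers of the monic polynomials of degree d along the base-p digits of k and sum over the coefficients: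
-- S_d(−k) becomes a sum over the compositions of k, the carry-free decompositions of k into d nonempty parts divisible by
-- q − 1 and one unconstrained part, where a composition contributes a monomial in t. Compositions exist if and only if
-- d (q − 1) ≤ l(k pʲ) for all j; otherwise S_d(−k) = 0.
--
-- If compositions exist, the least exponent of t is attained for a single choice of the part with weight 0: when this part
-- could be larger, digits can be exchanged so that the first digit that becomes available moves up while smaller digits,
-- each at most once, sink by one part, and their sum is less than the digit that moved up. By induction on d the order of
-- S_d(−k) at t = 0 is the least exponent. Merging two parts shows that it increases strictly with d ≥ 1. Hence for
-- r ≥ 2 the term (d₁, …, d_r) = (r − 1, …, 1, 0) dominates ζ(s) at t = 0 unless it vanishes, and then all terms vanish.
module Submission where

import Data.Nat
open import Defs using (FiniteField)

-- Cancellation in `S` can only come from ties: each term is a nonzero binomial coefficient times a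
-- nonzero power sum times a leading coefficient of smaller degree. A tie is excluded by showing
-- that, of two choices of the weight-0 part, the smaller one is never minimal. The obstacle is that
-- for f > 1 divisibility by q - 1 constrains f norms at once. The digit p^e is determined modulo q
-- - 1 only by its colour e mod f, so in general a digit is traded for a whole packet of the same
-- residue, not for another digit. A composition needs q - 1 per part in every norm; chip-firing,
-- one digit against p digits of the colour below, shows that this suffices. To free a packet for
-- p^N, digits below it are passed on, one colour (relative to that of N) at a time. The colours
-- used strictly decrease, so no digit is charged twice; and since base-p digits produce no carries,
-- all digits below p^N together stay under p^N. Therefore charges are recorded by colour and every
-- loss is compared with p^N.

-- Multisets of natural numbers and congruences

module Multisets where

  open import Data.Nat
  open import Data.Nat.Properties
  open import Algebra.Properties.CommutativeSemigroup +-commutativeSemigroup using (interchange; x∙yz≈y∙xz)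
  open import Data.Nat.Solver using (module +-*-Solver)
  open +-*-Solver using (solve; _:+_; _:*_; _:=_)
  open import Data.List.Base using (List; []; _∷_; _++_; replicate)
  open import Data.Product using (∃₂; _×_; _,_)
  open import Data.Sum using (_⊎_; inj₁; inj₂)
  open import Data.Empty using (⊥-elim)
  open import Relation.Nullary using (¬_; Dec; yes; no)
  open import Relation.Binary.Definitions using (tri<; tri≈; tri>)
  open import Relation.Binary.PropositionalEquality

  infix 4 _≋_

  Σ[_] : (ℕ → ℕ) → List ℕ → ℕ
  Σ[ φ ] []      = 0
  Σ[ φ ] (x ∷ X) = φ x + Σ[ φ ] X

  -- Lists stand for multisets; two of them agree when every additive functional does.
  _≋_ : List ℕ → List ℕ → Set
  X ≋ Y = ∀ φ → Σ[ φ ] X ≡ Σ[ φ ] Y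

  opaque
    Σ-++ : ∀ φ X Y → Σ[ φ ] (X ++ Y) ≡ Σ[ φ ] X + Σ[ φ ] Y
    Σ-++ φ []      Y = refl
    Σ-++ φ (x ∷ X) Y = trans (cong (φ x +_) (Σ-++ φ X Y)) (sym (+-assoc (φ x) _ _))

  Σ-mono : ∀ {φ ψ} → (∀ e → φ e ≤ ψ e) → ∀ X → Σ[ φ ] X ≤ Σ[ ψ ] X
  Σ-mono φ≤ψ []      = z≤n
  Σ-mono φ≤ψ (x ∷ X) = +-mono-≤ (φ≤ψ x) (Σ-mono φ≤ψ X)

  Σ-cong : ∀ {φ ψ} → (∀ e → φ e ≡ ψ e) → ∀ X → Σ[ φ ] X ≡ Σ[ ψ ] X
  Σ-cong eq []      = refl
  Σ-cong eq (x ∷ X) = cong₂ _+_ (eq x) (Σ-cong eq X)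

  opaque
    Σ-+ : ∀ φ ψ X → Σ[ (λ e → φ e + ψ e) ] X ≡ Σ[ φ ] X + Σ[ ψ ] X
    Σ-+ φ ψ []      = refl
    Σ-+ φ ψ (x ∷ X) = trans (cong (φ x + ψ x +_) (Σ-+ φ ψ X))
      (interchange (φ x) (ψ x) _ _)

    Σ-* : ∀ k φ X → Σ[ (λ e → k * φ e) ] X ≡ k * Σ[ φ ] X
    Σ-* k φ []      = sym (*-zeroʳ k)
    Σ-* k φ (x ∷ X) = trans (cong (k * φ x +_) (Σ-* k φ X)) (sym (*-distribˡ-+ k (φ x) _))

  Σ-cong₀ : ∀ {φ ψ χ} → (∀ e → χ e ≡ 0 → φ e ≡ ψ e) → ∀ X → Σ[ χ ] X ≡ 0 → Σ[ φ ] X ≡ Σ[ ψ ] X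
  Σ-cong₀ eq []      _ = refl
  Σ-cong₀ {χ = χ} eq (x ∷ X) z = cong₂ _+_ (eq x (m+n≡0⇒m≡0 (χ x) z)) (Σ-cong₀ eq X (m+n≡0⇒n≡0 (χ x) z))

  Σ-replicate : ∀ φ k e → Σ[ φ ] (replicate k e) ≡ k * φ e
  Σ-replicate φ zero    e = refl
  Σ-replicate φ (suc k) e = cong (φ e +_) (Σ-replicate φ k e)

  opaque
    -- Removing one element is expressed through all functionals `ψ` at once, so the order of a list
    -- never matters.
    Σ-find : ∀ φ X → 0 < Σ[ φ ] X → ∃₂ λ e X′ → 0 < φ e × (∀ ψ → Σ[ ψ ] X ≡ ψ e + Σ[ ψ ] X′)
    Σ-find φ (x ∷ X) pos with 0 <? φ x
    ... | yes h = x , X , h , λ ψ → refl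
    ... | no  h with Σ-find φ X (subst (λ a → 0 < a + Σ[ φ ] X) (n≤0⇒n≡0 (≮⇒≥ h)) pos)
    ...   | e , X′ , h′ , eq = e , x ∷ X′ , h′ , λ ψ → trans (cong (ψ x +_) (eq ψ))
              (x∙yz≈y∙xz (ψ x) (ψ e) _)

  ⟦_⟧ : ∀ {A : Set} → Dec A → ℕ
  ⟦ yes _ ⟧ = 1
  ⟦ no  _ ⟧ = 0

  ⟦⟧>0 : ∀ {A : Set} (d : Dec A) → 0 < ⟦ d ⟧ → A
  ⟦⟧>0 (yes a) _ = a

  ⟦⟧≡0 : ∀ {A : Set} (d : Dec A) → ⟦ d ⟧ ≡ 0 → ¬ A
  ⟦⟧≡0 (no ¬a) _ = ¬a

  ⟦⟧-yes : ∀ {A : Set} (d : Dec A) → A → ⟦ d ⟧ ≡ 1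
  ⟦⟧-yes (yes _) _ = refl
  ⟦⟧-yes (no ¬a) a = ⊥-elim (¬a a)

  ⟦⟧-no : ∀ {A : Set} (d : Dec A) → ¬ A → ⟦ d ⟧ ≡ 0
  ⟦⟧-no (yes a) ¬a = ⊥-elim (¬a a)
  ⟦⟧-no (no _)  _  = refl

  0⊎pos : ∀ k → k ≡ 0 ⊎ 0 < k
  0⊎pos zero    = inj₁ refl
  0⊎pos (suc k) = inj₂ z<s

  opaque
    cancel-≤ : ∀ {a b x y} c → x ≤ y → x ≡ a + c → y ≡ b + c → a ≤ b
    cancel-≤ {a} {b} c h refl refl = +-cancelʳ-≤ c a b h

    cancel-≡ : ∀ {a b x y} c → x ≡ y → x ≡ a + c → y ≡ b + c → a ≡ b
    cancel-≡ {a} {b} c h refl refl = +-cancelʳ-≡ c a b h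

  module Congruence (n : ℕ) where

    infix 4 _≈ₙ_

    _≈ₙ_ : ℕ → ℕ → Set
    a ≈ₙ b = ∃₂ λ s t → a + s * n ≡ b + t * n

    opaque
      ≡⇒≈ₙ : ∀ {a b} → a ≡ b → a ≈ₙ b
      ≡⇒≈ₙ refl = 0 , 0 , refl

      ≈ₙ-sym : ∀ {a b} → a ≈ₙ b → b ≈ₙ a
      ≈ₙ-sym (s , t , eq) = t , s , sym eq

      ≈ₙ-trans : ∀ {a b c} → a ≈ₙ b → b ≈ₙ c → a ≈ₙ c
      ≈ₙ-trans {a} {b} {c} (s , t , eq) (u , v , eq′) = s + u , t + v ,
        cancel-≡ b (cong₂ _+_ eq eq′)
          (solve 5 (λ a b s u n → (a :+ s :* n) :+ (b :+ u :* n) := (a :+ (s :+ u) :* n) :+ b) refl a b s u n)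
          (solve 5 (λ b c t v n → (b :+ t :* n) :+ (c :+ v :* n) := (c :+ (t :+ v) :* n) :+ b) refl b c t v n)

      ≈ₙ-+ : ∀ {a b c d} → a ≈ₙ b → c ≈ₙ d → a + c ≈ₙ b + d
      ≈ₙ-+ {a} {b} {c} {d} (s , t , eq) (u , v , eq′) = s + u , t + v ,
        trans (solve 5 (λ a c s u n → (a :+ c) :+ (s :+ u) :* n := (a :+ s :* n) :+ (c :+ u :* n)) refl a c s u n)
        (trans (cong₂ _+_ eq eq′)
          (solve 5 (λ b d t v n → (b :+ t :* n) :+ (d :+ v :* n) := (b :+ d) :+ (t :+ v) :* n) refl b d t v n))

      ≈ₙ-* : ∀ k {a b} → a ≈ₙ b → k * a ≈ₙ k * b
      ≈ₙ-* k {a} {b} (s , t , eq) = k * s , k * t ,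
        trans (solve 4 (λ k a s n → k :* a :+ k :* s :* n := k :* (a :+ s :* n)) refl k a s n)
        (trans (cong (k *_) eq) (solve 4 (λ k a s n → k :* (a :+ s :* n) := k :* a :+ k :* s :* n) refl k b t n))

      ≈ₙ-cancel : ∀ c {a b} → a + c ≈ₙ b + c → a ≈ₙ b
      ≈ₙ-cancel c {a} {b} (s , t , eq) = s , t , cancel-≡ c eq
        (solve 4 (λ a c s n → (a :+ c) :+ s :* n := (a :+ s :* n) :+ c) refl a c s n)
        (solve 4 (λ a c s n → (a :+ c) :+ s :* n := (a :+ s :* n) :+ c) refl b c t n)

      n≈0 : n ≈ₙ 0
      n≈0 = 0 , 1 , refl

      -- Turns any strict inequality between congruent norms into a surplus of a full n, the size of
      -- one more part.
      ≈ₙ-gap : ∀ {a b} → a ≈ₙ b → b < a → b + n ≤ a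
      ≈ₙ-gap {a} {b} (s , t , eq) b<a with suc s ≤? t
      ... | yes s<t = cancel-≤ (s * n) (+-monoʳ-≤ b (*-monoˡ-≤ n s<t))
              (solve 3 (λ b s n → b :+ (n :+ s :* n) := (b :+ n) :+ s :* n) refl b s n) (sym eq)
      ... | no  s≮t = ⊥-elim (<-irrefl (sym eq) (+-mono-<-≤ b<a (*-monoˡ-≤ n (≤-pred (≰⇒> s≮t)))))

      ≈ₙ-unique : ∀ {a b} → a ≈ₙ b → 0 < a → 0 < b → a ≤ n → b ≤ n → a ≡ b
      ≈ₙ-unique {a} {b} eq 0<a 0<b a≤n b≤n with <-cmp a b
      ... | tri≈ _ a≡b _ = a≡b
      ... | tri< a<b _ _ = ⊥-elim (<⇒≱ (m<n+m n 0<a) (≤-trans (≈ₙ-gap (≈ₙ-sym eq) a<b) b≤n))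
      ... | tri> _ _ b<a = ⊥-elim (<⇒≱ (m<n+m n 0<b) (≤-trans (≈ₙ-gap eq b<a) a≤n))

-- Binomial expansion along base-p digits

module Expansions where

  open import Level using (Level)
  open import Algebra.Bundles using (CommutativeSemiring)
  open import Data.Nat as ℕ using (ℕ; zero; suc; _∸_; _≤_; _<_; z<s; s<s; _!; NonZero)
  import Data.Nat.Properties as ℕₚ
  open import Data.Nat.Combinatorics using (_C_; nCk≡n!/k![n-k]!; k![n∸k]!∣n!; nCn≡1)
  open import Data.Nat.Divisibility using (_∣_; m∣m*n; ∣m⇒∣m*n; ∣⇒≤; divides; ∣1⇒≡1)
  open import Data.Nat.DivMod using (m/n*n≡m)
  open import Data.Nat.Primality using (Prime; euclidsLemma; prime⇒nonTrivial; prime⇒nonZero)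
  open import Data.Fin as Fin using (Fin; toℕ)
  open import Data.List.Base as List using (List; []; _∷_; _++_; foldr; applyUpTo; upTo; cartesianProductWith; concatMap)
  open import Data.Product using (_,_)
  open import Data.Sum
  open import Data.Empty using (⊥-elim)
  open import Function using (_∘_; id)
  open import Relation.Nullary
  import Relation.Binary.PropositionalEquality as ≡
  open ≡ using (_≡_)

  C*!≡! : ∀ {n k} → k ≤ n → (n C k) ℕ.* (k ! ℕ.* (n ∸ k) !) ≡ n !
  C*!≡! {n} {k} k≤n = ≡.trans (≡.cong (ℕ._* (k ! ℕ.* (n ∸ k) !)) (nCk≡n!/k![n-k]! k≤n)) (m/n*n≡m (k![n∸k]!∣n! k≤n))
    where
    instance
      k![n-k]!≢0 : NonZero (k ! ℕ.* (n ∸ k) !)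
      k![n-k]!≢0 = ℕₚ._!*_!≢0 k (n ∸ k)

  module Binomials {p : ℕ} (p-prime : Prime p) where

    opaque
      1<p : 1 < p
      1<p = ℕ.nonTrivial⇒n>1 p {{prime⇒nonTrivial p-prime}}

      p∤m! : ∀ m → m < p → ¬ p ∣ m !
      p∤m! zero    m<p p∣1 = ℕₚ.<⇒≢ 1<p (≡.sym (∣1⇒≡1 p∣1))
      p∤m! (suc m) m<p p∣m! with euclidsLemma (suc m) (m !) p-prime p∣m!
      ... | inj₁ p∣1+m = ℕₚ.<⇒≱ m<p (∣⇒≤ p∣1+m)
      ... | inj₂ p∣m!  = p∤m! m (ℕₚ.<-trans (ℕₚ.n<1+n m) m<p) p∣m!

      p∣pCk : ∀ k → 0 < k → k < p → p ∣ p C k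
      p∣pCk k 0<k k<p with euclidsLemma (p C k) (k ! ℕ.* (p ∸ k) !) p-prime
          (≡.subst (p ∣_) (≡.sym (C*!≡! (ℕₚ.<⇒≤ k<p))) (≡.subst (λ m → m ∣ m !) (ℕₚ.suc-pred p {{prime⇒nonZero p-prime}}) (m∣m*n (ℕ.pred p !))))
      ... | inj₁ p∣C = p∣C
      ... | inj₂ p∣k![p-k]! with euclidsLemma (k !) ((p ∸ k) !) p-prime p∣k![p-k]!
      ...   | inj₁ p∣k!     = ⊥-elim (p∤m! k k<p p∣k!)
      ...   | inj₂ p∣[p-k]! = ⊥-elim (p∤m! (p ∸ k) (ℕₚ.∸-monoʳ-< 0<k (ℕₚ.<⇒≤ k<p)) p∣[p-k]!)

      p∤kCj : ∀ {k j} → k < p → j ≤ k → ¬ p ∣ k C j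
      p∤kCj {k} {j} k<p j≤k p∣C = p∤m! k k<p (≡.subst (p ∣_) (C*!≡! j≤k) (∣m⇒∣m*n _ p∣C))

  module ListSums {c ℓ : Level} (R : CommutativeSemiring c ℓ) where

    open CommutativeSemiring R
    open import Algebra.Properties.CommutativeSemigroup +-commutativeSemigroup using (interchange)
    open import Algebra.Properties.Semiring.Sum semiring using (sum)

    ∑ : ∀ {A : Set} → (A → Carrier) → List A → Carrier
    ∑ g xs = foldr _+_ 0# (List.map g xs)

    opaque
      ∑-cong : ∀ {A : Set} {g h : A → Carrier} → (∀ x → g x ≈ h x) → ∀ xs → ∑ g xs ≈ ∑ h xs
      ∑-cong eq []       = refl
      ∑-cong eq (x ∷ xs) = +-cong (eq x) (∑-cong eq xs)

      ∑-0 : ∀ {A : Set} {g : A → Carrier} → (∀ x → g x ≈ 0#) → ∀ xs → ∑ g xs ≈ 0#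
      ∑-0 eq []       = refl
      ∑-0 eq (x ∷ xs) = trans (+-cong (eq x) (∑-0 eq xs)) (+-identityˡ 0#)

      ∑-++ : ∀ {A : Set} (g : A → Carrier) xs ys → ∑ g (xs ++ ys) ≈ ∑ g xs + ∑ g ys
      ∑-++ g []       ys = sym (+-identityˡ _)
      ∑-++ g (x ∷ xs) ys = trans (+-congˡ (∑-++ g xs ys)) (sym (+-assoc _ _ _))

      ∑-map : ∀ {A B : Set} (g : B → Carrier) (h : A → B) xs → ∑ g (List.map h xs) ≈ ∑ (λ x → g (h x)) xs
      ∑-map g h []       = refl
      ∑-map g h (x ∷ xs) = +-congˡ (∑-map g h xs)

      ∑-concatMap : ∀ {A B : Set} (g : B → Carrier) (h : A → List B) xs → ∑ g (concatMap h xs) ≈ ∑ (λ x → ∑ g (h x)) xs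
      ∑-concatMap g h []       = refl
      ∑-concatMap g h (x ∷ xs) = trans (∑-++ g (h x) _) (+-congˡ (∑-concatMap g h xs))

      ∑-+ : ∀ {A : Set} (g h : A → Carrier) xs → ∑ (λ x → g x + h x) xs ≈ ∑ g xs + ∑ h xs
      ∑-+ g h []       = sym (+-identityˡ 0#)
      ∑-+ g h (x ∷ xs) = trans (+-congˡ (∑-+ g h xs)) (interchange _ _ _ _)

      ∑-*ˡ : ∀ {A : Set} a (g : A → Carrier) xs → ∑ (λ x → a * g x) xs ≈ a * ∑ g xs
      ∑-*ˡ a g []       = sym (zeroʳ a)
      ∑-*ˡ a g (x ∷ xs) = trans (+-congˡ (∑-*ˡ a g xs)) (sym (distribˡ a _ _))

      ∑-*ʳ : ∀ {A : Set} a (g : A → Carrier) xs → ∑ (λ x → g x * a) xs ≈ ∑ g xs * a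
      ∑-*ʳ a g []       = sym (zeroˡ a)
      ∑-*ʳ a g (x ∷ xs) = trans (+-congˡ (∑-*ʳ a g xs)) (sym (distribʳ a _ _))

      ∑-swap : ∀ {A B : Set} (g : A → B → Carrier) xs ys → ∑ (λ x → ∑ (g x) ys) xs ≈ ∑ (λ y → ∑ (λ x → g x y) xs) ys
      ∑-swap g []       ys = sym (∑-0 (λ _ → refl) ys)
      ∑-swap g (x ∷ xs) ys = trans (+-congˡ (∑-swap g xs ys)) (sym (∑-+ (g x) _ ys))

      ∑-product : ∀ {A B D : Set} (g : D → Carrier) (h : A → B → D) xs ys → ∑ g (cartesianProductWith h xs ys) ≈ ∑ (λ x → ∑ (λ y → g (h x y)) ys) xs
      ∑-product g h []       ys = refl
      ∑-product g h (x ∷ xs) ys = trans (∑-++ g (List.map (h x) ys) _) (+-cong (∑-map g (h x) ys) (∑-product g h xs ys))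

      sum≈∑ : ∀ (g : ℕ → Carrier) (h : ℕ → ℕ) n → sum {n} (λ i → g (h (toℕ i))) ≈ ∑ g (applyUpTo h n)
      sum≈∑ g h zero    = refl
      sum≈∑ g h (suc n) = +-congˡ (sum≈∑ g (h ∘ suc) n)

  val : ℕ → List ℕ → ℕ
  val p []       = 0
  val p (k ∷ ks) = k ℕ.+ p ℕ.* val p ks

  -- For digits below p these are, by Lucas, the summands of k whose binomial coefficient is prime
  -- to p; all others disappear in characteristic p.
  subs : List ℕ → List (List ℕ)
  subs []       = [] ∷ []
  subs (k ∷ ks) = cartesianProductWith _∷_ (upTo (suc k)) (subs ks)

  minus : List ℕ → List ℕ → List ℕ
  minus = List.zipWith _∸_

  binom : List ℕ → List ℕ → ℕ
  binom (k ∷ ks) (j ∷ js) = (k C j) ℕ.* binom ks js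
  binom _        _        = 1

  module Expansion {c ℓ : Level} (R : CommutativeSemiring c ℓ) {p : ℕ} (p-prime : Prime p) where

    open CommutativeSemiring R
    open ListSums R
    open Binomials p-prime
    open import Algebra.Properties.Semiring.Sum semiring using (sum)
    open import Algebra.Properties.Semiring.Mult semiring
    open import Algebra.Properties.Semiring.Exp semiring
    open import Algebra.Properties.CommutativeSemiring.Binomial R using (theorem)
    open import Algebra.Properties.CommutativeSemigroup *-commutativeSemigroup using (interchange)
    open import Relation.Binary.Reasoning.Setoid setoid

    module _ (p≈0 : p × 1# ≈ 0#) where

      opaque
        p×≈0 : ∀ x → p × x ≈ 0#
        p×≈0 x = trans (×-congʳ p (sym (*-identityˡ x))) (trans (sym (×-assoc-* p 1# x)) (trans (*-congʳ p≈0) (zeroˡ x)))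

        p∣⇒×≈0 : ∀ {m} x → p ∣ m → m × x ≈ 0#
        p∣⇒×≈0 x (divides k ≡.refl) = trans (sym (×-assocˡ x k p)) (trans (×-congʳ k (p×≈0 x)) (k×0 k))
          where
          k×0 : ∀ k → k × 0# ≈ 0#
          k×0 zero    = refl
          k×0 (suc k) = trans (+-identityˡ _) (k×0 k)

        binomialSum : ∀ k x y → (x + y) ^ k ≈ ∑ (λ j → (k C j) × (x ^ j * y ^ (k ∸ j))) (upTo (suc k))
        binomialSum k x y = trans (theorem k x y) (sum≈∑ (λ j → (k C j) × (x ^ j * y ^ (k ∸ j))) id (suc k))

        ∑-ends : ∀ (g : ℕ → Carrier) h m → (∀ i → i < m → g (h i) ≈ 0#) → ∑ g (applyUpTo h (suc m)) ≈ g (h m)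
        ∑-ends g h zero    z = +-identityʳ _
        ∑-ends g h (suc m) z = trans (+-congʳ (z 0 z<s)) (trans (+-identityˡ _) (∑-ends g (h ∘ suc) m λ i i<m → z (suc i) (s<s i<m)))

        frobenius : ∀ x y → (x + y) ^ p ≈ x ^ p + y ^ p
        frobenius x y = begin
          (x + y) ^ p                          ≈⟨ binomialSum p x y ⟩
          ∑ g (upTo (suc p))                   ≡⟨⟩
          g 0 + ∑ g (applyUpTo suc p)          ≈⟨ +-cong (trans (+-identityʳ _) (*-identityˡ _)) rest ⟩
          y ^ p + x ^ p                        ≈⟨ +-comm _ _ ⟩
          x ^ p + y ^ p                        ∎
          where
          g : ℕ → Carrier
          g j = (p C j) × (x ^ j * y ^ (p ∸ j))
          top : g p ≈ x ^ p
          top = trans (×-congˡ (nCn≡1 p)) (trans (+-identityʳ _) (trans (*-congˡ (^-congʳ y (ℕₚ.n∸n≡0 p))) (*-identityʳ _)))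
          sp : suc (ℕ.pred p) ≡ p
          sp = ℕₚ.suc-pred p {{prime⇒nonZero p-prime}}
          rest : ∑ g (applyUpTo suc p) ≈ x ^ p
          rest = ≡.subst (λ m → ∑ g (applyUpTo suc m) ≈ x ^ p) sp (trans (∑-ends g suc (ℕ.pred p) λ i i<p′ → p∣⇒×≈0 _ (p∣pCk (suc i) z<s (≡.subst (suc (suc i) ℕ.≤_) sp (s<s i<p′))))
            (≡.subst (λ m → g m ≈ x ^ p) (≡.sym sp) top))

        ×-^-merge : ∀ a b u v u′ v′ → (a × (u * v)) * (b × (u′ * v′)) ≈ (a ℕ.* b) × ((u * u′) * (v * v′))
        ×-^-merge a b u v u′ v′ = trans (×-assoc-* a _ _) (trans (×-congʳ a (×-comm-* b _ _)) (trans (×-assocˡ _ a b) (×-congʳ (a ℕ.* b) (interchange _ _ _ _))))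

        -- Frobenius makes `(x + y) ^ (p * m)` a power of `x ^ p + y ^ p`, so each digit contributes
        -- its own binomial sum and the induction continues with `x ^ p` and `y ^ p`.
        expand : ∀ ks x y → (x + y) ^ val p ks ≈ ∑ (λ js → binom ks js × (x ^ val p js * y ^ val p (minus ks js))) (subs ks)
        expand []       x y = sym (trans (+-identityʳ _) (trans (+-identityʳ _) (*-identityˡ _)))
        expand (k ∷ ks) x y = begin
          (x + y) ^ (k ℕ.+ p ℕ.* val p ks)            ≈⟨ ^-homo-* (x + y) k _ ⟩
          (x + y) ^ k * (x + y) ^ (p ℕ.* val p ks)    ≈⟨ *-cong (binomialSum k x y) (sym (^-assocʳ (x + y) p _)) ⟩
          ∑ g (upTo (suc k)) * ((x + y) ^ p) ^ val p ks ≈⟨ *-congˡ (trans (^-congˡ (val p ks) (frobenius x y)) (expand ks (x ^ p) (y ^ p))) ⟩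
          ∑ g (upTo (suc k)) * ∑ h (subs ks)          ≈⟨ ∑-*ʳ _ g (upTo (suc k)) ⟨
          ∑ (λ j → g j * ∑ h (subs ks)) (upTo (suc k)) ≈⟨ ∑-cong (λ j → trans (sym (∑-*ˡ (g j) h (subs ks))) (∑-cong (term j) (subs ks))) (upTo (suc k)) ⟩
          ∑ (λ j → ∑ (λ js → e (j ∷ js)) (subs ks)) (upTo (suc k)) ≈⟨ ∑-product e _∷_ (upTo (suc k)) (subs ks) ⟨
          ∑ e (subs (k ∷ ks))                         ∎
          where
          g : ℕ → Carrier
          g j = (k C j) × (x ^ j * y ^ (k ∸ j))
          h : List ℕ → Carrier
          h js = binom ks js × ((x ^ p) ^ val p js * (y ^ p) ^ val p (minus ks js))
          e : List ℕ → Carrier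
          e js = binom (k ∷ ks) js × (x ^ val p js * y ^ val p (minus (k ∷ ks) js))
          term : ∀ j js → g j * h js ≈ e (j ∷ js)
          term j js = trans (×-^-merge (k C j) (binom ks js) _ _ _ _) (×-congʳ ((k C j) ℕ.* binom ks js)
            (*-cong (trans (*-congˡ (^-assocʳ x p (val p js))) (sym (^-homo-* x j _))) (trans (*-congˡ (^-assocʳ y p (val p (minus ks js)))) (sym (^-homo-* y (k ∸ j) _)))))

-- Units, colours and norms

module Compositions (p f : Data.Nat.ℕ) (1<p : 1 Data.Nat.< p) {{f≢0 : Data.Nat.NonZero f}} where

  open Multisets
  open Expansions using (val; subs; minus)
  open import Defs using (digitSum; digitSum′)
  open import Data.Nat hiding (compare)
  open import Data.Nat.Properties
  open import Data.Nat.DivMod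
  open import Data.Nat.Divisibility
  open import Data.Nat.Induction using (<-wellFounded)
  open import Algebra.Properties.CommutativeSemigroup +-commutativeSemigroup using (interchange; xy∙z≈xz∙y; xy∙z≈x∙zy; xy∙z≈yz∙x; xy∙z≈y∙zx; xy∙z≈zx∙y; xy∙z≈zy∙x; x∙yz≈xz∙y; x∙yz≈y∙xz; x∙yz≈zy∙x; x∙yz≈z∙xy)
  open import Data.Nat.Solver using (module +-*-Solver)
  open +-*-Solver using (solve; _:+_; _:*_; _:=_; con)
  open import Data.List.Base using (List; []; _∷_; _++_; replicate; upTo; length)
  open import Data.List.Properties using (∷-injective)
  open import Data.List.Relation.Unary.All using (All; []; _∷_)
  open import Data.List.Relation.Unary.AllPairs using ([]; _∷_)
  open import Data.List.Relation.Unary.Any using (here)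
  open import Data.List.Relation.Unary.Unique.Propositional using (Unique)
  open import Data.List.Relation.Unary.Unique.Propositional.Properties using (cartesianProductWith⁺; upTo⁺)
  open import Data.List.Membership.Propositional using (_∈_)
  open import Data.List.Membership.Propositional.Properties using (∈-cartesianProductWith⁺; ∈-cartesianProductWith⁻; ∈-upTo⁺; ∈-upTo⁻)
  open import Data.Product using (Σ; ∃; ∃₂; _×_; _,_; proj₁; proj₂)
  open import Data.Sum using (_⊎_; inj₁; inj₂)
  open import Data.Empty using (⊥-elim)
  open import Data.Unit using (⊤; tt)
  open import Function using (_∘_; case_of_)
  open import Induction.WellFounded using (Acc; acc)
  open import Relation.Nullary using (¬_; Dec; yes; no)
  open import Relation.Binary.PropositionalEquality

  instance
    p≢0 : NonZero p
    p≢0 = >-nonZero (<-trans z<s 1<p)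

  q n : ℕ
  q = p ^ f
  n = pred q

  instance
    q≢0 : NonZero q
    q≢0 = m^n≢0 p f

  opaque
    1+n≡q : suc n ≡ q
    1+n≡q = suc-pred q

  open Congruence n

  opaque
    p≤q : p ≤ q
    p≤q = subst (_≤ q) (*-identityʳ p) (^-monoʳ-≤ p (>-nonZero⁻¹ f))

    0<n : 0 < n
    0<n = ≤-pred (subst (2 ≤_) (sym 1+n≡q) (≤-trans 1<p p≤q))

    q≈1 : q ≈ₙ 1
    q≈1 = 0 , 1 , trans (+-identityʳ q) (trans (sym 1+n≡q) (cong suc (sym (+-identityʳ n))))

    q^k≈1 : ∀ k → q ^ k ≈ₙ 1
    q^k≈1 zero    = ≡⇒≈ₙ refl
    q^k≈1 (suc k) = ≈ₙ-trans (≈ₙ-* q (q^k≈1 k)) (≈ₙ-trans (≡⇒≈ₙ (*-identityʳ q)) q≈1)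

  v : ℕ → ℕ
  v e = p ^ e

  -- A unit e stands for pᵉ, and e mod f is its colour. Modulo n = q − 1 the unit pʲ⁺ᵉ reduces to ω j e, so that
  -- Σ[ ω j ] of the units of k is the digit sum l(k pʲ).
  pos : ℕ → ℕ → ℕ
  pos j e = (e + j) % f

  ω : ℕ → ℕ → ℕ
  ω j e = p ^ pos j e

  opaque
    pos<f : ∀ j e → pos j e < f
    pos<f j e = m%n<n (e + j) f

    0<p^ : ∀ k → 0 < p ^ k
    0<p^ k = m^n>0 p k

    p^<q : ∀ {k} → k < f → p ^ k < q
    p^<q k<f = ^-monoʳ-< p 1<p k<f

    p^≤n : ∀ {k} → k < f → p ^ k ≤ n
    p^≤n k<f = ≤-pred (subst (_ <_) (sym 1+n≡q) (p^<q k<f))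

    p^-mod : ∀ k → p ^ k ≈ₙ p ^ (k % f)
    p^-mod k = ≈ₙ-trans
      (≡⇒≈ₙ (trans (cong (p ^_) (m≡m%n+[m/n]*n k f))
            (trans (^-distribˡ-+-* p (k % f) (k / f * f))
                   (cong (p ^ (k % f) *_) (trans (cong (p ^_) (*-comm (k / f) f)) (sym (^-*-assoc p f (k / f))))))))
      (≈ₙ-trans (≈ₙ-* (p ^ (k % f)) (q^k≈1 (k / f))) (≡⇒≈ₙ (*-identityʳ _)))

    p^j*v≈ω : ∀ j e → p ^ j * v e ≈ₙ ω j e
    p^j*v≈ω j e = ≈ₙ-trans
      (≡⇒≈ₙ (trans (*-comm (p ^ j) (v e)) (sym (^-distribˡ-+-* p e j)))) (p^-mod (e + j))

    Σ-≈ₙ : ∀ {φ ψ} → (∀ e → φ e ≈ₙ ψ e) → ∀ X → Σ[ φ ] X ≈ₙ Σ[ ψ ] X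
    Σ-≈ₙ eq []      = ≡⇒≈ₙ refl
    Σ-≈ₙ eq (x ∷ X) = ≈ₙ-+ (eq x) (Σ-≈ₙ eq X)

    v⇒ω : ∀ j X → p ^ j * Σ[ v ] X ≈ₙ Σ[ ω j ] X
    v⇒ω j X = ≈ₙ-trans (≡⇒≈ₙ (sym (Σ-* (p ^ j) v X))) (Σ-≈ₙ (p^j*v≈ω j) X)

    ω-cong : ∀ j {X Y} → Σ[ v ] X ≈ₙ Σ[ v ] Y → Σ[ ω j ] X ≈ₙ Σ[ ω j ] Y
    ω-cong j {X} {Y} eq = ≈ₙ-trans (≈ₙ-sym (v⇒ω j X)) (≈ₙ-trans (≈ₙ-* (p ^ j) eq) (v⇒ω j Y))

    -- `p ^ (j * pred f)` inverts `p ^ j` modulo n, the product being q^j. Hence a congruence of a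
    -- single norm already gives a congruence of the values (`ω-cancel`).
    p^jf≈ : ∀ j a → p ^ (j * pred f) * (p ^ j * a) ≈ₙ a
    p^jf≈ j a = ≈ₙ-trans (≡⇒≈ₙ (trans (sym (*-assoc (p ^ (j * pred f)) (p ^ j) a)) (trans (cong (_* a) eq) (*-comm (q ^ j) a))))
      (≈ₙ-trans (≈ₙ-* a (q^k≈1 j)) (≡⇒≈ₙ (*-identityʳ a)))
      where
      eq : p ^ (j * pred f) * p ^ j ≡ q ^ j
      eq = trans (sym (^-distribˡ-+-* p (j * pred f) j))
          (trans (cong (p ^_) (trans (trans (+-comm (j * pred f) j) (sym (*-suc j (pred f)))) (trans (cong (j *_) (suc-pred f)) (*-comm j f))))
                 (sym (^-*-assoc p f j)))

    ω-cancel : ∀ j {X Y} → Σ[ ω j ] X ≈ₙ Σ[ ω j ] Y → Σ[ v ] X ≈ₙ Σ[ v ] Y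
    ω-cancel j {X} {Y} eq = ≈ₙ-trans (≈ₙ-sym (p^jf≈ j _))
      (≈ₙ-trans (≈ₙ-* (p ^ (j * pred f)) (≈ₙ-trans (v⇒ω j X) (≈ₙ-trans eq (≈ₙ-sym (v⇒ω j Y))))) (p^jf≈ j _))

    -- `e * pred f` stands for -e modulo f: it is the rotation that brings e to position 0.
    pos-own : ∀ e → pos (e * pred f) e ≡ 0
    pos-own e = trans (cong (_% f) (trans (sym (*-suc e (pred f))) (cong (e *_) (suc-pred f)))) (m*n%n≡0 e f)

    unit≈ : ∀ j e Z → pos j e ≡ 0 → Σ[ ω j ] Z ≈ₙ 1 → Σ[ v ] Z ≈ₙ v e
    unit≈ j e Z e0 Z≈1 = ≈ₙ-trans (ω-cancel j {Z} {e ∷ []} (≈ₙ-trans Z≈1 (≡⇒≈ₙ (trans (sym (cong (p ^_) e0)) (sym (+-identityʳ _)))))) (≡⇒≈ₙ (+-identityʳ _))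

  -- Packets of prescribed norm or residue

  Split : List ℕ → List ℕ → List ℕ → Set
  Split X Z R = ∀ φ → Σ[ φ ] X ≡ Σ[ φ ] Z + Σ[ φ ] R

  module _ (π : ℕ → ℕ) where

    Below : ℕ → List ℕ → Set
    Below t X = Σ[ (λ e → ⟦ t <? π e ⟧) ] X ≡ 0

    Exact : ℕ → List ℕ → Set
    Exact s X = ∃₂ λ Z R → Split X Z R × Σ[ (λ e → p ^ π e) ] Z ≡ s

    opaque
      multiple : ∀ t → (∀ X → Below t X → p ^ t ≤ Σ[ (λ e → p ^ π e) ] X → Exact (p ^ t) X) →
        ∀ i X → Below t X → i * p ^ t ≤ Σ[ (λ e → p ^ π e) ] X → Exact (i * p ^ t) X
      multiple t one zero    X b h = [] , X , (λ φ → refl) , refl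
      multiple t one (suc i) X b h with one X b (≤-trans (m≤m+n _ _) h)
      ... | Z , R , sp , eq with multiple t one i R (m+n≡0⇒n≡0 (Σ[ _ ] Z) (trans (sym (sp _)) b))
               (+-cancelˡ-≤ (p ^ t) _ _ (subst (p ^ t + i * p ^ t ≤_) (trans (sp _) (cong (_+ _) eq)) h))
      ...   | Z′ , R′ , sp′ , eq′ = Z ++ Z′ , R′ ,
                (λ φ → trans (sp φ) (trans (cong (_ +_) (sp′ φ)) (trans (sym (+-assoc (Σ[ φ ] Z) _ _)) (cong (_+ Σ[ φ ] R′) (sym (Σ-++ φ Z Z′)))))) ,
                trans (Σ-++ _ Z Z′) (cong₂ _+_ eq eq′)

      single : ∀ X {t} e X′ → π e ≡ t → (∀ ψ → Σ[ ψ ] X ≡ ψ e + Σ[ ψ ] X′) → Exact (p ^ t) X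
      single X e X′ refl eq = e ∷ [] , X′ , (λ φ → trans (eq φ) (cong (_+ Σ[ φ ] X′) (sym (+-identityʳ (φ e))))) , +-identityʳ _

    -- Change-making: each denomination divides the next one.
    opaque
      pay : ∀ t X → Below t X → p ^ t ≤ Σ[ (λ e → p ^ π e) ] X → Exact (p ^ t) X
      pay zero X b h with Σ-find _ X h
      ... | e , X′ , _ , eq = single X e X′
              (n≤0⇒n≡0 (≮⇒≥ (⟦⟧≡0 (0 <? π e) (m+n≡0⇒m≡0 _ (trans (sym (eq _)) b))))) eq
      pay (suc t) X b h with 0⊎pos (Σ[ (λ e → ⟦ π e ≟ suc t ⟧) ] X)
      ... | inj₂ some with Σ-find _ X some
      ...   | e , X′ , is , eq = single X e X′ (⟦⟧>0 (π e ≟ suc t) is) eq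
      pay (suc t) X b h | inj₁ none = multiple t (pay t) p X (trans
          (Σ-cong₀ {χ = λ e → ⟦ suc t <? π e ⟧ + ⟦ π e ≟ suc t ⟧} pt X (trans (Σ-+ _ _ X) (cong₂ _+_ b none))) (Σ-zero X)) h
        where
        Σ-zero : ∀ X → Σ[ (λ _ → 0) ] X ≡ 0
        Σ-zero []      = refl
        Σ-zero (x ∷ X) = Σ-zero X
        pt : ∀ e → ⟦ suc t <? π e ⟧ + ⟦ π e ≟ suc t ⟧ ≡ 0 → ⟦ t <? π e ⟧ ≡ 0
        pt e z = ⟦⟧-no (t <? π e) λ t<π → ⟦⟧≡0 (suc t <? π e) (m+n≡0⇒m≡0 _ z)
          (≤∧≢⇒< t<π (⟦⟧≡0 (π e ≟ suc t) (m+n≡0⇒n≡0 ⟦ suc t <? π e ⟧ z) ∘ sym))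

  opaque
    -- q itself is not a denomination; it is paid as p times the largest one, p^(f - 1).
    pay-q : ∀ j X → q ≤ Σ[ ω j ] X → Exact (pos j) q X
    pay-q j X h = subst (λ s → Exact (pos j) s X) eq
      (multiple (pos j) (pred f) (pay (pos j) (pred f)) p X bel (subst (_≤ Σ[ ω j ] X) (sym eq) h))
      where
      eq : p * p ^ pred f ≡ q
      eq = cong (p ^_) (suc-pred f)
      bel : Below (pos j) (pred f) X
      bel = trans (Σ-cong {ψ = λ _ → 0 * 0} (λ e → ⟦⟧-no (pred f <? pos j e) (λ lt → <⇒≱ (pos<f j e) (subst (_≤ pos j e) (suc-pred f) lt))) X) (Σ-* 0 (λ _ → 0) X)

  unit : ℕ → ℕ → ℕ
  unit j e = ⟦ pos j e ≟ 0 ⟧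

  opaque
    p∤n : ¬ p ∣ n
    p∤n p∣n = <⇒≱ 1<p (∣⇒≤ (∣m+n∣m⇒∣n (subst (p ∣_) (trans (sym 1+n≡q) (+-comm 1 n)) p∣q) p∣n))
      where
      p∣q : p ∣ q
      p∣q = subst (p ∣_) (cong (p ^_) (suc-pred f)) (m∣m*n (p ^ pred f))

    -- Units outside position 0 contribute multiples of p. Together with `p∤n` this finds a unit of
    -- the wanted colour in every part of norm exactly n.
    no-unit⇒p∣ : ∀ j X → Σ[ unit j ] X ≡ 0 → p ∣ Σ[ ω j ] X
    no-unit⇒p∣ j []      _ = p ∣0
    no-unit⇒p∣ j (x ∷ X) z = ∣m∣n⇒∣m+n (go (pos j x) (⟦⟧≡0 (pos j x ≟ 0) (m+n≡0⇒m≡0 (unit j x) z))) (no-unit⇒p∣ j X (m+n≡0⇒n≡0 (unit j x) z))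
      where
      go : ∀ k → ¬ (k ≡ 0) → p ∣ p ^ k
      go zero    k≢0 = ⊥-elim (k≢0 refl)
      go (suc k) _   = m∣m*n (p ^ k)

    positive : ∀ {φ ψ} X → 0 < Σ[ φ ] X → (∀ e → 0 < ψ e) → 0 < Σ[ ψ ] X
    positive {φ} {ψ} X h pos with Σ-find φ X h
    ... | e , X′ , _ , eq = subst (0 <_) (sym (eq ψ)) (≤-trans (pos e) (m≤m+n (ψ e) _))

  0<v : ∀ e → 0 < v e
  0<v = 0<p^

  0<ω : ∀ j e → 0 < ω j e
  0<ω j e = 0<p^ (pos j e)

  -- A packet inside `X` congruent to every unit in position 0 of rotation `j`, hence exchangeable
  -- for it (`unit≈`).
  UnitPart : ℕ → List ℕ → Set
  UnitPart j X = ∃₂ λ Z R → Split X Z R × 0 < Σ[ v ] Z × Σ[ ω j ] Z ≈ₙ 1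

  opaque
    unitPart : ∀ j X → 0 < Σ[ unit j ] X ⊎ q ≤ Σ[ ω j ] X → UnitPart j X
    unitPart j X (inj₁ h) with Σ-find (unit j) X h
    ... | e , R , is , eq = e ∷ [] , R , (λ φ → trans (eq φ) (cong (_+ Σ[ φ ] R) (sym (+-identityʳ (φ e))))) ,
            ≤-trans (0<v e) (m≤m+n _ _) ,
            ≡⇒≈ₙ (trans (+-identityʳ _) (cong (p ^_) (⟦⟧>0 (pos j e ≟ 0) is)))
    unitPart j X (inj₂ h) with pay-q j X h
    ... | Z , R , sp , eq = Z , R , sp , positive {ω j} Z (subst (0 <_) (sym eq) (0<p^ f)) 0<v , ≈ₙ-trans (≡⇒≈ₙ eq) q≈1

    -- Without a unit in position 0 the norm is a multiple of p, hence not n, hence at least n + 1 =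
    -- q.
    unit⊎q : ∀ j X → n ≤ Σ[ ω j ] X → 0 < Σ[ unit j ] X ⊎ q ≤ Σ[ ω j ] X
    unit⊎q j X h with 0⊎pos (Σ[ unit j ] X)
    ... | inj₂ some = inj₁ some
    ... | inj₁ none = inj₂ (subst (_≤ Σ[ ω j ] X) 1+n≡q (≤∧≢⇒< h λ eq → p∤n (subst (p ∣_) (sym eq) (no-unit⇒p∣ j X none))))

  -- These are the conditions under which the power sum over the field with this exponent is
  -- nonzero, see `σ-0`, `σ-∤` and `σ-∣`.
  record Λ⁺ (Y : List ℕ) : Set where
    constructor _,_
    field
      nonempty  : 0 < Σ[ v ] Y
      divisible : Σ[ v ] Y ≈ₙ 0
  open Λ⁺

  Λ⁺-ω≈0 : ∀ {Y} → Λ⁺ Y → ∀ j → Σ[ ω j ] Y ≈ₙ 0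
  Λ⁺-ω≈0 {Y} (_ , z) j = ≈ₙ-trans (≈ₙ-sym (v⇒ω j Y)) (≈ₙ-trans (≈ₙ-* (p ^ j) z) (≡⇒≈ₙ (*-zeroʳ (p ^ j))))

  opaque
    Λ⁺-norm : ∀ {Y} → Λ⁺ Y → ∀ j → n ≤ Σ[ ω j ] Y
    Λ⁺-norm {Y} l j = ≈ₙ-gap (Λ⁺-ω≈0 l j) (positive {v} Y (nonempty l) (0<ω j))

    -- The norms of a part are positive multiples of n: a part either has an excess of n to give
    -- away or is tight.
    Λ⁺-exact : ∀ {Y} → Λ⁺ Y → ∀ j → ¬ (n + n ≤ Σ[ ω j ] Y) → Σ[ ω j ] Y ≡ n
    Λ⁺-exact {Y} l j h with n <? Σ[ ω j ] Y
    ... | yes lt = ⊥-elim (h (≈ₙ-gap (≈ₙ-trans (Λ⁺-ω≈0 l j) (≈ₙ-sym n≈0)) lt))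
    ... | no  ≮  = ≤-antisym (≮⇒≥ ≮) (Λ⁺-norm l j)

  -- The (i+1)-st of the m + 1 parts collects the base-p digits of k that are spent on the coefficient of tⁱ; summing a
  -- coefficient over the field leaves only nonempty parts divisible by q − 1, the leading coefficient is unconstrained.
  -- W is the resulting exponent of t.
  data Conf : ℕ → Set where
    free : List ℕ → Conf 0
    cons : ∀ {m} (Y : List ℕ) → Λ⁺ Y → Conf m → Conf (suc m)

  tot : ∀ {m} → (ℕ → ℕ) → Conf m → ℕ
  tot φ (free F)     = Σ[ φ ] F
  tot φ (cons Y _ C) = Σ[ φ ] Y + tot φ C

  W : ∀ {m} → Conf m → ℕ
  W (free F)     = 0
  W (cons Y _ C) = tot v C + W C

  tot-norm : ∀ {m} (C : Conf m) j → m * n ≤ tot (ω j) C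
  tot-norm (free F)     j = z≤n
  tot-norm (cons Y l C) j = +-mono-≤ (Λ⁺-norm l j) (tot-norm C j)

  tot-mono : ∀ {m φ ψ} → (∀ e → φ e ≤ ψ e) → (C : Conf m) → tot φ C ≤ tot ψ C
  tot-mono h (free F)     = Σ-mono h F
  tot-mono h (cons Y _ C) = +-mono-≤ (Σ-mono h Y) (tot-mono h C)

  tot-+ : ∀ {m} φ ψ (C : Conf m) → tot (λ e → φ e + ψ e) C ≡ tot φ C + tot ψ C
  tot-+ φ ψ (free F)     = Σ-+ φ ψ F
  tot-+ φ ψ (cons Y _ C) = trans (cong₂ _+_ (Σ-+ φ ψ Y) (tot-+ φ ψ C))
    (interchange (Σ[ φ ] Y) (Σ[ ψ ] Y) (tot φ C) (tot ψ C))

  -- Exchanges between the parts of a composition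

  is : ℕ → ℕ → ℕ
  is e x = ⟦ x ≟ e ⟧

  opaque
    find-is : ∀ e X → 0 < Σ[ is e ] X → ∃ λ X′ → ∀ ψ → Σ[ ψ ] X ≡ ψ e + Σ[ ψ ] X′
    find-is e X h with Σ-find (is e) X h
    ... | x , X′ , eq , sp with ⟦⟧>0 (x ≟ e) eq
    ...   | refl = X′ , sp

    -- The part that holds `e` keeps its residue. When `z` is at most `v e`, the total of every tail
    -- of `C` can only drop, and `W` is built from such totals.
    replace : ∀ {m} (C : Conf m) e z → 0 < tot (is e) C → Σ[ v ] z ≈ₙ v e → 0 < Σ[ v ] z →
      ∃ λ (C′ : Conf m) → (∀ φ → tot φ C′ + φ e ≡ tot φ C + Σ[ φ ] z) × (Σ[ v ] z ≤ v e → W C′ ≤ W C)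
    replace (free F) e z h z≈e 0<z with find-is e F h
    ... | F′ , sp = free (z ++ F′) , eq , λ _ → z≤n
      where
      eq : ∀ φ → Σ[ φ ] (z ++ F′) + φ e ≡ Σ[ φ ] F + Σ[ φ ] z
      eq φ rewrite Σ-++ φ z F′ | sp φ = xy∙z≈zy∙x (Σ[ φ ] z) (Σ[ φ ] F′) (φ e)
    replace (cons Y l C) e z h z≈e 0<z with 0⊎pos (Σ[ is e ] Y)
    ... | inj₂ inside with find-is e Y inside
    ...   | Y′ , sp = cons (z ++ Y′) l′ C , eq , λ _ → ≤-refl
      where
      l′ : Λ⁺ (z ++ Y′)
      l′ = subst (0 <_) (sym (Σ-++ v z Y′)) (≤-trans 0<z (m≤m+n _ _)) ,
           ≈ₙ-trans (≡⇒≈ₙ (Σ-++ v z Y′)) (≈ₙ-trans (≈ₙ-+ z≈e (≡⇒≈ₙ refl)) (≈ₙ-trans (≡⇒≈ₙ (sym (sp v))) (divisible l)))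
      eq : ∀ φ → (Σ[ φ ] (z ++ Y′) + tot φ C) + φ e ≡ (Σ[ φ ] Y + tot φ C) + Σ[ φ ] z
      eq φ rewrite Σ-++ φ z Y′ | sp φ = solve 4 (λ a b c d → ((a :+ b) :+ d) :+ c := ((c :+ b) :+ d) :+ a) refl (Σ[ φ ] z) (Σ[ φ ] Y′) (φ e) (tot φ C)
    replace (cons Y l C) e z h z≈e 0<z | inj₁ outside with replace C e z (subst (λ a → 0 < a + tot (is e) C) outside h) z≈e 0<z
    ... | C′ , eq′ , cost = cons Y l C′ , eq , λ z≤e → +-mono-≤ (+-cancelʳ-≤ (v e) _ _ (≤-trans (≤-reflexive (eq′ v)) (+-monoʳ-≤ (tot v C) z≤e))) (cost z≤e)
      where
      eq : ∀ φ → (Σ[ φ ] Y + tot φ C′) + φ e ≡ (Σ[ φ ] Y + tot φ C) + Σ[ φ ] z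
      eq φ = trans (+-assoc (Σ[ φ ] Y) _ _) (trans (cong (Σ[ φ ] Y +_) (eq′ φ)) (sym (+-assoc (Σ[ φ ] Y) _ _)))

  Same : ∀ {m k} → Conf m → Conf k → Set
  Same C C′ = ∀ φ → tot φ C ≡ tot φ C′

  opaque
    -- `z` takes the place of `N`, wherever that sits in `C`, and `N` enters the first part; so at
    -- least one tail trades `v N` for the value of `z`.
    swapUp : ∀ {m} (C : Conf m) {T} (l : Λ⁺ T) {z R} N → Split T z R → Σ[ v ] z ≈ₙ v N → 0 < Σ[ v ] z → 0 < tot (is N) C → Σ[ v ] z ≤ v N →
      ∃ λ (C′ : Conf (suc m)) → Same C′ (cons T l C) × W C′ + v N ≤ W (cons T l C) + Σ[ v ] z
    swapUp C {T} l {z} {R} N sp z≈N 0<z N∈C z≤N with replace C N z N∈C z≈N 0<z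
    ... | C′ , eq , cost = cons (N ∷ R) l′ C′ , same , (begin
      tot v C′ + W C′ + v N    ≡⟨ xy∙z≈xz∙y (tot v C′) (W C′) (v N) ⟩
      (tot v C′ + v N) + W C′  ≡⟨ cong (_+ W C′) (eq v) ⟩
      (tot v C + Σ[ v ] z) + W C′ ≤⟨ +-monoʳ-≤ (tot v C + Σ[ v ] z) (cost z≤N) ⟩
      (tot v C + Σ[ v ] z) + W C ≡⟨ xy∙z≈xz∙y (tot v C) (Σ[ v ] z) (W C) ⟩
      (tot v C + W C) + Σ[ v ] z ∎)
      where
      open ≤-Reasoning
      l′ : Λ⁺ (N ∷ R)
      l′ = ≤-trans (0<v N) (m≤m+n _ _) , ≈ₙ-trans (≈ₙ-+ (≈ₙ-sym z≈N) (≡⇒≈ₙ refl)) (≈ₙ-trans (≡⇒≈ₙ (sym (sp v))) (divisible l))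
      same : ∀ φ → (φ N + Σ[ φ ] R) + tot φ C′ ≡ Σ[ φ ] T + tot φ C
      same φ = trans (xy∙z≈zx∙y (φ N) (Σ[ φ ] R) (tot φ C′))
        (trans (cong (_+ Σ[ φ ] R) (eq φ)) (trans (xy∙z≈yz∙x (tot φ C) (Σ[ φ ] z) (Σ[ φ ] R))
          (cong (_+ tot φ C) (sym (sp φ)))))

  -- The charge for one push: each unit below `N` in position 0 counts with its value, since each
  -- may sink by one part.
  χ : ℕ → ℕ → ℕ → ℕ
  χ N j e = ⟦ e <? N ⟧ * (unit j e * v e)

  χ>0 : ∀ N j e → 0 < χ N j e → e < N × pos j e ≡ 0
  χ>0 N j e h with e <? N | pos j e ≟ 0
  ... | yes a | yes b = a , b

  χ-yes : ∀ N j e → e < N → pos j e ≡ 0 → χ N j e ≡ v e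
  χ-yes N j e a b rewrite ⟦⟧-yes (e <? N) a | ⟦⟧-yes (pos j e ≟ 0) b = trans (+-identityʳ _) (+-identityʳ _)

  -- What a push needs in a tight part: a unit of the pushed colour that lies below `N`, so that `χ`
  -- covers its sinking.
  Exchangeable : ∀ {m} → ℕ → ℕ → Conf m → Set
  Exchangeable N j (free F)     = ⊤
  Exchangeable N j (cons Y _ C) = (Σ[ ω j ] Y ≡ n → 0 < Σ[ χ N j ] Y) × Exchangeable N j C

  -- Insert w, passing on a unit of the same colour through every bin without excess, and
  -- pay q out of the first bin that has one: no unit sinks by more than one bin.
  opaque
    push : ∀ N j {m} (C : Conf m) w → pos j w ≡ 0 → Exchangeable N j C → n + m * n ≤ tot (ω j) C →
      ∃₂ λ z (C′ : Conf m) → (∀ φ → tot φ C′ + Σ[ φ ] z ≡ tot φ C + φ w) × Σ[ ω j ] z ≡ q × W C′ ≤ W C + tot (χ N j) C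
    push N j (free F) w w0 ex h with pay-q j (w ∷ F) (subst₂ _≤_ 1+n≡q (cong (_+ Σ[ ω j ] F) (sym (cong (p ^_) w0))) (s≤s (subst (_≤ Σ[ ω j ] F) (+-identityʳ n) h)))
    ... | z , R , sp , eq = z , free R , (λ φ → trans (+-comm (Σ[ φ ] R) _) (trans (sym (sp φ)) (+-comm (φ w) _))) , eq , z≤n
    push N j (cons {m} Y l C) w w0 ex h with n + n ≤? Σ[ ω j ] Y
    ... | yes excess with pay-q j (w ∷ Y) (subst₂ _≤_ 1+n≡q (cong (_+ Σ[ ω j ] Y) (sym (cong (p ^_) w0))) (s≤s (≤-trans (m≤m+n n n) excess)))
    ...   | z , R , sp , eq = z , cons R l′ C , (λ φ → trans (xy∙z≈zx∙y (Σ[ φ ] R) (tot φ C) (Σ[ φ ] z))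
              (trans (cong (_+ tot φ C) (sym (sp φ))) (xy∙z≈yz∙x (φ w) (Σ[ φ ] Y) (tot φ C)))) , eq , m≤m+n _ _
      where
      big : q + n ≤ q + Σ[ ω j ] R
      big = subst₂ _≤_ (cong (_+ n) 1+n≡q) (trans (cong (_+ Σ[ ω j ] Y) (sym (cong (p ^_) w0))) (trans (sp (ω j)) (cong (_+ Σ[ ω j ] R) eq))) (s≤s excess)
      zw : Σ[ v ] z ≈ₙ v w
      zw = unit≈ j w z w0 (≈ₙ-trans (≡⇒≈ₙ eq) q≈1)
      l′ : Λ⁺ R
      l′ = positive {ω j} R (≤-trans 0<n (+-cancelˡ-≤ q _ _ big)) 0<v ,
           ≈ₙ-trans (≈ₙ-cancel (v w) (≈ₙ-trans (≈ₙ-+ (≡⇒≈ₙ refl) (≈ₙ-sym zw)) (≡⇒≈ₙ (trans (+-comm _ (Σ[ v ] z)) (trans (sym (sp v)) (+-comm (v w) _)))))) (divisible l)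
    push N j (cons {m} Y l C) w w0 ex h | no ¬excess with Σ-find (χ N j) Y (proj₁ ex (Λ⁺-exact l j ¬excess))
    ... | x , Y₀ , x-ok , sp with push N j C x (proj₂ (χ>0 N j x x-ok)) (proj₂ ex)
            (+-cancelˡ-≤ n _ _ (subst₂ _≤_ refl (cong (_+ tot (ω j) C) (Λ⁺-exact l j ¬excess)) h))
    ...   | z , C′ , eq , zq , cost = z , cons (w ∷ Y₀) l′ C′ , same , zq , (begin
      tot v C′ + W C′ ≤⟨ +-mono-≤ (≤-trans (m≤m+n _ (Σ[ v ] z)) (≤-reflexive (eq v))) cost ⟩
      (tot v C + v x) + (W C + tot (χ N j) C) ≡⟨ interchange (tot v C) (v x) (W C) (tot (χ N j) C) ⟩
      (tot v C + W C) + (v x + tot (χ N j) C) ≤⟨ +-monoʳ-≤ (tot v C + W C) (+-monoˡ-≤ (tot (χ N j) C) vx≤) ⟩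
      (tot v C + W C) + (Σ[ χ N j ] Y + tot (χ N j) C) ∎)
      where
      open ≤-Reasoning
      vx≤ : v x ≤ Σ[ χ N j ] Y
      vx≤ = subst₂ _≤_ (χ-yes N j x (proj₁ (χ>0 N j x x-ok)) (proj₂ (χ>0 N j x x-ok))) (sym (sp (χ N j))) (m≤m+n (χ N j x) _)
      xw : v x ≈ₙ v w
      xw = ≈ₙ-trans (≡⇒≈ₙ (sym (+-identityʳ _))) (unit≈ j w (x ∷ []) w0 (≡⇒≈ₙ (trans (+-identityʳ _) (cong (p ^_) (proj₂ (χ>0 N j x x-ok))))))
      l′ : Λ⁺ (w ∷ Y₀)
      l′ = ≤-trans (0<v w) (m≤m+n _ _) , ≈ₙ-trans (≈ₙ-+ (≈ₙ-sym xw) (≡⇒≈ₙ refl)) (≈ₙ-trans (≡⇒≈ₙ (sym (sp v))) (divisible l))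
      same : ∀ φ → ((φ w + Σ[ φ ] Y₀) + tot φ C′) + Σ[ φ ] z ≡ (Σ[ φ ] Y + tot φ C) + φ w
      same φ rewrite sp φ = trans (solve 4 (λ a b c d → ((a :+ b) :+ c) :+ d := (c :+ d) :+ (a :+ b)) refl (φ w) (Σ[ φ ] Y₀) (tot φ C′) (Σ[ φ ] z))
        (trans (cong (_+ (φ w + Σ[ φ ] Y₀)) (eq φ)) (solve 4 (λ a b c d → (a :+ b) :+ (c :+ d) := ((b :+ d) :+ a) :+ c) refl (tot φ C) (φ x) (φ w) (Σ[ φ ] Y₀)))

  -- Rotation of norms and chip-firing

  suc-% : ∀ x → suc x % f ≡ suc (x % f) % f
  suc-% x = trans (cong (λ y → suc y % f) (m≡m%n+[m/n]*n x f)) ([m+kn]%n≡m%n (suc (x % f)) (x / f) f)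

  pos-+f : ∀ j e → pos (j + f) e ≡ pos j e
  pos-+f j e = trans (cong (_% f) (sym (+-assoc e j f))) ([m+n]%n≡m%n (e + j) f)

  opaque
    pos-same : ∀ {i j e x} → pos i e ≡ 0 → pos j e ≡ 0 → pos i x ≡ pos j x
    pos-same {i} {j} {e} {x} i0 j0 = trans (sym (%-remove-+ʳ (x + i) (m%n≡0⇒n∣m (e + j) f j0)))
      (trans (cong (_% f) (solve 4 (λ x i e j → (x :+ i) :+ (e :+ j) := (x :+ j) :+ (e :+ i)) refl x i e j))
             (%-remove-+ʳ (x + j) (m%n≡0⇒n∣m (e + i) f i0)))

    pos-same′ : ∀ {i j e x} → pos j e ≡ 0 → pos j x ≡ 0 → pos i e ≡ pos i x
    pos-same′ {i} {j} {e} {x} e0 x0 = trans (sym (%-remove-+ʳ (e + i) (m%n≡0⇒n∣m (x + j) f x0)))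
      (trans (cong (_% f) (solve 4 (λ x i e j → (e :+ i) :+ (x :+ j) := (x :+ i) :+ (e :+ j)) refl x i e j))
             (%-remove-+ʳ (x + i) (m%n≡0⇒n∣m (e + j) f e0)))

    -- Adding `pred f` rotates back by one position. Multiplication by p undoes this, except that
    -- p^(f - 1) becomes q = 1 + n instead of wrapping around to 1.
    ω-step : ∀ j e → p * ω (j + pred f) e ≡ ω j e + n * unit j e
    ω-step j e = go (pos (j + pred f) e) refl
      where
      next : pos j e ≡ suc (pos (j + pred f) e) % f
      next = trans (sym (pos-+f j e)) (trans (cong (_% f)
        (trans (cong (λ g → e + (j + g)) (sym (suc-pred f))) (solve 3 (λ e j g → e :+ (j :+ (con 1 :+ g)) := con 1 :+ (e :+ (j :+ g))) refl e j (pred f))))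
        (suc-% (e + (j + pred f))))
      go : ∀ r → pos (j + pred f) e ≡ r → p * ω (j + pred f) e ≡ ω j e + n * unit j e
      go r eq with suc r <? f
      ... | yes sr<f = trans (cong (λ r → p * p ^ r) eq) (sym (trans (cong₂ (λ a b → p ^ a + n * b) j-pos (⟦⟧-no (pos j e ≟ 0) λ z → case trans (sym z) j-pos of λ ()))
              (trans (cong (p ^ suc r +_) (*-zeroʳ n)) (+-identityʳ _))))
        where
        j-pos : pos j e ≡ suc r
        j-pos = trans next (trans (cong (λ r → suc r % f) eq) (m<n⇒m%n≡m sr<f))
      ... | no sr≮f = trans (cong (λ r → p * p ^ r) eq) (trans (cong (p ^_) sr≡f) (sym (trans (cong₂ (λ a b → p ^ a + n * b) j-pos (⟦⟧-yes (pos j e ≟ 0) j-pos))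
              (trans (cong suc (*-identityʳ n)) 1+n≡q))))
        where
        sr≡f : suc r ≡ f
        sr≡f = ≤-antisym (subst (_< f) eq (pos<f (j + pred f) e)) (≮⇒≥ sr≮f)
        j-pos : pos j e ≡ 0
        j-pos = trans next (trans (cong (λ r → suc r % f) eq) (trans (cong (_% f) sr≡f) (n%n≡0 f)))

    Σω-step : ∀ j X → p * Σ[ ω (j + pred f) ] X ≡ Σ[ ω j ] X + n * Σ[ unit j ] X
    Σω-step j X = trans (sym (Σ-* p _ X)) (trans (Σ-cong (ω-step j) X) (trans (Σ-+ _ _ X) (cong (Σ[ ω j ] X +_) (Σ-* n (unit j) X))))

  tot-* : ∀ {m} k φ (C : Conf m) → tot (λ e → k * φ e) C ≡ k * tot φ C
  tot-* k φ (free F)     = Σ-* k φ F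
  tot-* k φ (cons Y _ C) = trans (cong₂ _+_ (Σ-* k φ Y) (tot-* k φ C)) (sym (*-distribˡ-+ k (Σ[ φ ] Y) _))

  tot-cong : ∀ {m φ ψ} → (∀ e → φ e ≡ ψ e) → (C : Conf m) → tot φ C ≡ tot ψ C
  tot-cong h (free F)     = Σ-cong h F
  tot-cong h (cons Y _ C) = cong₂ _+_ (Σ-cong h Y) (tot-cong h C)

  opaque
    totω-step : ∀ {m} j (C : Conf m) → p * tot (ω (j + pred f)) C ≡ tot (ω j) C + n * tot (unit j) C
    totω-step j C = trans (sym (tot-* p _ C)) (trans (tot-cong (ω-step j) C) (trans (tot-+ _ _ C) (cong (tot (ω j) C +_) (tot-* n (unit j) C))))

    tot-find : ∀ {m} φ (C : Conf m) → 0 < tot φ C → ∃ λ e → 0 < φ e × 0 < tot (is e) C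
    tot-find φ (free F) h with Σ-find φ F h
    ... | e , _ , h′ , eq = e , h′ , subst (0 <_) (sym (eq (is e))) (≤-trans (≤-reflexive (sym (⟦⟧-yes (e ≟ e) refl))) (m≤m+n _ _))
    tot-find φ (cons Y _ C) h with 0⊎pos (Σ[ φ ] Y)
    ... | inj₁ none with tot-find φ C (subst (λ a → 0 < a + tot φ C) none h)
    ...   | e , h′ , in-C = e , h′ , ≤-trans in-C (m≤n+m _ _)
    tot-find φ (cons Y _ C) h | inj₂ some with Σ-find φ Y some
    ... | e , _ , h′ , eq = e , h′ , ≤-trans (subst (0 <_) (sym (eq (is e))) (≤-trans (≤-reflexive (sym (⟦⟧-yes (e ≟ e) refl))) (m≤m+n _ _))) (m≤m+n _ _)

  -- The p units of the colour just below that of `e`. They sum to q p^e, which is p^e modulo n.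
  chip : ℕ → List ℕ
  chip e = replicate p (e + pred f)

  opaque
    Σ-chip-ω : ∀ j e → Σ[ ω j ] (chip e) ≡ ω j e + n * unit j e
    Σ-chip-ω j e = trans (Σ-replicate (ω j) p (e + pred f)) (trans
      (cong (λ a → p * p ^ (a % f)) (xy∙z≈x∙zy e (pred f) j)) (ω-step j e))

    chip-≈ : ∀ e → Σ[ v ] (chip e) ≈ₙ v e
    chip-≈ e = ≈ₙ-trans (ω-cancel 0 {chip e} {e ∷ []} (≈ₙ-trans (≡⇒≈ₙ (Σ-chip-ω 0 e)) (≈ₙ-+ (≡⇒≈ₙ refl)
      (0 , unit 0 e , trans (+-identityʳ _) (*-comm n (unit 0 e)))))) (≡⇒≈ₙ (+-identityʳ _))

    pos-% : ∀ j e → pos (j % f) e ≡ pos j e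
    pos-% j e = sym (trans (cong (λ a → (e + a) % f) (m≡m%n+[m/n]*n j f))
      (trans (cong (_% f) (sym (+-assoc e (j % f) (j / f * f)))) ([m+kn]%n≡m%n (e + j % f) (j / f) f)))

    unit-% : ∀ j e → unit (j % f) e ≡ unit j e
    unit-% j e = cong (λ a → ⟦ a ≟ 0 ⟧) (pos-% j e)

  module _ (K : List ℕ) where

    Bounded : ∀ {m} → Conf m → Set
    Bounded C = ∀ j → tot (ω j) C ≤ Σ[ ω j ] K

    opaque
      -- By `ω-step`, p times the preceding norm is the `j`-th norm plus n for each unit in position
      -- 0. The preceding norm is bounded by that of `K`, so a surplus of such units leaves room in
      -- the `j`-th norm.
      overfull-room : ∀ {m} (C : Conf m) → Bounded C → ∀ j → Σ[ unit j ] K < tot (unit j) C → tot (ω j) C + n ≤ Σ[ ω j ] K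
      overfull-room C bound j over = cancel-≤ (n * Σ[ unit j ] K) (begin
          tot (ω j) C + n * suc (Σ[ unit j ] K)  ≤⟨ +-monoʳ-≤ (tot (ω j) C) (*-monoʳ-≤ n over) ⟩
          tot (ω j) C + n * tot (unit j) C       ≡⟨ sym (totω-step j C) ⟩
          p * tot (ω (j + pred f)) C             ≤⟨ *-monoʳ-≤ p (bound (j + pred f)) ⟩
          p * Σ[ ω (j + pred f) ] K              ≡⟨ Σω-step j K ⟩
          Σ[ ω j ] K + n * Σ[ unit j ] K         ∎)
          (trans (cong (tot (ω j) C +_) (*-suc n _)) (sym (+-assoc (tot (ω j) C) n _))) refl
        where open ≤-Reasoning

      0<chip : ∀ e → 0 < Σ[ v ] (chip e)
      0<chip e = positive {λ _ → 1} (chip e) (subst (0 <_) (sym (Σ-replicate (λ _ → 1) p (e + pred f))) (≤-trans (<-trans z<s 1<p) (≤-reflexive (sym (*-identityʳ p))))) 0<v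

    -- Exchanging a unit of an overfull colour for p units of the colour below raises a single norm,
    -- by n, and that norm has this much room left.
    opaque
      fire-once : ∀ {m} (C : Conf m) → Bounded C → ∀ j → Σ[ unit j ] K < tot (unit j) C →
        ∃ λ (C′ : Conf m) → Bounded C′ × suc (tot (λ _ → 1) C) ≤ tot (λ _ → 1) C′
      fire-once {m} C bound j over with tot-find (unit j) C (≤-<-trans z≤n over)
      ... | e , e-unit , e∈C with replace C e (chip e) e∈C (chip-≈ e) (0<chip e)
      ...   | C′ , eq , _ = C′ , bound′ , longer
        where
        new : ∀ i → tot (ω i) C′ ≡ tot (ω i) C + n * unit i e
        new i = cancel-≡ (ω i e) (trans (eq (ω i)) (cong (tot (ω i) C +_) (Σ-chip-ω i e))) refl
          (x∙yz≈xz∙y (tot (ω i) C) (ω i e) (n * unit i e))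
        bound-at : ∀ i → Dec (pos i e ≡ 0) → tot (ω i) C′ ≤ Σ[ ω i ] K
        bound-at i (no ¬i0) = subst (_≤ Σ[ ω i ] K) (sym (trans (new i) (trans (cong (λ a → tot (ω i) C + n * a) (⟦⟧-no (pos i e ≟ 0) ¬i0))
          (trans (cong (tot (ω i) C +_) (*-zeroʳ n)) (+-identityʳ _))))) (bound i)
        bound-at i (yes i0) = subst₂ _≤_ (trans (cong₂ _+_ (tot-cong ω-eq C) (sym (trans (cong (n *_) (⟦⟧-yes (pos i e ≟ 0) i0)) (*-identityʳ n)))) (sym (new i)))
            (Σ-cong ω-eq K) (overfull-room C bound j over)
          where
          ω-eq : ∀ x → ω j x ≡ ω i x
          ω-eq x = cong (p ^_) (pos-same {j} {i} {e} {x} (⟦⟧>0 (pos j e ≟ 0) e-unit) i0)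
        bound′ : Bounded C′
        bound′ i = bound-at i (pos i e ≟ 0)
        longer : suc (tot (λ _ → 1) C) ≤ tot (λ _ → 1) C′
        longer = +-cancelʳ-≤ 1 _ _ (≤-trans (≤-reflexive (solve 1 (λ a → (con 1 :+ a) :+ con 1 := a :+ con 2) refl (tot (λ _ → 1) C)))
          (≤-trans (+-monoʳ-≤ (tot (λ _ → 1) C) (subst (2 ≤_) (sym (trans (Σ-replicate (λ _ → 1) p (e + pred f)) (*-identityʳ p))) 1<p)) (≤-reflexive (sym (eq (λ _ → 1))))))

    Settled : ∀ {m} → Conf m → Set
    Settled C = ∀ j → tot (unit j) C ≤ Σ[ unit j ] K

    opaque
      settled? : ∀ {m} (C : Conf m) → Settled C ⊎ ∃ λ j → Σ[ unit j ] K < tot (unit j) C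
      settled? C with anyUpTo? (λ j → Σ[ unit j ] K <? tot (unit j) C) f
      ... | yes (j , _ , over) = inj₂ (j , over)
      ... | no none = inj₁ λ j → subst₂ _≤_ (tot-cong {φ = unit (j % f)} {unit j} (unit-% j) C) (Σ-cong {unit (j % f)} {unit j} (unit-% j) K)
                        (≮⇒≥ λ h → none (j % f , m%n<n j f , h))

      -- Each firing adds at least one unit, and the number of units never exceeds the 0-th norm,
      -- which stays bounded by that of `K`. The fuel `k` counts the units that may still be added.
      fire : ∀ {m} k (C : Conf m) → Bounded C → Σ[ ω 0 ] K ≤ tot (λ _ → 1) C + k → ∃ λ (C′ : Conf m) → Settled C′
      fire k C bound fuel with settled? C
      ... | inj₁ settled = C , settled
      fire k C bound fuel | inj₂ (j , over) with fire-once C bound j over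
      fire zero C bound fuel | inj₂ (j , over) | C′ , bound′ , longer =
        ⊥-elim (<⇒≱ (≤-<-trans (subst (Σ[ ω 0 ] K ≤_) (+-identityʳ _) fuel) longer) (≤-trans (tot-mono (0<ω 0) C′) (bound′ 0)))
      fire (suc k) C bound fuel | inj₂ (j , over) | C′ , bound′ , longer =
        fire k C′ bound′ (≤-trans fuel (≤-trans (≤-reflexive (+-suc _ k)) (+-monoˡ-≤ k longer)))

  opaque
    same-colour : ∀ {e x} → 0 < unit (x * pred f) e → ∀ i → pos i e ≡ pos i x
    same-colour {e} {x} e-ok i = pos-same′ {i} {x * pred f} {e} {x} (⟦⟧>0 (pos (x * pred f) e ≟ 0) e-ok) (pos-own x)

    -- Norms see only colours, so every unit of `L` may be represented by some unit of `K` of its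
    -- colour.
    realize : ∀ L K → (∀ j → Σ[ unit j ] L ≤ Σ[ unit j ] K) → ∃₂ λ Z R → Split K Z R × (∀ j → Σ[ ω j ] Z ≡ Σ[ ω j ] L) × (∀ j → Σ[ unit j ] Z ≡ Σ[ unit j ] L)
    realize []      K h = [] , K , (λ φ → refl) , (λ j → refl) , λ j → refl
    realize (x ∷ L) K h with Σ-find (unit (x * pred f)) K (≤-trans (≤-trans (≤-reflexive (sym (⟦⟧-yes (pos (x * pred f) x ≟ 0) (pos-own x)))) (m≤m+n _ _)) (h (x * pred f)))
    ... | e , K′ , e-ok , sp with realize L K′ (λ j → +-cancelˡ-≤ (unit j x) _ _ (≤-trans (h j) (≤-reflexive (trans (sp (unit j)) (cong (λ a → ⟦ a ≟ 0 ⟧ + Σ[ unit j ] K′) (same-colour e-ok j))))))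
    ...   | Z , R , sp′ , ω-eq , u-eq = e ∷ Z , R , (λ φ → trans (sp φ) (trans (cong (φ e +_) (sp′ φ)) (sym (+-assoc (φ e) _ _)))) ,
            (λ j → cong₂ _+_ (cong (p ^_) (same-colour e-ok j)) (ω-eq j)) , λ j → cong₂ _+_ (cong (λ a → ⟦ a ≟ 0 ⟧) (same-colour e-ok j)) (u-eq j)

  Λ⁺-from-ω : ∀ j Z → 0 < Σ[ ω j ] Z → Σ[ ω j ] Z ≈ₙ 0 → Λ⁺ Z
  Λ⁺-from-ω j Z 0<Z Z≈0 = positive {ω j} Z 0<Z 0<v , ω-cancel j {Z} {[]} Z≈0

  opaque
    realizeConf : ∀ {m} (C : Conf m) K → (∀ j → tot (unit j) C ≤ Σ[ unit j ] K) → ∃ λ (C′ : Conf m) → ∀ φ → tot φ C′ ≡ Σ[ φ ] K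
    realizeConf (free F) K h = free K , λ φ → refl
    realizeConf (cons Y l C) K h with realize Y K (λ j → ≤-trans (m≤m+n _ _) (h j))
    ... | Z , R , sp , ω-eq , u-eq with realizeConf C R (λ j → +-cancelˡ-≤ (Σ[ unit j ] Y) _ _ (≤-trans (h j) (≤-reflexive (trans (sp (unit j)) (cong (_+ _) (u-eq j))))))
    ...   | C′ , eq = cons Z (Λ⁺-from-ω 0 Z (subst (0 <_) (sym (ω-eq 0)) (≤-trans 0<n (Λ⁺-norm l 0))) (≈ₙ-trans (≡⇒≈ₙ (ω-eq 0)) (Λ⁺-ω≈0 l 0))) C′ ,
            λ φ → trans (cong (Σ[ φ ] Z +_) (eq φ)) (sym (sp φ))

  -- The base-p digits of p^k - 1. For k = f every colour occurs p - 1 times, so rotation changes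
  -- nothing and all norms are n.
  palette : ℕ → List ℕ
  palette zero    = []
  palette (suc k) = replicate (pred p) k ++ palette k

  opaque
    palette-shift : ∀ φ k → Σ[ (λ e → φ (suc e)) ] (palette k) + pred p * φ 0 ≡ Σ[ φ ] (palette k) + pred p * φ k
    palette-shift φ zero    = refl
    palette-shift φ (suc k) rewrite Σ-++ (λ e → φ (suc e)) (replicate (pred p) k) (palette k) | Σ-++ φ (replicate (pred p) k) (palette k)
      | Σ-replicate (λ e → φ (suc e)) (pred p) k | Σ-replicate φ (pred p) k =
      trans (+-assoc (pred p * φ (suc k)) _ _) (trans (cong (pred p * φ (suc k) +_) (palette-shift φ k))
        (x∙yz≈zy∙x (pred p * φ (suc k)) (Σ[ φ ] (palette k)) (pred p * φ k)))

    palette-ω : ∀ j → Σ[ ω j ] (palette f) ≡ n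
    palette-ω zero = suc-injective (trans (go f ≤-refl) (sym 1+n≡q))
      where
      go : ∀ k → k ≤ f → suc (Σ[ ω 0 ] (palette k)) ≡ p ^ k
      go zero    _ = refl
      go (suc k) k<f rewrite Σ-++ (ω 0) (replicate (pred p) k) (palette k) | Σ-replicate (ω 0) (pred p) k =
        trans (sym (+-suc _ _)) (trans (cong₂ (λ a b → pred p * p ^ a + b) (trans (cong (_% f) (+-identityʳ k)) (m<n⇒m%n≡m k<f)) (go k (<⇒≤ k<f)))
          (trans (+-comm _ (p ^ k)) (cong (_* p ^ k) (suc-pred p))))
    palette-ω (suc j) = trans (Σ-cong (λ e → cong (λ a → p ^ (a % f)) (+-suc e j)) (palette f))
      (trans (cancel-≡ (pred p * ω j 0) (palette-shift (ω j) f) refl (cong (λ a → Σ[ ω j ] (palette f) + pred p * p ^ a)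
        (trans (cong (_% f) (+-comm f j)) ([m+n]%n≡m%n j f)))) (palette-ω j))

  start : ∀ m → Conf m
  start zero    = free []
  start (suc m) = cons (palette f) (Λ⁺-from-ω 0 (palette f) (subst (0 <_) (sym (palette-ω 0)) 0<n) (≈ₙ-trans (≡⇒≈ₙ (palette-ω 0)) n≈0)) (start m)

  opaque
    start-ω : ∀ m j → tot (ω j) (start m) ≡ m * n
    start-ω zero    j = refl
    start-ω (suc m) j = cong₂ _+_ (palette-ω j) (start-ω m j)

    -- The starting composition meets the lower bound with equality in every norm, but disregards
    -- which units `K` has. Firing corrects the colours, and matching by colour then uses the true
    -- units of `K`.
    compose : ∀ m K → (∀ j → m * n ≤ Σ[ ω j ] K) → ∃ λ (C : Conf m) → ∀ φ → tot φ C ≡ Σ[ φ ] K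
    compose m K h with fire K (Σ[ ω 0 ] K) (start m) (λ j → ≤-trans (≤-reflexive (start-ω m j)) (h j)) (m≤n+m _ _)
    ... | C , room = realizeConf C K room

    -- Two parts and a free remainder are formed; the remainder is divisible by n as well, though
    -- possibly empty. Whichever holds `N` is split off, and the other two always include a nonempty
    -- part.
    halve : ∀ X N → Σ[ v ] X ≈ₙ 0 → (∀ j → n + n ≤ Σ[ ω j ] X) → 0 < Σ[ is N ] X →
      ∃₂ λ Z R → Split X Z R × Λ⁺ R × Σ[ v ] Z ≈ₙ 0 × 0 < Σ[ is N ] Z
    halve X N X≈0 h N∈X with compose 2 X (λ j → ≤-trans (≤-reflexive (cong (n +_) (+-identityʳ n))) (h j))
    ... | cons A a (cons B b (free F)) , eq = pick (0⊎pos (Σ[ is N ] A)) (0⊎pos (Σ[ is N ] B))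
      where
      join : ∀ {A} F → Λ⁺ A → Σ[ v ] F ≈ₙ 0 → Λ⁺ (A ++ F)
      join {A} F (z , d) F≈0 = subst (0 <_) (sym (Σ-++ v A F)) (≤-trans z (m≤m+n _ _)) , ≈ₙ-trans (≡⇒≈ₙ (Σ-++ v A F)) (≈ₙ-+ d F≈0)
      F≈0 : Σ[ v ] F ≈ₙ 0
      F≈0 = ≈ₙ-cancel 0 (≈ₙ-trans (≡⇒≈ₙ (+-identityʳ _)) (≈ₙ-trans (≈ₙ-sym (≈ₙ-+ (Λ⁺.divisible a) (≈ₙ-+ (Λ⁺.divisible b) (≡⇒≈ₙ refl)))) (≈ₙ-trans (≡⇒≈ₙ (eq v)) X≈0)))
      pick : Σ[ is N ] A ≡ 0 ⊎ 0 < Σ[ is N ] A → Σ[ is N ] B ≡ 0 ⊎ 0 < Σ[ is N ] B → ∃₂ λ Z R → Split X Z R × Λ⁺ R × Σ[ v ] Z ≈ₙ 0 × 0 < Σ[ is N ] Z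
      pick (inj₂ in-A) _ = A , B ++ F , (λ φ → trans (sym (eq φ)) (cong (Σ[ φ ] A +_) (sym (Σ-++ φ B F)))) , join F b F≈0 , Λ⁺.divisible a , in-A
      pick (inj₁ _) (inj₂ in-B) = B , A ++ F , (λ φ → trans (sym (eq φ)) (trans (x∙yz≈y∙xz (Σ[ φ ] A) (Σ[ φ ] B) (Σ[ φ ] F))
        (cong (Σ[ φ ] B +_) (sym (Σ-++ φ A F))))) , join F a F≈0 , Λ⁺.divisible b , in-B
      pick (inj₁ out-A) (inj₁ out-B) = F , A ++ B , (λ φ → trans (sym (eq φ)) (trans (x∙yz≈z∙xy (Σ[ φ ] A) (Σ[ φ ] B) (Σ[ φ ] F))
        (cong (Σ[ φ ] F +_) (sym (Σ-++ φ A B))))) , join B a (Λ⁺.divisible b) , F≈0 ,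
        subst (0 <_) (sym (trans (sym (cong₂ (λ a b → a + (b + Σ[ is N ] F)) out-A out-B)) (eq (is N)))) N∈X

    -- For f = 1 every unit is 1 modulo n, so any n units from a place with an excess form a part,
    -- and nothing else has to move.
    pull : f ≡ 1 → ∀ {m} (C : Conf m) → n + m * n ≤ tot (ω 0) C →
      ∃₂ λ z (C′ : Conf m) → (∀ φ → tot φ C′ + Σ[ φ ] z ≡ tot φ C) × Λ⁺ z × W C′ ≤ W C
    pull refl = go
      where
      none : ∀ j X → Below (pos j) 0 X
      none j []      = refl
      none j (x ∷ X) = trans (cong (_+ _) (⟦⟧-no (0 <? pos j x) (λ h → <⇒≱ (pos<f j x) h))) (none j X)
      packet : ∀ X → n ≤ Σ[ ω 0 ] X → ∃₂ λ Z R → Split X Z R × Σ[ ω 0 ] Z ≡ n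
      packet X h with multiple (pos 0) 0 (pay (pos 0) 0) n X (none 0 X) (≤-trans (≤-reflexive (*-identityʳ n)) h)
      ... | Z , R , sp , eq = Z , R , sp , trans eq (*-identityʳ n)
      Z-ok : ∀ {Z} → Σ[ ω 0 ] Z ≡ n → Λ⁺ Z
      Z-ok {Z} eq = Λ⁺-from-ω 0 Z (subst (0 <_) (sym eq) 0<n) (≈ₙ-trans (≡⇒≈ₙ eq) n≈0)
      go : ∀ {m} (C : Conf m) → n + m * n ≤ tot (ω 0) C → ∃₂ λ z (C′ : Conf m) → (∀ φ → tot φ C′ + Σ[ φ ] z ≡ tot φ C) × Λ⁺ z × W C′ ≤ W C
      go (free F) h with packet F (≤-trans (m≤m+n n 0) h)
      ... | Z , R , sp , eq = Z , free R , (λ φ → trans (+-comm (Σ[ φ ] R) _) (sym (sp φ))) , Z-ok eq , z≤n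
      go (cons {m} Y l C) h with n + n ≤? Σ[ ω 0 ] Y
      ... | no ¬h with go C (+-cancelˡ-≤ n _ _ (subst (λ a → n + (n + m * n) ≤ a + tot (ω 0) C) (Λ⁺-exact l 0 ¬h) h))
      ...   | z , C′ , eq , zl , cost = z , cons Y l C′ , (λ φ → trans (+-assoc (Σ[ φ ] Y) _ _) (cong (Σ[ φ ] Y +_) (eq φ))) , zl ,
              +-mono-≤ (≤-trans (m≤m+n _ _) (≤-reflexive (eq v))) cost
      go (cons Y l C) h | yes h₂ with packet Y (≤-trans (m≤m+n n n) h₂)
      ... | Z , R , sp , eq = Z , cons R (positive {ω 0} R (≤-trans 0<n (+-cancelˡ-≤ n _ _ (≤-trans h₂ (≤-reflexive (trans (sp (ω 0)) (cong (_+ _) eq)))))) 0<v ,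
                ≈ₙ-cancel (Σ[ v ] Z) (≈ₙ-trans (≡⇒≈ₙ (trans (+-comm (Σ[ v ] R) _) (sym (sp v)))) (≈ₙ-trans (Λ⁺.divisible l) (≈ₙ-sym (Λ⁺.divisible (Z-ok {Z} eq)))))) C ,
              (λ φ → trans (xy∙z≈zx∙y (Σ[ φ ] R) (tot φ C) (Σ[ φ ] Z)) (cong (_+ tot φ C) (sym (sp φ)))) , Z-ok eq , ≤-refl

    Σ-mono₀ : ∀ {φ ψ χ} → (∀ e → χ e ≡ 0 → φ e ≤ ψ e) → ∀ X → Σ[ χ ] X ≡ 0 → Σ[ φ ] X ≤ Σ[ ψ ] X
    Σ-mono₀ h []      _ = z≤n
    Σ-mono₀ {χ = χ} h (x ∷ X) z = +-mono-≤ (h x (m+n≡0⇒m≡0 (χ x) z)) (Σ-mono₀ h X (m+n≡0⇒n≡0 (χ x) z))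

  -- Comparison of two weight-0 parts

  low hi : ℕ → ℕ → ℕ
  low N e = ⟦ e <? N ⟧ * v e
  hi N e = ⟦ N ≤? e ⟧

  hi≡0 : ∀ N e → hi N e ≡ 0 → e < N
  hi≡0 N e z = ≰⇒> (⟦⟧≡0 (N ≤? e) z)

  opaque
    low-all : ∀ N X → Σ[ hi N ] X ≡ 0 → Σ[ v ] X ≡ Σ[ low N ] X
    low-all N = Σ-cong₀ {χ = hi N} λ e z → sym (trans (cong (_* v e) (⟦⟧-yes (e <? N) (hi≡0 N e z))) (+-identityʳ _))

    maximum : ∀ M → 0 < Σ[ v ] M → ∃₂ λ N M₀ → (∀ ψ → Σ[ ψ ] M ≡ ψ N + Σ[ ψ ] M₀) × Σ[ hi (suc N) ] M₀ ≡ 0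
    maximum (x ∷ []) _ = x , [] , (λ ψ → refl) , refl
    maximum (x ∷ y ∷ M) _ with maximum (y ∷ M) (≤-trans (0<v y) (m≤m+n _ _))
    ... | N , M₀ , sp , b with N <? x
    ...   | no N≮x = N , x ∷ M₀ , (λ ψ → trans (cong (ψ x +_) (sp ψ)) (x∙yz≈y∙xz (ψ x) (ψ N) (Σ[ ψ ] M₀))) ,
              trans (cong (_+ Σ[ hi (suc N) ] M₀) (⟦⟧-no (suc N ≤? x) N≮x)) b
    ...   | yes N<x = x , y ∷ M , (λ ψ → refl) , trans (sp _) (cong₂ _+_ (⟦⟧-no (suc x ≤? N) (<-asym N<x))
              (n≤0⇒n≡0 (≤-trans (Σ-mono {φ = hi (suc x)} {ψ = hi (suc N)} mono M₀) (≤-reflexive b))))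
      where
      mono : ∀ e → hi (suc x) e ≤ hi (suc N) e
      mono e with suc x ≤? e | suc N ≤? e
      ... | yes h | no ¬h = ⊥-elim (¬h (<-trans N<x h))
      ... | yes h | yes _ = ≤-refl
      ... | no _  | _     = z≤n

  -- The property of base-p digits in a form that subcollections inherit.
  CarryFreeL : List ℕ → Set
  CarryFreeL X = ∀ N → Σ[ low N ] X < p ^ N

  opaque
    member-≤ : ∀ φ e X → 0 < Σ[ is e ] X → φ e ≤ Σ[ φ ] X
    member-≤ φ e X h with find-is e X h
    ... | X′ , sp = subst (φ e ≤_) (sym (sp φ)) (m≤m+n _ _)

  -- `T` and `M` compared as base-p numbers from the top: the common leading units `H`, then the
  -- first unit `N` of `M` that `T` lacks.
  record Aligned (T M : List ℕ) : Set where
    field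
      H Tl Ml : List ℕ
      N       : ℕ
      splitT  : Split T H Tl
      splitM  : Split M H (N ∷ Ml)
      Tl<N    : Σ[ hi N ] Tl ≡ 0
      Ml≤N    : Σ[ hi (suc N) ] Ml ≡ 0

  opaque
    align : ∀ k T M → Σ[ (λ _ → 1) ] M ≤ k → CarryFreeL M → Σ[ v ] T < Σ[ v ] M → Aligned T M
    align k T M len cf T<M with maximum M (≤-<-trans z≤n T<M)
    ... | N , M₀ , sp , b with 0⊎pos (Σ[ hi (suc N) ] T)
    ...   | inj₂ above with Σ-find (hi (suc N)) T above
    -- A unit of `T` above the top of `M` would outweigh all of `M`, which is carry-free.
    ...     | e , T′ , N<e , sp′ = ⊥-elim (<⇒≱ T<M (begin
      Σ[ v ] M             ≡⟨ low-all (suc N) M (trans (sp _) (cong₂ _+_ (⟦⟧-no (suc N ≤? N) (<-irrefl refl)) b)) ⟩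
      Σ[ low (suc N) ] M   ≤⟨ <⇒≤ (cf (suc N)) ⟩
      p ^ suc N            ≤⟨ ^-monoʳ-≤ p (⟦⟧>0 (suc N ≤? e) N<e) ⟩
      p ^ e                ≤⟨ m≤m+n _ _ ⟩
      v e + Σ[ v ] T′      ≡⟨ sym (sp′ v) ⟩
      Σ[ v ] T             ∎))
      where open ≤-Reasoning
    align k T M len cf T<M | N , M₀ , sp , b | inj₁ T≤N with 0⊎pos (Σ[ is N ] T)
    ... | inj₁ N∉T = record { H = [] ; Tl = T ; Ml = M₀ ; N = N ; splitT = λ φ → refl ; splitM = sp ; Ml≤N = b
        ; Tl<N = n≤0⇒n≡0 (≤-trans (Σ-mono {ψ = λ e → hi (suc N) e + is N e} mono T) (≤-reflexive (trans (Σ-+ _ _ T) (cong₂ _+_ T≤N N∉T)))) }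
      where
      mono : ∀ e → hi N e ≤ hi (suc N) e + is N e
      mono e with N ≤? e | suc N ≤? e | e ≟ N
      ... | no _  | _     | _      = z≤n
      ... | yes _ | yes _ | _      = s≤s z≤n
      ... | yes _ | no _  | yes _  = ≤-refl
      ... | yes h | no ¬h | no e≢N = ⊥-elim (¬h (≤∧≢⇒< h (e≢N ∘ sym)))
    ... | inj₂ N∈T with find-is N T N∈T
    ...   | T₀ , sp′ = finish k len
      where
      finish : ∀ k → Σ[ (λ _ → 1) ] M ≤ k → Aligned T M
      finish zero    h = ⊥-elim (<⇒≱ (≤-<-trans z≤n T<M) (≤-trans (≤-reflexive (trans (Σ-cong₀ {χ = λ _ → 1} (λ e ()) M (n≤0⇒n≡0 h)) (Σ-* 0 v M))) z≤n))
      finish (suc k) h with align k T₀ M₀ (≤-pred (≤-trans (≤-reflexive (sym (sp _))) h)) (λ K → ≤-<-trans (≤-trans (m≤n+m _ _) (≤-reflexive (sym (sp (low K))))) (cf K))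
                         (+-cancelˡ-< (v N) _ _ (subst₂ _<_ (sp′ v) (sp v) T<M))
      ... | r = record { H = N ∷ R.H ; Tl = R.Tl ; Ml = R.Ml ; N = R.N ; Tl<N = R.Tl<N ; Ml≤N = R.Ml≤N
          ; splitT = λ φ → trans (sp′ φ) (trans (cong (φ N +_) (R.splitT φ)) (sym (+-assoc (φ N) _ _)))
          ; splitM = λ φ → trans (sp φ) (trans (cong (φ N +_) (R.splitM φ)) (sym (+-assoc (φ N) _ _))) }
        where module R = Aligned r

  Better : ∀ {m} → Conf m → Set
  Better {m} y = ∃ λ (C : Conf m) → Same C y × W C < W y

  opaque
    exchangeable : ∀ N j {m} (C : Conf m) → (∀ Y → Λ⁺ Y → (∀ φ → Σ[ φ ] Y ≤ tot φ C) → Σ[ ω j ] Y ≡ n → 0 < Σ[ χ N j ] Y) → Exchangeable N j C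
    exchangeable N j (free F)     h = tt
    exchangeable N j (cons Y l C) h = h Y l (λ φ → m≤m+n _ _) , exchangeable N j C λ Y′ l′ sub → h Y′ l′ λ φ → ≤-trans (sub φ) (m≤n+m _ _)

    -- `ω j w` lies between 1 and n, so it is the least positive number of its class. Hence
    -- exchanging `w` for a congruent packet lowers no norm.
    ≈ω-min : ∀ j {z w} → 0 < Σ[ v ] z → Σ[ v ] z ≈ₙ v w → ω j w ≤ Σ[ ω j ] z
    ≈ω-min j {z} {w} 0<z z≈w with ω j w ≤? Σ[ ω j ] z
    ... | yes h = h
    ... | no ¬h = ⊥-elim (<⇒≱ (positive {v} z 0<z (0<ω j)) (+-cancelʳ-≤ n _ _ (≤-trans
        (≈ₙ-gap (≈ₙ-sym (≈ₙ-trans (ω-cong j {z} {w ∷ []} (≈ₙ-trans z≈w (≡⇒≈ₙ (sym (+-identityʳ _))))) (≡⇒≈ₙ (+-identityʳ _)))) (≰⇒> ¬h)) (p^≤n (pos<f j w)))))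

  -- One exchange: `w` leaves the first part and is pushed into the others, and a packet `z` of norm
  -- q, congruent to `w`, comes back. `loss` credits the whole value of `z` against the charges.
  module Op (N j : ℕ) {m} {T} (l : Λ⁺ T) (C : Conf m) {w T₀} (sp : ∀ ψ → Σ[ ψ ] T ≡ ψ w + Σ[ ψ ] T₀) (w-ok : 0 < χ N j w)
            (ex : Exchangeable N j C) (enough : n + m * n ≤ tot (ω j) C) where

    w<N = proj₁ (χ>0 N j w w-ok)
    w0  = proj₂ (χ>0 N j w w-ok)
    pushed = push N j C w w0 ex enough
    z  = proj₁ pushed
    C′ = proj₁ (proj₂ pushed)
    eq = proj₁ (proj₂ (proj₂ pushed))
    zq = proj₁ (proj₂ (proj₂ (proj₂ pushed)))
    cost = proj₂ (proj₂ (proj₂ (proj₂ pushed)))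

    opaque
      z≈w : Σ[ v ] z ≈ₙ v w
      z≈w = unit≈ j w z w0 (≈ₙ-trans (≡⇒≈ₙ zq) q≈1)

      0<z : 0 < Σ[ v ] z
      0<z = positive {ω j} z (subst (0 <_) (sym zq) (0<p^ f)) 0<v

    T′ = z ++ T₀

    l′ : Λ⁺ T′
    l′ = subst (0 <_) (sym (Σ-++ v z T₀)) (≤-trans 0<z (m≤m+n _ _)) ,
         ≈ₙ-trans (≡⇒≈ₙ (Σ-++ v z T₀)) (≈ₙ-trans (≈ₙ-+ z≈w (≡⇒≈ₙ refl)) (≈ₙ-trans (≡⇒≈ₙ (sym (sp v))) (divisible l)))

    opaque
      same : Same (cons T′ l′ C′) (cons T l C)
      same φ rewrite Σ-++ φ z T₀ | sp φ = trans (xy∙z≈zx∙y (Σ[ φ ] z) (Σ[ φ ] T₀) (tot φ C′))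
        (trans (cong (_+ Σ[ φ ] T₀) (eq φ)) (xy∙z≈yz∙x (tot φ C) (φ w) (Σ[ φ ] T₀)))

      loss : W (cons T′ l′ C′) + Σ[ v ] z ≤ W (cons T l C) + tot (χ N j) (cons T l C)
      loss = begin
        tot v C′ + W C′ + Σ[ v ] z   ≡⟨ xy∙z≈xz∙y (tot v C′) (W C′) (Σ[ v ] z) ⟩
        (tot v C′ + Σ[ v ] z) + W C′ ≤⟨ +-mono-≤ (≤-reflexive (eq v)) cost ⟩
        (tot v C + v w) + (W C + tot (χ N j) C) ≡⟨ interchange (tot v C) (v w) (W C) (tot (χ N j) C) ⟩
        (tot v C + W C) + (v w + tot (χ N j) C) ≤⟨ +-monoʳ-≤ (tot v C + W C) (+-monoˡ-≤ _ (subst₂ _≤_ (χ-yes N j w w<N w0) (sym (sp (χ N j))) (m≤m+n _ _))) ⟩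
        (tot v C + W C) + (Σ[ χ N j ] T + tot (χ N j) C) ∎
        where open ≤-Reasoning

  -- Colours counted upwards from the colour of N

  module Colours (N : ℕ) where

    jc : ℕ
    jc = N * pred f

    opaque
      posN : pos jc N ≡ 0
      posN = pos-own N

    -- The rotation `jc` - h modulo f: it brings the colour h steps above that of `N` to position 0.
    shift : ℕ → ℕ
    shift h = jc + (f ∸ h)

    opaque
      pos-shift : ∀ h e → pos (shift h) e ≡ (pos jc e + (f ∸ h)) % f
      pos-shift h e = trans (cong (_% f) (sym (+-assoc e jc (f ∸ h)))) (trans (cong (λ x → (x + (f ∸ h)) % f) (m≡m%n+[m/n]*n (e + jc) f))
        (trans (cong (_% f) (xy∙z≈xz∙y (pos jc e) ((e + jc) / f * f) (f ∸ h))) ([m+kn]%n≡m%n (pos jc e + (f ∸ h)) ((e + jc) / f) f)))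

      pos-shift-≥ : ∀ h e → h ≤ f → h ≤ pos jc e → pos (shift h) e ≡ pos jc e ∸ h
      pos-shift-≥ h e h≤f h≤s = trans (pos-shift h e) (trans (cong (_% f) eq) (trans ([m+n]%n≡m%n (pos jc e ∸ h) f) (m<n⇒m%n≡m (≤-<-trans (m∸n≤m _ h) (pos<f jc e)))))
        where
        eq : pos jc e + (f ∸ h) ≡ (pos jc e ∸ h) + f
        eq = +-cancelʳ-≡ h _ _ (trans (+-assoc (pos jc e) _ h) (trans (cong (pos jc e +_) (m∸n+n≡m h≤f)) (trans (cong (_+ f) (sym (m∸n+n≡m h≤s)))
          (xy∙z≈xz∙y (pos jc e ∸ h) h f))))

      pos-shift-< : ∀ h e → h ≤ f → pos jc e < h → pos (shift h) e ≡ pos jc e + (f ∸ h)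
      pos-shift-< h e h≤f s<h = trans (pos-shift h e) (m<n⇒m%n≡m (≤-trans (+-monoˡ-< (f ∸ h) s<h) (≤-reflexive (m+[n∸m]≡n h≤f))))

      shift-0 : ∀ h e → h < f → pos (shift h) e ≡ 0 → pos jc e ≡ h
      shift-0 h e h<f z with h ≤? pos jc e
      ... | yes h≤s = ≤-antisym (m∸n≡0⇒m≤n (trans (sym (pos-shift-≥ h e (<⇒≤ h<f) h≤s)) z)) h≤s
      ... | no  h≰s = ⊥-elim (m>n⇒m∸n≢0 h<f (m+n≡0⇒n≡0 (pos jc e) (trans (sym (pos-shift-< h e (<⇒≤ h<f) (≰⇒> h≰s))) z)))

    -- Bounds what is lost in exchanges of units below N whose colour lies at least b steps above that of N.
    A : ℕ → ℕ → ℕ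
    A b e = ⟦ e <? N ⟧ * (⟦ b ≤? pos jc e ⟧ * v e)

    opaque
      A≤low : ∀ b e → A b e ≤ low N e
      A≤low b e with e <? N | b ≤? pos jc e
      ... | no _  | _     = z≤n
      ... | yes _ | yes _ = ≤-reflexive (cong (_+ 0) (+-identityʳ _))
      ... | yes _ | no _  = z≤n

      A-mono : ∀ {b c} → b ≤ c → ∀ e → A c e ≤ A b e
      A-mono {b} {c} b≤c e with e <? N | c ≤? pos jc e | b ≤? pos jc e
      ... | no _  | _     | _     = z≤n
      ... | yes _ | no _  | _     = z≤n
      ... | yes _ | yes _ | yes _ = ≤-refl
      ... | yes _ | yes h | no ¬h = ⊥-elim (¬h (≤-trans b≤c h))

      -- Colour `h` is covered by `A h` but not by `A (suc h)`; the difference is the budget of one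
      -- push at `shift h`. The charges of pushes with decreasing colours therefore add up within
      -- one `A`.
      A-step : ∀ h → h < f → ∀ e → χ N (shift h) e + A (suc h) e ≤ A h e
      A-step h h<f e with e <? N | pos (shift h) e ≟ 0 | suc h ≤? pos jc e | h ≤? pos jc e
      ... | no _  | _     | _      | _      = z≤n
      ... | yes _ | no _  | no _   | _      = z≤n
      ... | yes _ | no _  | yes _  | yes _  = ≤-refl
      ... | yes _ | no _  | yes a  | no b   = ⊥-elim (b (<⇒≤ a))
      ... | yes _ | yes z | yes a  | _      = ⊥-elim (<-irrefl (sym (shift-0 h e h<f z)) a)
      ... | yes _ | yes z | no _   | yes _  = ≤-reflexive (+-identityʳ _)
      ... | yes _ | yes z | no _   | no b   = ⊥-elim (b (≤-reflexive (sym (shift-0 h e h<f z))))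

      χ+A≤A : ∀ {m} {h b} → h < f → h < b → (C : Conf m) → tot (A b) C + tot (χ N (shift h)) C ≤ tot (A h) C
      χ+A≤A {h = h} {b} h<f h<b C = ≤-trans (≤-reflexive (trans (+-comm (tot (A b) C) _) (sym (tot-+ _ _ C))))
        (tot-mono (λ e → ≤-trans (+-monoʳ-≤ (χ N (shift h) e) (A-mono h<b e)) (A-step h h<f e)) C)

    opaque
      lowest : ∀ b X → 0 < Σ[ (λ e → ⟦ pos jc e <? b ⟧) ] X → ∃₂ λ w X′ →
        (∀ ψ → Σ[ ψ ] X ≡ ψ w + Σ[ ψ ] X′) × pos jc w < b × Σ[ (λ e → ⟦ pos jc e <? pos jc w ⟧) ] X ≡ 0
      lowest (suc b) X h with 0⊎pos (Σ[ (λ e → ⟦ pos jc e <? b ⟧) ] X)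
      ... | inj₂ some with lowest b X some
      ...   | w , X′ , sp , w<b , min = w , X′ , sp , m<n⇒m<1+n w<b , min
      lowest (suc b) X h | inj₁ none with Σ-find _ X h
      ... | w , X′ , w-ok , sp = w , X′ , sp , w≤b , n≤0⇒n≡0 (≤-trans (Σ-mono mono X) (≤-reflexive none))
        where
        w≤b : pos jc w < suc b
        w≤b = ⟦⟧>0 (pos jc w <? suc b) w-ok
        mono : ∀ e → ⟦ pos jc e <? pos jc w ⟧ ≤ ⟦ pos jc e <? b ⟧
        mono e with pos jc e <? pos jc w | pos jc e <? b
        ... | no _  | _     = z≤n
        ... | yes _ | yes _ = ≤-refl
        ... | yes a | no ¬a = ⊥-elim (¬a (<-≤-trans a (≤-pred w≤b)))
      lowest zero X h = ⊥-elim (<-irrefl refl (<-≤-trans h (≤-reflexive (trans (Σ-cong {ψ = λ _ → 0 * 0} (λ e → ⟦⟧-no (pos jc e <? 0) λ ()) X) (Σ-* 0 (λ _ → 0) X)))))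

    opaque
      -- When no colour below `h` occurs, nothing wraps around, and rotating by `h` is division by
      -- p^h.
      ω-rotate : ∀ h X → h ≤ f → Σ[ (λ e → ⟦ pos jc e <? h ⟧) ] X ≡ 0 → p ^ h * Σ[ ω (shift h) ] X ≡ Σ[ ω jc ] X
      ω-rotate h X h≤f none = trans (sym (Σ-* (p ^ h) _ X)) (Σ-cong₀ {χ = λ e → ⟦ pos jc e <? h ⟧} pt X none)
        where
        pt : ∀ e → ⟦ pos jc e <? h ⟧ ≡ 0 → p ^ h * ω (shift h) e ≡ ω jc e
        pt e z = trans (cong (λ a → p ^ h * p ^ a) (pos-shift-≥ h e h≤f h≤s)) (trans (sym (^-distribˡ-+-* p h _)) (cong (p ^_) (m+[n∸m]≡n h≤s)))
          where
          h≤s : h ≤ pos jc e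
          h≤s = ≮⇒≥ (⟦⟧≡0 (pos jc e <? h) z)

  -- Raising the first differing unit

  opaque
    small⇒low : ∀ N X → Σ[ v ] X < p ^ N → Σ[ hi N ] X ≡ 0
    small⇒low N X h with 0⊎pos (Σ[ hi N ] X)
    ... | inj₁ z = z
    ... | inj₂ some with Σ-find (hi N) X some
    ...   | e , X′ , ok , sp = ⊥-elim (<⇒≱ h (≤-trans (^-monoʳ-≤ p (⟦⟧>0 (N ≤? e) ok)) (≤-trans (m≤m+n (v e) (Σ[ v ] X′)) (≤-reflexive (sym (sp v))))))

    is≤hi : ∀ {N e} → N ≤ e → ∀ X → Σ[ hi N ] X ≡ 0 → Σ[ is e ] X ≡ 0
    is≤hi {N} {e} N≤e X z = n≤0⇒n≡0 (≤-trans (Σ-mono pt X) (≤-reflexive z))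
      where
      pt : ∀ x → is e x ≤ hi N x
      pt x with x ≟ e | N ≤? x
      ... | no _     | _      = z≤n
      ... | yes _    | yes _  = ≤-refl
      ... | yes refl | no N≰x = ⊥-elim (N≰x N≤e)

    is-refl : ∀ e → is e e ≡ 1
    is-refl e = ⟦⟧-yes (e ≟ e) refl

  -- The best part T of a composition is compared with a larger best part M: N is the largest unit in which they differ,
  -- H is common. Either a cheaper composition or an even larger best part is found.
  module Situation {m : ℕ} {T : List ℕ} (lT : Λ⁺ T) (C₀ : Conf m) (carryFree : ∀ N → tot (low N) (cons T lT C₀) < p ^ N)
                   {M : List ℕ} (lM : Λ⁺ M) (D : Conf m) (sameM : Same (cons M lM D) (cons T lT C₀)) (al : Aligned T M) where

    open Aligned al
    open Colours N

    y : Conf (suc m)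
    y = cons T lT C₀

    M₁ : List ℕ
    M₁ = N ∷ Ml

    Bigger : Set
    Bigger = Σ (List ℕ) λ M′ → Σ (Λ⁺ M′) λ l′ → Σ (Conf m) λ D′ → Same (cons M′ l′ D′) y × Σ[ v ] M < Σ[ v ] M′

    opaque
      M₁≤N : Σ[ hi (suc N) ] M₁ ≡ 0
      M₁≤N = cong₂ _+_ (⟦⟧-no (suc N ≤? N) (<-irrefl refl)) Ml≤N

      M₁-small : Σ[ v ] M₁ < p ^ suc N
      M₁-small = ≤-<-trans (begin
        Σ[ v ] M₁                    ≡⟨ low-all (suc N) M₁ M₁≤N ⟩
        Σ[ low (suc N) ] M₁          ≤⟨ m≤n+m (Σ[ low (suc N) ] M₁) (Σ[ low (suc N) ] H) ⟩
        Σ[ low (suc N) ] H + Σ[ low (suc N) ] M₁ ≡⟨ sym (splitM (low (suc N))) ⟩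
        Σ[ low (suc N) ] M           ≤⟨ m≤m+n (Σ[ low (suc N) ] M) (tot (low (suc N)) D) ⟩
        Σ[ low (suc N) ] M + tot (low (suc N)) D ≡⟨ sameM (low (suc N)) ⟩
        tot (low (suc N)) y          ∎) (carryFree (suc N))
        where open ≤-Reasoning

      -- Here `M` is improved and not `y`: a unit above `N` enters it in exchange for a packet of
      -- `M₁`, and carry-freeness keeps all of `M₁` below p^(N + 1).
      bigger : ∀ e j → N < e → pos j e ≡ 0 → UnitPart j M₁ → 0 < tot (is e) D → Bigger
      bigger e j N<e e0 (Z , R , sp , 0<Z , Z≈1) e∈D with replace D e Z e∈D (unit≈ j e Z e0 Z≈1) 0<Z
      ... | D′ , eq , _ = e ∷ (H ++ R) , l′ , D′ , same , larger
        where
        parts : ∀ φ → Σ[ φ ] M ≡ Σ[ φ ] Z + Σ[ φ ] (H ++ R)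
        parts φ = trans (splitM φ) (trans (cong (Σ[ φ ] H +_) (sp φ)) (trans (x∙yz≈y∙xz (Σ[ φ ] H) (Σ[ φ ] Z) (Σ[ φ ] R))
          (cong (Σ[ φ ] Z +_) (sym (Σ-++ φ H R)))))
        l′ : Λ⁺ (e ∷ (H ++ R))
        l′ = ≤-trans (0<v e) (m≤m+n _ _) , ≈ₙ-trans (≈ₙ-+ (≈ₙ-sym (unit≈ j e Z e0 Z≈1)) (≡⇒≈ₙ refl)) (≈ₙ-trans (≡⇒≈ₙ (sym (parts v))) (divisible lM))
        same : ∀ φ → (φ e + Σ[ φ ] (H ++ R)) + tot φ D′ ≡ tot φ y
        same φ = trans (xy∙z≈zx∙y (φ e) (Σ[ φ ] (H ++ R)) (tot φ D′))
          (trans (cong (_+ Σ[ φ ] (H ++ R)) (eq φ)) (trans (xy∙z≈yz∙x (tot φ D) (Σ[ φ ] Z) (Σ[ φ ] (H ++ R)))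
          (trans (cong (_+ tot φ D) (sym (parts φ))) (sameM φ))))
        larger : Σ[ v ] M < v e + Σ[ v ] (H ++ R)
        larger = subst (_< v e + Σ[ v ] (H ++ R)) (sym (parts v)) (+-monoˡ-< (Σ[ v ] (H ++ R))
          (<-≤-trans (≤-<-trans (≤-trans (m≤m+n _ _) (≤-reflexive (sym (sp v)))) M₁-small) (^-monoʳ-≤ p N<e)))

      M₁≈ : ∀ {T′ Tl′} → Λ⁺ T′ → Split T′ H Tl′ → Σ[ v ] M₁ ≈ₙ Σ[ v ] Tl′
      M₁≈ {T′} {Tl′} l′ sp = ≈ₙ-cancel (Σ[ v ] H) (≈ₙ-trans (≡⇒≈ₙ (trans (+-comm (Σ[ v ] M₁) _) (sym (splitM v))))
        (≈ₙ-trans (divisible lM) (≈ₙ-trans (≈ₙ-sym (divisible l′)) (≡⇒≈ₙ (trans (sp v) (+-comm (Σ[ v ] H) _))))))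

      balance : ∀ {T′ Tl′} (l′ : Λ⁺ T′) (C : Conf m) → Same (cons T′ l′ C) y → Split T′ H Tl′ →
        ∀ φ → tot φ D + Σ[ φ ] M₁ ≡ tot φ C + Σ[ φ ] Tl′
      balance {T′} {Tl′} l′ C same sp φ = cancel-≡ (Σ[ φ ] H) (trans (sameM φ) (sym (same φ)))
        (trans (cong (_+ tot φ D) (splitM φ)) (xy∙z≈zy∙x (Σ[ φ ] H) (Σ[ φ ] M₁) (tot φ D)))
        (trans (cong (_+ tot φ C) (sp φ)) (xy∙z≈zy∙x (Σ[ φ ] H) (Σ[ φ ] Tl′) (tot φ C)))

      above∈D : ∀ {Tl′ e} (C : Conf m) → (∀ φ → tot φ D + Σ[ φ ] M₁ ≡ tot φ C + Σ[ φ ] Tl′) → N < e → 0 < tot (is e) C → 0 < tot (is e) D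
      above∈D {Tl′} {e} C bal N<e e∈C = subst (0 <_) (sym (trans (trans (sym (+-identityʳ _)) (cong (tot (is e) D +_) (sym (is≤hi N<e M₁ M₁≤N)))) (bal (is e)))) (≤-trans e∈C (m≤m+n _ _))

      N∈C : ∀ {Tl′} (C : Conf m) → (∀ φ → tot φ D + Σ[ φ ] M₁ ≡ tot φ C + Σ[ φ ] Tl′) → Σ[ hi N ] Tl′ ≡ 0 → 0 < tot (is N) C
      N∈C {Tl′} C bal low = subst (0 <_) (trans (bal (is N)) (trans (cong (tot (is N) C +_) (is≤hi ≤-refl Tl′ low)) (+-identityʳ _)))
        (≤-trans (≤-trans (≤-reflexive (sym (is-refl N))) (m≤m+n (is N N) (Σ[ is N ] Ml))) (m≤n+m (Σ[ is N ] M₁) (tot (is N) D)))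

      -- `D` already has the m n that its parts demand. Since `M₁` exceeds `Tl′` by n and the totals
      -- agree, `C` has n to spare, which is what a push consumes.
      Ml-unit : ∀ j {Tl′} → Σ[ ω j ] Tl′ + n ≤ Σ[ ω j ] M₁ → (C : Conf m) → (∀ φ → tot φ D + Σ[ φ ] M₁ ≡ tot φ C + Σ[ φ ] Tl′) → n + m * n ≤ tot (ω j) C
      Ml-unit j {Tl′} gap C bal = +-cancelʳ-≤ (Σ[ ω j ] Tl′) _ _ (≤-trans (≤-reflexive (xy∙z≈y∙zx n (m * n) (Σ[ ω j ] Tl′)))
        (≤-trans (+-mono-≤ (tot-norm D j) gap) (≤-reflexive (bal (ω j)))))

      totA<p^N : ∀ b → tot (A b) y < p ^ N
      totA<p^N b = ≤-<-trans (tot-mono (A≤low b) y) (carryFree N)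

      -- All charges are for distinct units below `N`, so by carry-freeness they stay under p^N, and
      -- a gain of p^N wins.
      better-by : ∀ {C : Conf (suc m)} {b c} → Same C y → p ^ N ≤ c → W C + c ≤ W y + tot (A b) y → Better y
      better-by {C} {b} {c} same big h = C , same , +-cancelʳ-< (p ^ N) _ _ (≤-<-trans (≤-trans (+-monoʳ-≤ (W C) big) h) (+-monoʳ-< (W y) (totA<p^N b)))

    -- Nothing in T below N can be exchanged for N yet. Since M does contain N, for the lowest colour present in Tl′ some
    -- worse part has an excess, and `push` brings it up at the price of units of that colour.
    record State (b : ℕ) : Set where
      field
        {T′}  : List ℕ
        l′    : Λ⁺ T′
        C     : Conf m
        Tl′   : List ℕ
        same  : Same (cons T′ l′ C) y
        split : Split T′ H Tl′
        lowT  : Σ[ hi N ] Tl′ ≡ 0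
        cost  : W (cons T′ l′ C) ≤ W y + tot (A b) y
        noN   : Σ[ unit jc ] Tl′ ≡ 0
        <q    : Σ[ ω jc ] Tl′ < q
        some  : 0 < Σ[ (λ e → ⟦ pos jc e <? b ⟧) ] Tl′

    module Step (b : ℕ) (b≤f : b ≤ f) (S : State b) where
      open State S

      bal : ∀ φ → tot φ D + Σ[ φ ] M₁ ≡ tot φ C + Σ[ φ ] Tl′
      bal = balance {T′} {Tl′} l′ C same split

      module At (w : ℕ) (Tl₀ : List ℕ) (sp : ∀ ψ → Σ[ ψ ] Tl′ ≡ ψ w + Σ[ ψ ] Tl₀) (h<b : pos jc w < b)
                (min : Σ[ (λ e → ⟦ pos jc e <? pos jc w ⟧) ] Tl′ ≡ 0) where

        h j : ℕ
        h = pos jc w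
        j = shift h

        opaque
          h<f : h < f
          h<f = <-≤-trans h<b b≤f

          0<h : 0 < h
          0<h = n≢0⇒n>0 (⟦⟧≡0 (pos jc w ≟ 0) (m+n≡0⇒m≡0 _ (trans (sym (sp (unit jc))) noN)))

          w0 : pos j w ≡ 0
          w0 = trans (pos-shift-≥ h w (<⇒≤ h<f) ≤-refl) (n∸n≡0 h)

          w<N : w < N
          w<N = hi≡0 N w (m+n≡0⇒m≡0 _ (trans (sym (sp (hi N))) lowT))

          ωN : ω j N ≡ p ^ (f ∸ h)
          ωN = cong (p ^_) (trans (pos-shift-< h N (<⇒≤ h<f) (subst (_< h) (sym posN) 0<h)) (cong (_+ (f ∸ h)) posN))

          N≢0 : ¬ (pos j N ≡ 0)
          N≢0 z = m>n⇒m∸n≢0 h<f (trans (sym (trans (pos-shift-< h N (<⇒≤ h<f) (subst (_< h) (sym posN) 0<h)) (cong (_+ (f ∸ h)) posN))) z)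

          -- `h` is the lowest colour in `Tl′`, so the rotation divides its norm, which was below q,
          -- by p^h. The unit `N` instead wraps around to p^(f - h), and so `M₁` is ahead in this
          -- norm.
          Tl<ωN : Σ[ ω j ] Tl′ < p ^ (f ∸ h)
          Tl<ωN = *-cancelˡ-< (p ^ h) _ _ (subst₂ _<_ (sym (ω-rotate h Tl′ (<⇒≤ h<f) min))
            (trans (cong (p ^_) (sym (m+[n∸m]≡n (<⇒≤ h<f)))) (^-distribˡ-+-* p h (f ∸ h))) <q)

          gap : Σ[ ω j ] Tl′ + n ≤ Σ[ ω j ] M₁
          gap = ≈ₙ-gap (ω-cong j {M₁} {Tl′} (M₁≈ {T′} {Tl′} l′ split)) (<-≤-trans Tl<ωN (≤-trans (≤-reflexive (sym ωN)) (m≤m+n (ω j N) (Σ[ ω j ] Ml))))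

          enough : n + m * n ≤ tot (ω j) C
          enough = Ml-unit j {Tl′} gap C bal

        ψ : ℕ → ℕ
        ψ e = ⟦ N <? e ⟧ * unit j e

        opaque
          -- `w` contributes at least 1 to the norm of `Tl′`, so `gap` gives `M₁` norm at least 1 +
          -- n = q, enough for a packet of this colour.
          found : 0 < tot ψ C → Bigger
          found some′ with tot-find ψ C some′
          ... | e , ψe , e∈C = bigger e j N<e e0 (unitPart j M₁ (inj₂ q≤)) (above∈D {Tl′} C bal N<e e∈C)
            where
            both : ∀ e → 0 < ψ e → N < e × pos j e ≡ 0
            both e h with N <? e | pos j e ≟ 0
            ... | yes a | yes b = a , b
            N<e : N < e
            N<e = proj₁ (both e ψe)
            e0 : pos j e ≡ 0
            e0 = proj₂ (both e ψe)
            q≤ : q ≤ Σ[ ω j ] M₁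
            q≤ = ≤-trans (≤-reflexive (sym 1+n≡q)) (≤-trans (+-monoˡ-≤ n (≤-trans (0<ω j w) (≤-trans (m≤m+n _ _) (≤-reflexive (sym (sp (ω j))))))) gap)

          -- A tight part has a unit in position 0, because p does not divide n. It is not above `N`
          -- by assumption, and it is not `N`, which has another colour.
          swappable : tot ψ C ≡ 0 → Exchangeable N j C
          swappable none = exchangeable N j C λ Y l sub eq → <-≤-trans (n≢0⇒n>0 λ z → p∤n (subst (p ∣_) eq (no-unit⇒p∣ j Y z)))
              (Σ-mono₀ {unit j} {χ N j} {ψ} pt Y (n≤0⇒n≡0 (≤-trans (sub ψ) (≤-reflexive none))))
            where
            pt : ∀ e → ψ e ≡ 0 → unit j e ≤ χ N j e
            pt e z with pos j e ≟ 0 | N <? e | e <? N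
            ... | no _   | _     | _      = z≤n
            ... | yes _  | _     | yes _  = ≤-trans (0<v e) (≤-reflexive (sym (trans (+-identityʳ _) (+-identityʳ _))))
            ... | yes e0 | no a  | no b   = ⊥-elim (N≢0 (subst (λ x → pos j x ≡ 0) (≤-antisym (≮⇒≥ a) (≮⇒≥ b)) e0))

        T₀ : List ℕ
        T₀ = H ++ Tl₀

        opaque
          spT : ∀ ψ → Σ[ ψ ] T′ ≡ ψ w + Σ[ ψ ] T₀
          spT ψ = trans (split ψ) (trans (cong (Σ[ ψ ] H +_) (sp ψ)) (trans (x∙yz≈y∙xz (Σ[ ψ ] H) (ψ w) (Σ[ ψ ] Tl₀))
            (cong (ψ w +_) (sym (Σ-++ ψ H Tl₀)))))

          w-ok : 0 < χ N j w
          w-ok = subst (0 <_) (sym (χ-yes N j w w<N w0)) (0<v w)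

        module After (ex : Exchangeable N j C) where
          module O = Op N j l′ C {w} {T₀} spT w-ok ex enough
          open O using (z)

          opaque
            sameO : Same (cons O.T′ O.l′ O.C′) y
            sameO φ = trans (O.same φ) (same φ)

            costO : W (cons O.T′ O.l′ O.C′) + Σ[ v ] z ≤ W y + tot (A h) y
            costO = begin
              W (cons O.T′ O.l′ O.C′) + Σ[ v ] z              ≤⟨ O.loss ⟩
              W (cons T′ l′ C) + tot (χ N j) (cons T′ l′ C)   ≤⟨ +-mono-≤ cost (≤-reflexive (same (χ N j))) ⟩
              W y + tot (A b) y + tot (χ N j) y               ≡⟨ +-assoc (W y) _ _ ⟩
              W y + (tot (A b) y + tot (χ N j) y)             ≤⟨ +-monoʳ-≤ (W y) (χ+A≤A h<f h<b y) ⟩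
              W y + tot (A h) y                               ∎
              where open ≤-Reasoning

            splitO : Split O.T′ H (z ++ Tl₀)
            splitO φ = trans (Σ-++ φ z T₀) (trans (cong (Σ[ φ ] z +_) (Σ-++ φ H Tl₀)) (trans (x∙yz≈y∙xz (Σ[ φ ] z) (Σ[ φ ] H) (Σ[ φ ] Tl₀))
              (cong (Σ[ φ ] H +_) (sym (Σ-++ φ z Tl₀)))))

            lowO : Σ[ v ] z < p ^ N → Σ[ hi N ] (z ++ Tl₀) ≡ 0
            lowO small = trans (Σ-++ (hi N) z Tl₀) (cong₂ _+_ (small⇒low N z small) (m+n≡0⇒n≡0 (hi N w) (trans (sym (sp (hi N))) lowT)))

            -- The packet given for `N` is taken out of `z`, whose value `loss` has credited; so its
            -- sinking is already paid for.
            finish : Σ[ v ] z < p ^ N → UnitPart jc z → Better y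
            finish small (Z , R , spz , 0<Z , Z≈1) with swapUp O.C′ O.l′ {Z} {R ++ T₀} N
                (λ φ → trans (Σ-++ φ z T₀) (trans (cong (_+ Σ[ φ ] T₀) (spz φ)) (trans (+-assoc (Σ[ φ ] Z) _ _) (cong (Σ[ φ ] Z +_) (sym (Σ-++ φ R T₀))))))
                (unit≈ jc N Z posN Z≈1)
                0<Z (N∈C {z ++ Tl₀} O.C′ (balance {O.T′} {z ++ Tl₀} O.l′ O.C′ sameO splitO) (lowO small)) (<⇒≤ (≤-<-trans Z≤z small))
              where
              Z≤z : Σ[ v ] Z ≤ Σ[ v ] z
              Z≤z = ≤-trans (m≤m+n _ _) (≤-reflexive (sym (spz v)))
            ... | C″ , same″ , cost″ = better-by {C″} {h} (λ φ → trans (same″ φ) (sameO φ)) ≤-refl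
                  (≤-trans cost″ (≤-trans (+-monoʳ-≤ (W (cons O.T′ O.l′ O.C′)) (≤-trans (m≤m+n _ (Σ[ v ] R)) (≤-reflexive (sym (spz v))))) costO))

            ωz : Σ[ ω jc ] z < q → Σ[ ω jc ] z ≡ p ^ h
            ωz z<q = ≈ₙ-unique (≈ₙ-trans (ω-cong jc {z} {w ∷ []} (≈ₙ-trans O.z≈w (≡⇒≈ₙ (sym (+-identityʳ _))))) (≡⇒≈ₙ (+-identityʳ _)))
              (positive {v} z O.0<z (0<ω jc)) (0<p^ h) (≤-pred (subst (Σ[ ω jc ] z <_) (sym 1+n≡q) z<q)) (p^≤n h<f)

            -- Otherwise the rotation by `h` would be a division, and the norms q and p^h of `z`
            -- would satisfy p^h q = p^h.
            lower : Σ[ ω jc ] z < q → 0 < Σ[ (λ e → ⟦ pos jc e <? h ⟧) ] z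
            lower z<q = n≢0⇒n>0 λ none → <-irrefl (sym (*-cancelˡ-≡ q 1 (p ^ h) {{m^n≢0 p h}}
                (trans (cong (p ^ h *_) (sym O.zq)) (trans (ω-rotate h z (<⇒≤ h<f) none) (trans (ωz z<q) (sym (*-identityʳ _)))))))
              (≤-trans 1<p p≤q)

          next : Σ[ v ] z < p ^ N → Σ[ unit jc ] z ≡ 0 → Σ[ ω jc ] z < q → State h
          next small none z<q = record
            { l′ = O.l′ ; C = O.C′ ; Tl′ = z ++ Tl₀ ; same = sameO ; split = splitO ; lowT = lowO small
            ; cost = ≤-trans (m≤m+n _ (Σ[ v ] z)) costO
            ; noN = trans (Σ-++ (unit jc) z Tl₀) (cong₂ _+_ none (m+n≡0⇒n≡0 (unit jc w) (trans (sym (sp (unit jc))) noN)))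
            -- `z` has the same norm at `jc` as the unit `w` that it replaces.
            ; <q = subst (_< q) (trans (sp (ω jc)) (trans (cong (_+ Σ[ ω jc ] Tl₀) (sym (ωz z<q))) (sym (Σ-++ (ω jc) z Tl₀)))) <q
            ; some = <-≤-trans (lower z<q) (≤-trans (m≤m+n _ _) (≤-reflexive (sym (Σ-++ (λ e → ⟦ pos jc e <? h ⟧) z Tl₀)))) }

          outcome : (Better y ⊎ Bigger) ⊎ State h
          outcome with p ^ N ≤? Σ[ v ] z
          ... | yes big = inj₁ (inj₁ (better-by {cons O.T′ O.l′ O.C′} {h} sameO big costO))
          ... | no ¬big with 0⊎pos (Σ[ unit jc ] z) | q ≤? Σ[ ω jc ] z
          ...   | inj₂ some′ | _        = inj₁ (inj₁ (finish (≰⇒> ¬big) (unitPart jc z (inj₁ some′))))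
          ...   | inj₁ none  | yes q≤z  = inj₁ (inj₁ (finish (≰⇒> ¬big) (unitPart jc z (inj₂ q≤z))))
          ...   | inj₁ none  | no ¬q≤z  = inj₂ (next (≰⇒> ¬big) none (≰⇒> ¬q≤z))

        step : (Better y ⊎ Bigger) ⊎ State h
        step with 0⊎pos (tot ψ C)
        ... | inj₂ some′ = inj₁ (inj₂ (found some′))
        ... | inj₁ none  = After.outcome (swappable none)

      step : (Better y ⊎ Bigger) ⊎ ∃ λ h → h < b × State h
      step with lowest b Tl′ some
      ... | w , Tl₀ , sp , h<b , min with At.step w Tl₀ sp h<b min
      ...   | inj₁ done = inj₁ done
      ...   | inj₂ S′   = inj₂ (pos jc w , h<b , S′)

    opaque
      loop : ∀ k b → b ≤ k → b ≤ f → State b → Better y ⊎ Bigger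
      loop k b b≤k b≤f S with Step.step b b≤f S
      ... | inj₁ done = done
      loop zero    b b≤k b≤f S | inj₂ (h , h<b , S′) = ⊥-elim (<⇒≱ h<b (≤-trans b≤k z≤n))
      loop (suc k) b b≤k b≤f S | inj₂ (h , h<b , S′) = loop k h (≤-pred (≤-trans h<b b≤k)) (≤-trans (<⇒≤ h<b) b≤f) S′

  -- The case of a weight-0 part contained in the larger one

  opaque
    Σ≡0 : ∀ X → Σ[ v ] X ≡ 0 → ∀ φ → Σ[ φ ] X ≡ 0
    Σ≡0 []      z φ = refl
    Σ≡0 (x ∷ X) z φ = ⊥-elim (<⇒≢ (0<v x) (sym (m+n≡0⇒m≡0 (v x) z)))

    Λ⁺-++ : ∀ {Z T} → Σ[ v ] Z ≈ₙ 0 → Λ⁺ T → Λ⁺ (Z ++ T)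
    Λ⁺-++ {Z} {T} Z≈0 (z , d) = subst (0 <_) (sym (Σ-++ v Z T)) (≤-trans z (m≤n+m _ _)) , ≈ₙ-trans (≡⇒≈ₙ (Σ-++ v Z T)) (≈ₙ-+ Z≈0 d)

    -- By `Σω-step` p divides n times `suc` of the count, and n is -1 modulo p. So a tight part has
    -- at least p - 1 units in position 0.
    unit-count : ∀ j Y → Σ[ ω j ] Y ≡ n → p ≤ suc (Σ[ unit j ] Y)
    unit-count j Y eq = ∣⇒≤ (∣m+n∣m⇒∣n (subst (p ∣_) q*≡ (∣m⇒∣m*n (suc (Σ[ unit j ] Y)) (subst (p ∣_) (cong (p ^_) (suc-pred f)) (m∣m*n (p ^ pred f))))) p∣n*)
      where
      q*≡ : q * suc (Σ[ unit j ] Y) ≡ n * suc (Σ[ unit j ] Y) + suc (Σ[ unit j ] Y)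
      q*≡ = trans (cong (_* suc (Σ[ unit j ] Y)) (sym 1+n≡q)) (+-comm (suc (Σ[ unit j ] Y)) _)
      p∣n* : p ∣ n * suc (Σ[ unit j ] Y)
      p∣n* = subst (p ∣_) (trans (Σω-step j Y) (trans (cong (_+ n * Σ[ unit j ] Y) eq) (sym (*-suc n (Σ[ unit j ] Y))))) (m∣m*n _)

  -- When T is contained in M, the second best part X is enlarged until a part containing N can be split off it.
  module Packed {m₁ : ℕ} {T : List ℕ} (lT : Λ⁺ T) {X : List ℕ} (lX : Λ⁺ X) (C₁ : Conf m₁)
                (carryFree : ∀ N → tot (low N) (cons T lT (cons X lX C₁)) < p ^ N)
                {M : List ℕ} (lM : Λ⁺ M) (D : Conf (suc m₁)) (sameM : Same (cons M lM D) (cons T lT (cons X lX C₁))) (al : Aligned T M)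
                (empty : ∀ φ → Σ[ φ ] (Aligned.Tl al) ≡ 0) where

    open Situation lT (cons X lX C₁) carryFree lM D sameM al
    open Aligned al
    open Colours N

    C₀ : Conf (suc m₁)
    C₀ = cons X lX C₁

    ψ : ℕ → ℕ
    ψ e = ⟦ N <? e ⟧

    opaque
      bal : ∀ φ → tot φ D + Σ[ φ ] M₁ ≡ tot φ C₀ + Σ[ φ ] Tl
      bal = balance {T} {Tl} lT C₀ (λ φ → refl) splitT

      M₁Λ : Λ⁺ M₁
      M₁Λ = ≤-trans (0<v N) (m≤m+n _ _) , ≈ₙ-trans (M₁≈ {T} {Tl} lT splitT) (≡⇒≈ₙ (empty v))

      -- With `Tl` empty `M₁` is a part by itself, so the surplus n is present in every norm and not
      -- only in a chosen one.
      norm : ∀ j → n + suc m₁ * n ≤ tot (ω j) C₀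
      norm j = Ml-unit j {Tl} (≤-trans (≤-reflexive (cong (_+ n) (empty (ω j)))) (Λ⁺-norm M₁Λ j)) C₀ bal

      cost-C₀ : ∀ {C : Conf (suc m₁)} → Same C C₀ → W C < W C₀ → Better y
      cost-C₀ {C} same C<C₀ = cons T lT C , (λ φ → cong (Σ[ φ ] T +_) (same φ)) , +-mono-≤-< (≤-reflexive (same v)) C<C₀

      pulled : f ≡ 1 → Better y
      pulled f≡1 with pull f≡1 C₀ (norm 0)
      ... | z , C , eq , zl , cost = cons (z ++ T) (Λ⁺-++ {z} {T} (divisible zl) lT) C , same ,
            +-mono-<-≤ (<-≤-trans (m<m+n (tot v C) (nonempty zl)) (≤-reflexive (eq v))) cost
        where
        same : ∀ φ → Σ[ φ ] (z ++ T) + tot φ C ≡ Σ[ φ ] T + tot φ C₀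
        same φ = trans (cong (_+ tot φ C) (Σ-++ φ z T)) (trans (xy∙z≈y∙zx (Σ[ φ ] z) (Σ[ φ ] T) (tot φ C)) (cong (Σ[ φ ] T +_) (eq φ)))

      found : 0 < tot ψ C₀ → Bigger
      found some with tot-find ψ C₀ some
      ... | e , ψe , e∈C = bigger e (e * pred f) (⟦⟧>0 (N <? e) ψe) (pos-own e)
            (unitPart _ M₁ (unit⊎q _ M₁ (Λ⁺-norm M₁Λ _))) (above∈D {Tl} C₀ bal (⟦⟧>0 (N <? e) ψe) e∈C)

      -- p copies of `N` alone would sum to p^(N + 1).
      is-N<p : tot (is N) y < p
      is-N<p = *-cancelʳ-< (p ^ N) _ _ (≤-<-trans (≤-trans (≤-reflexive (trans (*-comm (tot (is N) y) (p ^ N)) (sym (tot-* (p ^ N) (is N) y)))) (tot-mono pt y)) (carryFree (suc N)))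
        where
        pt : ∀ e → p ^ N * is N e ≤ low (suc N) e
        pt e with e ≟ N | e <? suc N
        ... | no _     | _     = ≤-trans (≤-reflexive (*-zeroʳ (p ^ N))) z≤n
        ... | yes refl | yes _ = ≤-reflexive (trans (*-identityʳ _) (sym (+-identityʳ _)))
        ... | yes refl | no h  = ⊥-elim (h (n<1+n e))

    module NothingAbove (none : tot ψ C₀ ≡ 0) where

      opaque
        part<N : Σ[ is N ] X ≡ 0 → ∀ Z R → Split X Z R → Σ[ v ] Z < p ^ N
        part<N N∉X Z R sp = ≤-<-trans (≤-trans (≤-trans (m≤m+n _ (Σ[ v ] R)) (≤-reflexive (sym (sp v)))) (≤-trans (≤-reflexive (low-all N X X<N))
            (≤-trans (m≤m+n (Σ[ low N ] X) (tot (low N) C₁)) (m≤n+m _ (Σ[ low N ] T))))) (carryFree N)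
          where
          mono : ∀ e → hi N e ≤ ψ e + is N e
          mono e with N ≤? e | N <? e | e ≟ N
          ... | no _  | _     | _      = z≤n
          ... | yes _ | yes _ | _      = s≤s z≤n
          ... | yes _ | no _  | yes _  = ≤-refl
          ... | yes h | no ¬h | no e≢N = ⊥-elim (¬h (≤∧≢⇒< h (e≢N ∘ sym)))
          X<N : Σ[ hi N ] X ≡ 0
          X<N = n≤0⇒n≡0 (≤-trans (Σ-mono mono X) (≤-reflexive (trans (Σ-+ ψ (is N) X) (cong₂ _+_ (m+n≡0⇒m≡0 _ none) N∉X))))

        -- `X` then lies entirely below `N` and can give a packet for it: the swap takes place
        -- between the second part and the later ones, while `T` stays.
        withoutN : Σ[ is N ] X ≡ 0 → Better y
        withoutN N∉X with unitPart jc X (unit⊎q jc X (Λ⁺-norm lX jc))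
        ... | Z , R , sp , 0<Z , Z≈1 with swapUp C₁ lX {Z} {R} N sp
                (unit≈ jc N Z posN Z≈1)
                0<Z (subst (λ a → 0 < a + tot (is N) C₁) N∉X (N∈C {Tl} C₀ bal Tl<N)) (<⇒≤ (part<N N∉X Z R sp))
        ...   | C″ , same , cost = cost-C₀ {C″} same (+-cancelʳ-< (p ^ N) _ _ (≤-<-trans cost (+-monoʳ-< (W C₀) (part<N N∉X Z R sp))))

      -- The second part is to reach 2 n in every norm, so that it can be split in two. The norms
      -- are filled from the highest relative colour downwards, as the charges `A` require; the
      -- colour of `N` itself comes last.
      record Stage (b : ℕ) : Set where
        field
          {X′}  : List ℕ
          l′    : Λ⁺ X′
          C     : Conf m₁
          same  : Same (cons X′ l′ C) C₀
          N∈X   : 0 < Σ[ is N ] X′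
          cost  : W (cons X′ l′ C) ≤ W C₀ + tot (A b) y
          full  : ∀ h → b ≤ h → h < f → n + n ≤ Σ[ ω (shift h) ] X′

      module Advance (1<f : 1 < f) (h : ℕ) (h<f : h < f) (S : Stage (suc h)) where
        open Stage S

        j : ℕ
        j = shift h

        opaque
          within : ∀ Y → (∀ φ → Σ[ φ ] Y ≤ tot φ (cons X′ l′ C)) → Σ[ ψ ] Y ≡ 0
          within Y sub = n≤0⇒n≡0 (≤-trans (sub ψ) (≤-reflexive (trans (same ψ) none)))

          is-N : tot (is N) (cons X′ l′ C) < p
          is-N = ≤-<-trans (≤-trans (≤-reflexive (same (is N))) (m≤n+m _ (Σ[ is N ] T))) is-N<p

          N≢0 : 0 < h → ¬ (pos j N ≡ 0)
          N≢0 0<h z = <⇒≢ 0<h (trans (sym posN) (shift-0 h N h<f z))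

          -- For `h` > 0 the colour differs from that of `N`, and any unit in position 0 will do.
          -- For `h` = 0 the copies of `N` are in position 0 too and have to be outnumbered.
          lowUnit : ∀ Y → Σ[ ψ ] Y ≡ 0 → (h ≡ 0 → Σ[ is N ] Y < Σ[ unit j ] Y) → Σ[ ω j ] Y ≡ n → 0 < Σ[ χ N j ] Y
          lowUnit Y ≤N count eq with 0⊎pos h
          ... | inj₁ h≡0 = +-cancelˡ-< (Σ[ is N ] Y) _ _ (<-≤-trans (subst (_< Σ[ unit j ] Y) (sym (+-identityʳ _)) (count h≡0))
                (≤-trans (Σ-mono₀ {unit j} {λ e → is N e + χ N j e} {ψ} pt Y ≤N) (≤-reflexive (Σ-+ (is N) (χ N j) Y))))
            where
            pt : ∀ e → ψ e ≡ 0 → unit j e ≤ is N e + χ N j e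
            pt e z with pos j e ≟ 0 | e ≟ N | N <? e | e <? N
            ... | no _  | _     | _     | _     = z≤n
            ... | yes _ | yes _ | _     | _     = s≤s z≤n
            ... | yes _ | no _  | _     | yes _ = ≤-trans (0<v e) (≤-reflexive (sym (trans (+-identityʳ _) (+-identityʳ _))))
            ... | yes _ | no ≢N | no a  | no b  = ⊥-elim (≢N (≤-antisym (≮⇒≥ a) (≮⇒≥ b)))
          ... | inj₂ 0<h = <-≤-trans (n≢0⇒n>0 λ z → p∤n (subst (p ∣_) eq (no-unit⇒p∣ j Y z))) (Σ-mono₀ {unit j} {χ N j} {ψ} pt Y ≤N)
            where
            pt : ∀ e → ψ e ≡ 0 → unit j e ≤ χ N j e
            pt e z with pos j e ≟ 0 | N <? e | e <? N
            ... | no _   | _     | _      = z≤n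
            ... | yes _  | _     | yes _  = ≤-trans (0<v e) (≤-reflexive (sym (trans (+-identityʳ _) (+-identityʳ _))))
            ... | yes e0 | no a  | no b   = ⊥-elim (N≢0 0<h (subst (λ x → pos j x ≡ 0) (≤-antisym (≮⇒≥ a) (≮⇒≥ b)) e0))

          swappable : Exchangeable N j C
          swappable = exchangeable N j C λ Y l sub eq → lowUnit Y (within Y λ φ → ≤-trans (sub φ) (m≤n+m _ _))
            -- `X′` keeps a copy of `N`, so at most p - 2 copies are left for `Y`, against at least
            -- p - 1 units in position 0.
            (λ _ → ≤-pred (≤-trans (s≤s (≤-trans (≤-reflexive (+-comm 1 _)) (≤-trans (+-mono-≤ (sub (is N)) N∈X) (≤-reflexive (+-comm (tot (is N) C) _)))))
              (≤-trans is-N (unit-count j Y eq)))) eq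

          -- This is where f > 1 enters: the norm for colour 1 already is at least 2 n, and by
          -- `Σω-step` a norm of exactly n at colour 0 then forces 2 p - 1 units, more than there
          -- are copies of `N`.
          countX : h ≡ 0 → Σ[ ω j ] X′ ≡ n → Σ[ is N ] X′ < Σ[ unit j ] X′
          countX refl eq = ≤-trans (≤-<-trans (m≤m+n _ _) is-N) (≤-pred (≤-trans (+-monoˡ-≤ p (<⇒≤ 1<p)) p+p≤))
            where
            ω-eq : ∀ e → ω (shift 0 + pred f) e ≡ ω (shift 1) e
            ω-eq e = cong (p ^_) (trans (cong (λ a → (e + a) % f) (xy∙z≈xz∙y jc f (pred f))) (pos-+f (shift 1) e))
            p+p≤ : p + p ≤ suc (Σ[ unit j ] X′)
            p+p≤ = *-cancelˡ-≤ n {{>-nonZero 0<n}} (begin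
              n * (p + p)                      ≡⟨ solve 2 (λ n p → n :* (p :+ p) := p :* (n :+ n)) refl n p ⟩
              p * (n + n)                      ≤⟨ *-monoʳ-≤ p (full 1 ≤-refl 1<f) ⟩
              p * Σ[ ω (shift 1) ] X′          ≡⟨ cong (p *_) (sym (Σ-cong ω-eq X′)) ⟩
              p * Σ[ ω (shift 0 + pred f) ] X′ ≡⟨ Σω-step (shift 0) X′ ⟩
              Σ[ ω j ] X′ + n * Σ[ unit j ] X′ ≡⟨ cong (_+ n * Σ[ unit j ] X′) eq ⟩
              n + n * Σ[ unit j ] X′           ≡⟨ sym (*-suc n _) ⟩
              n * suc (Σ[ unit j ] X′)         ∎)
              where open ≤-Reasoning

          enough : Σ[ ω j ] X′ ≡ n → n + m₁ * n ≤ tot (ω j) C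
          enough eq = +-cancelˡ-≤ n _ _ (≤-trans (norm j) (≤-reflexive (trans (sym (same (ω j))) (cong (_+ tot (ω j) C) eq))))

          cheaper : ∀ e → A (suc h) e ≤ A h e
          cheaper = A-mono (n≤1+n h)

          grown : ∀ {w X₀} (sp : ∀ φ → Σ[ φ ] X′ ≡ φ w + Σ[ φ ] X₀) (w-ok : 0 < χ N j w) → Σ[ ω j ] X′ ≡ n → Stage h
          grown {w} {X₀} sp w-ok eq = record { l′ = O.l′ ; C = O.C′ ; same = λ φ → trans (O.same φ) (same φ)
              ; N∈X = <-≤-trans (subst (0 <_) (trans (sp (is N)) (cong (_+ Σ[ is N ] X₀) (⟦⟧-no (w ≟ N) (<⇒≢ O.w<N)))) N∈X) (≤-trans (m≤n+m _ _) (≤-reflexive (sym (Σ-++ (is N) O.z X₀))))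
              ; cost = ≤-trans (m≤m+n _ (Σ[ v ] O.z)) (≤-trans O.loss (≤-trans (+-mono-≤ cost (≤-trans (≤-reflexive (same (χ N j))) (m≤n+m _ (Σ[ χ N j ] T))))
                  (≤-trans (≤-reflexive (+-assoc (W C₀) _ _)) (+-monoʳ-≤ (W C₀) (χ+A≤A h<f (n<1+n h) y)))))
              ; full = full′ }
            where
            module O = Op N j l′ C {w} {X₀} sp w-ok swappable (enough eq)
            full′ : ∀ h′ → h ≤ h′ → h′ < f → n + n ≤ Σ[ ω (shift h′) ] (O.z ++ X₀)
            full′ h′ h≤h′ h′<f with m≤n⇒m<n∨m≡n h≤h′
            ... | inj₁ h<h′ = ≤-trans (full h′ h<h′ h′<f) (≤-trans (≤-reflexive (sp (ω (shift h′)))) (≤-trans (+-monoˡ-≤ (Σ[ ω (shift h′) ] X₀) (≈ω-min (shift h′) {O.z} {w} O.0<z O.z≈w))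
                  (≤-reflexive (sym (Σ-++ (ω (shift h′)) O.z X₀)))))
            -- `w` of norm 1 leaves and `z` of norm q enters: n - 1 + q = 2 n.
            ... | inj₂ refl = ≤-reflexive (sym (trans (Σ-++ (ω j) O.z X₀) (trans (cong (_+ Σ[ ω j ] X₀) (trans O.zq (sym 1+n≡q)))
                  (trans (sym (+-suc n _)) (cong (n +_) (trans (cong (_+ Σ[ ω j ] X₀) (sym (cong (p ^_) O.w0))) (trans (sym (sp (ω j))) eq)))))))

          advance : Stage h
          advance with n + n ≤? Σ[ ω j ] X′
          ... | yes done = record { l′ = l′ ; C = C ; same = same ; N∈X = N∈X ; cost = ≤-trans cost (+-monoʳ-≤ (W C₀) (tot-mono cheaper y)) ; full = full′ }
            where
            full′ : ∀ h′ → h ≤ h′ → h′ < f → n + n ≤ Σ[ ω (shift h′) ] X′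
            full′ h′ h≤h′ h′<f with m≤n⇒m<n∨m≡n h≤h′
            ... | inj₁ h<h′ = full h′ h<h′ h′<f
            ... | inj₂ refl = done
          ... | no ¬done with Σ-find (χ N j) X′ (lowUnit X′ (within X′ λ φ → m≤m+n _ _) (λ h≡0 → countX h≡0 (Λ⁺-exact l′ j ¬done)) (Λ⁺-exact l′ j ¬done))
          ...   | w , X₀ , w-ok , sp = grown {w} {X₀} sp w-ok (Λ⁺-exact l′ j ¬done)

      opaque
        rotation : ∀ i → ∃ λ h → h < f × (∀ x → ω (shift h) x ≡ ω i x)
        rotation i = pos jc (i * pred f) , pos<f jc (i * pred f) , λ x → cong (p ^_) (pos-same {shift (pos jc (i * pred f))} {i} {i * pred f} {x} h0 e0)
          where
          e0 : pos i (i * pred f) ≡ 0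
          e0 = trans (cong (_% f) (+-comm (i * pred f) i)) (pos-own i)
          h0 : pos (shift (pos jc (i * pred f))) (i * pred f) ≡ 0
          h0 = trans (pos-shift-≥ (pos jc (i * pred f)) (i * pred f) (<⇒≤ (pos<f jc (i * pred f))) ≤-refl) (n∸n≡0 (pos jc (i * pred f)))

        norms : ∀ X′ → (∀ h → 0 ≤ h → h < f → n + n ≤ Σ[ ω (shift h) ] X′) → ∀ i → n + n ≤ Σ[ ω i ] X′
        norms X′ full i with rotation i
        ... | h , h<f , ω-eq = subst (n + n ≤_) (Σ-cong ω-eq X′) (full h z≤n h<f)

        -- The half that contains `N` joins `T` and gains at least p^N, more than everything charged
        -- while the second part was filled.
        finish : Stage 0 → Better y
        finish S with halve (Stage.X′ S) N (divisible (Stage.l′ S)) (norms (Stage.X′ S) (Stage.full S)) (Stage.N∈X S)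
        ... | Z , R , sp , lR , Z≈0 , N∈Z = better-by {cons (Z ++ T) (Λ⁺-++ {Z} {T} Z≈0 lT) (cons R lR C)} {0} same′ (member-≤ v N Z N∈Z) (begin
            (Σ[ v ] R + tot v C) + (tot v C + W C) + Σ[ v ] Z   ≡⟨ solve 4 (λ r c w z → (r :+ c) :+ (c :+ w) :+ z := ((z :+ r) :+ c) :+ (c :+ w)) refl (Σ[ v ] R) (tot v C) (W C) (Σ[ v ] Z) ⟩
            ((Σ[ v ] Z + Σ[ v ] R) + tot v C) + (tot v C + W C) ≡⟨ cong (λ a → (a + tot v C) + (tot v C + W C)) (sym (sp v)) ⟩
            (Σ[ v ] X′ + tot v C) + (tot v C + W C)             ≤⟨ +-mono-≤ (≤-reflexive (same v)) cost ⟩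
            tot v C₀ + (W C₀ + tot (A 0) y)                     ≡⟨ sym (+-assoc (tot v C₀) _ _) ⟩
            tot v C₀ + W C₀ + tot (A 0) y                       ∎)
          where
          open Stage S
          open ≤-Reasoning
          same′ : ∀ φ → Σ[ φ ] (Z ++ T) + (Σ[ φ ] R + tot φ C) ≡ Σ[ φ ] T + tot φ C₀
          same′ φ = trans (cong (_+ (Σ[ φ ] R + tot φ C)) (Σ-++ φ Z T)) (trans (solve 4 (λ z t r c → (z :+ t) :+ (r :+ c) := t :+ ((z :+ r) :+ c)) refl (Σ[ φ ] Z) (Σ[ φ ] T) (Σ[ φ ] R) (tot φ C))
            (cong (Σ[ φ ] T +_) (trans (cong (_+ tot φ C) (sym (sp φ))) (same φ))))

        descend : 1 < f → ∀ b → b ≤ f → Stage b → Better y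
        descend 1<f zero    _   S = finish S
        descend 1<f (suc b) b<f S = descend 1<f b (<⇒≤ b<f) (Advance.advance 1<f b b<f S)

        withN : 1 < f → 0 < Σ[ is N ] X → Better y
        withN 1<f N∈X = descend 1<f f ≤-refl (record { l′ = lX ; C = C₁ ; same = λ φ → refl ; N∈X = N∈X ; cost = m≤m+n _ _
          ; full = λ h f≤h h<f → ⊥-elim (<⇒≱ h<f f≤h) })

    opaque
      packed : Better y ⊎ Bigger
      packed with f ≟ 1 | 0⊎pos (tot ψ C₀)
      ... | yes f≡1 | _         = inj₁ (pulled f≡1)
      ... | no  _   | inj₂ some = inj₂ (found some)
      ... | no f≢1  | inj₁ none with 0⊎pos (Σ[ is N ] X)
      ...   | inj₁ N∉X = inj₁ (NothingAbove.withoutN none N∉X)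
      ...   | inj₂ N∈X = inj₁ (NothingAbove.withN none (≤∧≢⇒< (>-nonZero⁻¹ f) (f≢1 ∘ sym)) N∈X)

  -- A minimal composition has the largest weight-0 part

  CarryFree : ∀ {m} → Conf m → Set
  CarryFree C = ∀ N → tot (low N) C < p ^ N

  module _ {m : ℕ} {T : List ℕ} (lT : Λ⁺ T) (C : Conf m) (cf : CarryFree (cons T lT C)) {M : List ℕ} (lM : Λ⁺ M) (D : Conf m)
           (sameM : Same (cons M lM D) (cons T lT C)) (al : Aligned T M) where

    open Situation lT C cf lM D sameM al
    open Aligned al
    open Colours N

    opaque
      direct : UnitPart jc Tl → Better y
      direct (Z , R , spz , 0<Z , Z≈1) with swapUp C lT {Z} {H ++ R} N
          (λ φ → trans (splitT φ) (trans (cong (Σ[ φ ] H +_) (spz φ)) (trans (x∙yz≈y∙xz (Σ[ φ ] H) (Σ[ φ ] Z) (Σ[ φ ] R))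
            (cong (Σ[ φ ] Z +_) (sym (Σ-++ φ H R))))))
          (unit≈ jc N Z posN Z≈1)
          0<Z (N∈C {Tl} C (balance {T} {Tl} lT C (λ φ → refl) splitT) Tl<N) (<⇒≤ (Z<N Z R spz))
        where
        Z<N : ∀ Z R → Split Tl Z R → Σ[ v ] Z < p ^ N
        Z<N Z R spz = ≤-<-trans (begin
          Σ[ v ] Z                           ≤⟨ m≤m+n _ _ ⟩
          Σ[ v ] Z + Σ[ v ] R                ≡⟨ sym (spz v) ⟩
          Σ[ v ] Tl                          ≡⟨ low-all N Tl Tl<N ⟩
          Σ[ low N ] Tl                      ≤⟨ m≤n+m _ _ ⟩
          Σ[ low N ] H + Σ[ low N ] Tl       ≡⟨ sym (splitT (low N)) ⟩
          Σ[ low N ] T                       ≤⟨ m≤m+n _ _ ⟩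
          tot (low N) y                      ∎) (cf N)
          where open ≤-Reasoning
      ... | C′ , same , cost = C′ , same , +-cancelʳ-< (p ^ N) _ _ (≤-<-trans cost (+-monoʳ-< (W y) (≤-<-trans (≤-trans (m≤m+n _ _) (≤-trans (≤-reflexive (sym (spz v))) (≤-reflexive (low-all N Tl Tl<N))))
            (≤-<-trans (≤-trans (m≤n+m _ (Σ[ low N ] H)) (≤-trans (≤-reflexive (sym (splitT (low N)))) (m≤m+n _ _))) (cf N)))))

      search : Σ[ unit jc ] Tl ≡ 0 → Σ[ ω jc ] Tl < q → 0 < Σ[ v ] Tl → Better y ⊎ Bigger
      search none <q 0<Tl = loop f f ≤-refl ≤-refl (record { l′ = lT ; C = C ; Tl′ = Tl ; same = λ φ → refl ; split = splitT ; lowT = Tl<N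
        ; cost = m≤m+n _ _ ; noN = none ; <q = <q ; some = positive {v} Tl 0<Tl (λ e → ≤-reflexive (sym (⟦⟧-yes (pos jc e <? f) (pos<f jc e)))) })

  opaque
    dispatch : ∀ {m T} (lT : Λ⁺ T) (C : Conf m) (cf : CarryFree (cons T lT C)) {M} (lM : Λ⁺ M) (D : Conf m)
      (sameM : Same (cons M lM D) (cons T lT C)) (al : Aligned T M) → Σ[ v ] T < Σ[ v ] M →
      Better (cons T lT C) ⊎ Situation.Bigger lT C cf lM D sameM al
    dispatch lT C cf lM D sameM al T<M with 0⊎pos (Σ[ unit (Colours.jc N) ] Tl) | q ≤? Σ[ ω (Colours.jc N) ] Tl | 0⊎pos (Σ[ v ] Tl)
      where open Aligned al
    ... | inj₂ some | _       | _        = inj₁ (direct lT C cf lM D sameM al (unitPart (Colours.jc (Aligned.N al)) (Aligned.Tl al) (inj₁ some)))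
    ... | inj₁ _    | yes q≤  | _        = inj₁ (direct lT C cf lM D sameM al (unitPart (Colours.jc (Aligned.N al)) (Aligned.Tl al) (inj₂ q≤)))
    ... | inj₁ none | no ¬q≤  | inj₂ 0<  = search lT C cf lM D sameM al none (≰⇒> ¬q≤) 0<
    -- Only the free part follows `T`, so its value is the whole weight, and it shrinks when the
    -- first part grows.
    dispatch {T = T} lT (free F) cf {M} lM (free G) sameM al T<M | inj₁ _ | no _ | inj₁ empty =
      inj₁ (cons M lM (free G) , sameM , +-monoˡ-< 0 (+-cancelˡ-< (Σ[ v ] M) _ _ (subst (_< Σ[ v ] M + Σ[ v ] F) (sym (sameM v)) (+-monoˡ-< (Σ[ v ] F) T<M))))
    dispatch lT (cons X lX C₁) cf lM D sameM al T<M | inj₁ _ | no _ | inj₁ empty = Packed.packed lT lX C₁ cf lM D sameM al (Σ≡0 (Aligned.Tl al) empty)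

  -- `Bigger` restarts the argument with a larger `M`; the fuel bounds how far the value of `M` can
  -- still rise, as it never exceeds the total.
  Improves : ℕ → Set
  Improves k = ∀ {m T} (lT : Λ⁺ T) (C : Conf m) → CarryFree (cons T lT C) → ∀ {M} (lM : Λ⁺ M) (D : Conf m) →
    Same (cons M lM D) (cons T lT C) → Σ[ v ] T < Σ[ v ] M → tot v (cons T lT C) < Σ[ v ] M + k → Better (cons T lT C)

  opaque
    improves-0 : Improves 0
    improves-0 lT C cf {M} lM D same T<M fuel = ⊥-elim (<⇒≱ fuel (≤-trans (≤-reflexive (+-identityʳ _)) (≤-trans (m≤m+n (Σ[ v ] M) (tot v D)) (≤-reflexive (same v)))))

    improves-suc : ∀ k → Improves k → Improves (suc k)
    improves-suc k rec {T = T} lT C cf {M} lM D same T<M fuel with dispatch lT C cf lM D same (align (Σ[ (λ _ → 1) ] M) T M ≤-refl cfM T<M) T<M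
      where
      cfM : CarryFreeL M
      cfM N = ≤-<-trans (≤-trans (m≤m+n _ _) (≤-reflexive (same (low N)))) (cf N)
    ... | inj₁ better = better
    ... | inj₂ (M′ , lM′ , D′ , same′ , M<M′) = rec lT C cf lM′ D′ same′ (<-trans T<M M<M′) (<-≤-trans fuel (≤-trans (≤-reflexive (+-suc _ k)) (+-monoˡ-≤ k M<M′)))

  improves : ∀ k → Improves k
  improves zero    = improves-0
  improves (suc k) = improves-suc k (improves k)

  opaque
    -- Two minimal compositions of the same number must therefore have weight-0 parts of equal
    -- value.
    improve : ∀ {m T} (lT : Λ⁺ T) (C : Conf m) → CarryFree (cons T lT C) → ∀ {M} (lM : Λ⁺ M) (D : Conf m) →
      Same (cons M lM D) (cons T lT C) → Σ[ v ] T < Σ[ v ] M → Better (cons T lT C)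
    improve {T = T} lT C cf {M} lM D same T<M = improves (suc (tot v (cons T lT C))) lT C cf lM D same T<M (m≤n+m _ (Σ[ v ] M))

  -- Digit vectors as multisets of units

  units : ℕ → List ℕ → List ℕ
  units i []       = []
  units i (k ∷ ks) = replicate k i ++ units (suc i) ks

  Digit : List ℕ → Set
  Digit = All (_< p)

  opaque
    Σ-units : ∀ φ i k ks → Σ[ φ ] (units i (k ∷ ks)) ≡ k * φ i + Σ[ φ ] (units (suc i) ks)
    Σ-units φ i k ks = trans (Σ-++ φ (replicate k i) _) (cong (_+ Σ[ φ ] (units (suc i) ks)) (Σ-replicate φ k i))

    Σ-units-suc : ∀ φ i ks → Σ[ φ ] (units (suc i) ks) ≡ Σ[ (λ e → φ (suc e)) ] (units i ks)
    Σ-units-suc φ i []       = refl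
    Σ-units-suc φ i (k ∷ ks) = trans (Σ-units φ (suc i) k ks) (trans (cong (k * φ (suc i) +_) (Σ-units-suc φ (suc i) ks)) (sym (Σ-units (λ e → φ (suc e)) i k ks)))

    units-val : ∀ i ks → Σ[ v ] (units i ks) ≡ p ^ i * val p ks
    units-val i []       = sym (*-zeroʳ (p ^ i))
    units-val i (k ∷ ks) = trans (Σ-units v i k ks) (trans (cong (k * v i +_) (units-val (suc i) ks))
      (solve 4 (λ k a p b → k :* a :+ (p :* a) :* b := a :* (k :+ p :* b)) refl k (p ^ i) p (val p ks)))

    units₀-val : ∀ ks → Σ[ v ] (units 0 ks) ≡ val p ks
    units₀-val ks = trans (units-val 0 ks) (+-identityʳ _)

    units-above : ∀ φ i → (∀ e → i ≤ e → φ e ≡ 0) → ∀ ks → Σ[ φ ] (units i ks) ≡ 0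
    units-above φ i z []       = refl
    units-above φ i z (k ∷ ks) = trans (Σ-units φ i k ks) (cong₂ _+_ (trans (cong (k *_) (z i ≤-refl)) (*-zeroʳ k)) (units-above φ (suc i) (λ e h → z e (<⇒≤ h)) ks))

    -- The extra p^i carries the induction: a digit k < p at place i contributes k p^i, and (k + 1)
    -- p^i is at most p^(i + 1).
    units-carryFree : ∀ {ks} → Digit ks → ∀ N i → i ≤ N → Σ[ low N ] (units i ks) + p ^ i ≤ p ^ N
    units-carryFree [] N i i≤N = ^-monoʳ-≤ p i≤N
    units-carryFree {k ∷ ks} (k<p ∷ ds) N i i≤N with m≤n⇒m<n∨m≡n i≤N
    ... | inj₁ i<N = ≤-trans (≤-reflexive (trans (cong (_+ p ^ i) (trans (Σ-units (low N) i k ks) (cong (λ a → k * a + Σ[ low N ] (units (suc i) ks)) (trans (cong (_* v i) (⟦⟧-yes (i <? N) i<N)) (+-identityʳ _)))))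
          (solve 3 (λ k a b → (k :* a :+ b) :+ a := b :+ (con 1 :+ k) :* a) refl k (p ^ i) (Σ[ low N ] (units (suc i) ks)))))
          (≤-trans (+-monoʳ-≤ (Σ[ low N ] (units (suc i) ks)) (*-monoˡ-≤ (p ^ i) k<p)) (units-carryFree ds N (suc i) i<N))
    ... | inj₂ refl = ≤-reflexive (cong (_+ p ^ i) (units-above (low i) i (λ e i≤e → cong (_* v e) (⟦⟧-no (e <? i) (≤⇒≯ i≤e))) (k ∷ ks)))

    carryFree : ∀ {ks} → Digit ks → ∀ N → Σ[ low N ] (units 0 ks) < p ^ N
    carryFree {ks} ds N = ≤-trans (≤-reflexive (+-comm 1 _)) (units-carryFree ds N 0 z≤n)

    digits : ∀ k → ∃ λ ks → Digit ks × val p ks ≡ k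
    digits k = go k (<-wellFounded k)
      where
      go : ∀ k → Acc _<_ k → ∃ λ ks → Digit ks × val p ks ≡ k
      go zero    _        = [] , [] , refl
      go (suc k) (acc rs) with go (suc k / p) (rs (m/n<m (suc k) p 1<p))
      ... | ks , ds , eq = suc k % p ∷ ks , m%n<n (suc k) p ∷ ds , trans (cong (suc k % p +_) (trans (cong (p *_) eq) (*-comm p _))) (sym (m≡m%n+[m/n]*n (suc k) p))

    val-injective : ∀ {ks js} → length ks ≡ length js → Digit ks → Digit js → val p ks ≡ val p js → ks ≡ js
    val-injective {[]}     {[]}     _   _           _           _  = refl
    val-injective {k ∷ ks} {j ∷ js} len (k<p ∷ kds) (j<p ∷ jds) eq = cong₂ _∷_ k≡j
        (val-injective (suc-injective len) kds jds (*-cancelˡ-≡ _ _ p (+-cancelˡ-≡ k _ _ (trans eq (cong (_+ p * val p js) (sym k≡j))))))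
      where
      first : ∀ k ks → k < p → (k + p * val p ks) % p ≡ k
      first k ks k<p = trans (cong (λ a → (k + a) % p) (*-comm p (val p ks))) (trans ([m+kn]%n≡m%n k (val p ks) p) (m<n⇒m%n≡m k<p))
      k≡j : k ≡ j
      k≡j = trans (sym (first k ks k<p)) (trans (cong (_% p) eq) (first j js j<p))

    subs-unique : ∀ ks → Unique (subs ks)
    subs-unique []       = [] ∷ []
      where open import Data.List.Relation.Unary.AllPairs using ([]; _∷_)
    subs-unique (k ∷ ks) = cartesianProductWith⁺ _∷_ ∷-injective (upTo⁺ (suc k)) (subs-unique ks)

    subs⁻ : ∀ {k ks js′} → js′ ∈ subs (k ∷ ks) → ∃₂ λ j js → js′ ≡ j ∷ js × j ≤ k × js ∈ subs ks
    subs⁻ {k} {ks} m with ∈-cartesianProductWith⁻ _∷_ (upTo (suc k)) (subs ks) m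
    ... | j , js , j∈ , js∈ , refl = j , js , refl , ≤-pred (∈-upTo⁻ j∈) , js∈

    subs⁺ : ∀ {j k js ks} → j ≤ k → js ∈ subs ks → (j ∷ js) ∈ subs (k ∷ ks)
    subs⁺ j≤k js∈ = ∈-cartesianProductWith⁺ _∷_ (∈-upTo⁺ (s≤s j≤k)) js∈

    subs-length : ∀ ks {js} → js ∈ subs ks → length js ≡ length ks
    subs-length []       (here refl) = refl
    subs-length (k ∷ ks) m with subs⁻ {k} {ks} m
    ... | j , js , refl , _ , js∈ = cong suc (subs-length ks js∈)

    subs-digit : ∀ {ks js} → Digit ks → js ∈ subs ks → Digit js
    subs-digit []         (here refl) = []
    subs-digit {k ∷ ks} (k<p ∷ ds) m with subs⁻ {k} {ks} m
    ... | j , js , refl , j≤k , js∈ = ≤-<-trans j≤k k<p ∷ subs-digit ds js∈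

    subs-split : ∀ i ks {js} → js ∈ subs ks → Split (units i ks) (units i js) (units i (minus ks js))
    subs-split i []       (here refl) φ = refl
    subs-split i (k ∷ ks) m φ with subs⁻ {k} {ks} m
    ... | j , js , refl , j≤k , js∈ = trans (Σ-units φ i k ks) (trans (cong₂ (λ a b → a * φ i + b) (sym (m+[n∸m]≡n j≤k)) (subs-split (suc i) ks js∈ φ))
          (trans (solve 5 (λ j d x a b → (j :+ d) :* x :+ (a :+ b) := (j :* x :+ a) :+ (d :* x :+ b)) refl j (k ∸ j) (φ i) (Σ[ φ ] (units (suc i) js)) (Σ[ φ ] (units (suc i) (minus ks js))))
            (sym (cong₂ _+_ (Σ-units φ i j js) (Σ-units φ i (k ∸ j) (minus ks js))))))

  drop : ℕ → List ℕ → List ℕ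
  drop i []      = []
  drop i (x ∷ X) with x ≟ i
  ... | yes _ = drop i X
  ... | no  _ = x ∷ drop i X

  opaque
    Σ-drop : ∀ φ i X → Σ[ φ ] X ≡ Σ[ is i ] X * φ i + Σ[ φ ] (drop i X)
    Σ-drop φ i []      = refl
    Σ-drop φ i (x ∷ X) with x ≟ i
    ... | yes refl = trans (cong (φ x +_) (Σ-drop φ x X)) (sym (+-assoc (φ x) _ _))
    ... | no  _    = trans (cong (φ x +_) (Σ-drop φ i X)) (x∙yz≈y∙xz (φ x) (Σ[ is i ] X * φ i) (Σ[ φ ] (drop i X)))

    first-digit : ∀ i k ks X Y → (∀ φ → Σ[ φ ] X + Σ[ φ ] Y ≡ Σ[ φ ] (units i (k ∷ ks))) → Σ[ is i ] X + Σ[ is i ] Y ≡ k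
    first-digit i k ks X Y eq = trans (eq (is i)) (trans (Σ-units (is i) i k ks) (trans (cong₂ (λ u w → k * u + w) (⟦⟧-yes (i ≟ i) refl)
      (units-above (is i) (suc i) (λ e i<e → ⟦⟧-no (e ≟ i) (λ e≡i → <⇒≢ i<e (sym e≡i))) ks)) (trans (+-identityʳ _) (*-identityʳ k))))

    -- Evaluated at `is i` the hypothesis says how the lowest digit is shared between `X` and `Y`;
    -- dropping all copies of `i` leaves the same problem for the higher digits.
    decompose : ∀ i ks X Y → (∀ φ → Σ[ φ ] X + Σ[ φ ] Y ≡ Σ[ φ ] (units i ks)) →
      ∃ λ js → js ∈ subs ks × X ≋ units i js × Y ≋ units i (minus ks js)
    decompose i []       X Y eq = [] , here refl , (λ φ → m+n≡0⇒m≡0 _ (eq φ)) , λ φ → m+n≡0⇒n≡0 (Σ[ φ ] X) (eq φ)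
    decompose i (k ∷ ks) X Y eq with decompose (suc i) ks (drop i X) (drop i Y) rest
      where
      rest : ∀ φ → Σ[ φ ] (drop i X) + Σ[ φ ] (drop i Y) ≡ Σ[ φ ] (units (suc i) ks)
      rest φ = +-cancelˡ-≡ (k * φ i) _ _ (trans (trans (cong (λ u → u * φ i + (Σ[ φ ] (drop i X) + Σ[ φ ] (drop i Y))) (sym (first-digit i k ks X Y eq)))
        (trans (solve 5 (λ a b x s t → (a :+ b) :* x :+ (s :+ t) := (a :* x :+ s) :+ (b :* x :+ t)) refl (Σ[ is i ] X) (Σ[ is i ] Y) (φ i) (Σ[ φ ] (drop i X)) (Σ[ φ ] (drop i Y)))
          (sym (cong₂ _+_ (Σ-drop φ i X) (Σ-drop φ i Y))))) (trans (eq φ) (Σ-units φ i k ks)))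
    ... | js , js∈ , X≋ , Y≋ = Σ[ is i ] X ∷ js , subs⁺ {Σ[ is i ] X} {k} {js} {ks} (m+n≤o⇒m≤o _ (≤-reflexive (first-digit i k ks X Y eq))) js∈ ,
          (λ φ → trans (Σ-drop φ i X) (trans (cong (Σ[ is i ] X * φ i +_) (X≋ φ)) (sym (Σ-units φ i (Σ[ is i ] X) js)))) ,
          (λ φ → trans (Σ-drop φ i Y) (trans (cong₂ (λ u w → u * φ i + w) Y-digit (Y≋ φ)) (sym (Σ-units φ i (k ∸ Σ[ is i ] X) (minus ks js)))))
      where
      Y-digit : Σ[ is i ] Y ≡ k ∸ Σ[ is i ] X
      Y-digit = trans (sym (m+n∸m≡n (Σ[ is i ] X) _)) (cong (_∸ Σ[ is i ] X) (first-digit i k ks X Y eq))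

    -- Digit sums in base q as norms

    digitSum-fuel : ∀ m k {u w} → k ≤ u → k ≤ w → digitSum′ m u k ≡ digitSum′ m w k
    digitSum-fuel m zero    {zero}  {zero}  _  _  = refl
    digitSum-fuel m zero    {zero}  {suc w} _  _  = digitSum-fuel m zero {zero} {w} z≤n z≤n
    digitSum-fuel m zero    {suc u} {zero}  _  _  = digitSum-fuel m zero {u} {zero} z≤n z≤n
    digitSum-fuel m zero    {suc u} {suc w} _  _  = digitSum-fuel m zero {u} {w} z≤n z≤n
    digitSum-fuel m (suc k) {suc u} {suc w} (s≤s k≤u) (s≤s k≤w) = cong (suc k % suc (suc m) +_)
        (digitSum-fuel m (suc k / suc (suc m)) (≤-trans smaller k≤u) (≤-trans smaller k≤w))
      where
      smaller : suc k / suc (suc m) ≤ k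
      smaller = ≤-pred (m/n<m (suc k) (suc (suc m)) (s≤s (s≤s z≤n)))

    digitSum-step : ∀ m a k → a < suc (suc m) → digitSum (suc (suc m)) (a + suc (suc m) * k) ≡ a + digitSum (suc (suc m)) k
    digitSum-step m a k a<b = trans (digitSum-fuel m x (≤-refl {x}) (n≤1+n x)) (cong₂ _+_ x%b
        (trans (cong (digitSum′ m x) x/b) (digitSum-fuel m k (≤-trans (m≤n*m k b) (m≤n+m _ a)) ≤-refl)))
      where
      b : ℕ
      b = suc (suc m)
      x : ℕ
      x = a + suc (suc m) * k
      x%b : (a + suc (suc m) * k) % suc (suc m) ≡ a
      x%b = trans (cong (λ c → (a + c) % b) (*-comm b k)) (trans ([m+kn]%n≡m%n a k b) (m<n⇒m%n≡m a<b))
      x/b : (a + suc (suc m) * k) / suc (suc m) ≡ k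
      x/b = *-cancelˡ-≡ _ _ b (+-cancelˡ-≡ a _ _ (trans (cong₂ _+_ (sym x%b) (*-comm b (x / b))) (sym (m≡m%n+[m/n]*n x b))))

    digitSum-+ : ∀ b → 1 < b → ∀ a k → a < b → digitSum b (a + b * k) ≡ a + digitSum b k
    digitSum-+ (suc (suc m)) 1<b = digitSum-step m
    digitSum-+ (suc zero)    (s≤s ())

    digitSum-0 : ∀ b → digitSum b 0 ≡ 0
    digitSum-0 zero          = refl
    digitSum-0 (suc zero)    = refl
    digitSum-0 (suc (suc m)) = refl

    -- `a` is the base-q digit under construction and `i` the place of the next base-p digit inside
    -- it. At `suc i ≡ f` the digit is complete and both start again from 0.
    digitSum-units : ∀ {ks} → Digit ks → ∀ i a → i < f → a < p ^ i → digitSum q (a + p ^ i * val p ks) ≡ a + Σ[ ω i ] (units 0 ks)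
    digitSum-units {[]} [] i a i<f a<p^i = trans (cong (digitSum q) (trans (cong (a +_) (trans (*-zeroʳ (p ^ i)) (sym (*-zeroʳ q)))) refl))
      (trans (digitSum-+ q 1<q a 0 (<-trans a<p^i (p^<q i<f))) (cong (a +_) (digitSum-0 q)))
      where
      1<q : 1 < q
      1<q = ≤-trans 1<p p≤q
    digitSum-units {k ∷ ks} (k<p ∷ ds) i a i<f a<p^i = trans (cong (digitSum q) regroup) (trans (split (m≤n⇒m<n∨m≡n i<f))
        (trans (+-assoc a _ _) (cong (a +_) (sym (trans (Σ-units (ω i) 0 k ks) (cong₂ (λ u w → k * p ^ u + w) (m<n⇒m%n≡m i<f) (Σ-units-suc (ω i) 0 ks)))))))
      where
      1<q : 1 < q
      1<q = ≤-trans 1<p p≤q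
      regroup : a + p ^ i * (k + p * val p ks) ≡ (a + k * p ^ i) + p ^ suc i * val p ks
      regroup = solve 5 (λ a x k p w → a :+ x :* (k :+ p :* w) := (a :+ k :* x) :+ (p :* x) :* w) refl a (p ^ i) k p (val p ks)
      small : a + k * p ^ i < p ^ suc i
      small = ≤-trans (+-monoˡ-≤ (k * p ^ i) a<p^i) (*-monoˡ-≤ (p ^ i) k<p)
      ω-suc : ∀ e → ω (suc i) e ≡ ω i (suc e)
      ω-suc e = cong (λ x → p ^ (x % f)) (+-suc e i)
      split : suc i < f ⊎ suc i ≡ f → digitSum q ((a + k * p ^ i) + p ^ suc i * val p ks) ≡ a + k * p ^ i + Σ[ (λ e → ω i (suc e)) ] (units 0 ks)
      split (inj₁ 1+i<f) = trans (digitSum-units ds (suc i) _ 1+i<f small) (cong (a + k * p ^ i +_) (Σ-cong ω-suc (units 0 ks)))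
      split (inj₂ 1+i≡f) = trans (cong (λ b → digitSum q ((a + k * p ^ i) + b * val p ks)) p^1+i≡q) (trans (digitSum-+ q 1<q (a + k * p ^ i) (val p ks) (subst (a + k * p ^ i <_) p^1+i≡q small))
        (cong (a + k * p ^ i +_) (trans (cong (digitSum q) (sym (+-identityʳ _))) (trans (digitSum-units ds 0 0 (≤-trans (s≤s z≤n) i<f) (s≤s z≤n)) (Σ-cong ω-wrap (units 0 ks))))))
        where
        p^1+i≡q : p ^ suc i ≡ q
        p^1+i≡q = cong (p ^_) 1+i≡f
        ω-wrap : ∀ e → ω 0 e ≡ ω i (suc e)
        ω-wrap e = cong (p ^_) (sym (trans (cong (_% f) (trans (sym (+-suc e i)) (cong (e +_) 1+i≡f))) (trans ([m+n]%n≡m%n e f) (cong (_% f) (sym (+-identityʳ e))))))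

    norm≡digitSum : ∀ {ks} → Digit ks → ∀ j → j < f → digitSum q (val p ks * p ^ j) ≡ Σ[ ω j ] (units 0 ks)
    norm≡digitSum {ks} ds j j<f = trans (cong (digitSum q) (*-comm (val p ks) (p ^ j))) (digitSum-units ds j 0 j<f (0<p^ j))

-- The semiring of polynomials and orders of vanishing at t = 0

module Polynomials (F : FiniteField) where

  open import Defs
  open import Level using (0ℓ)
  open import Data.Nat as ℕ using (ℕ; zero; suc; z<s; s<s)
  open import Data.Nat.Properties using (<-trans; n<1+n; ≤-pred)
  open import Data.List.Base as List using (List; []; _∷_)
  open import Data.Product
  import Relation.Binary.PropositionalEquality as ≡
  open ≡ using (_≡_)
  open import Data.List.Relation.Unary.All using (All; []; _∷_)
  open import Algebra.Bundles using (CommutativeSemiring)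
  open import Relation.Binary.Structures using (IsEquivalence)
  open import Algebra.Structures.Biased using (isCommutativeSemiringˡ)

  open FiniteField F hiding (p; f; q)
  open import Relation.Binary.Reasoning.Setoid setoid
  open import Algebra.Properties.CommutativeSemigroup +-commutativeSemigroup using (interchange; x∙yz≈y∙xz)

  infixl 6 _+ₚ_
  infixl 7 _*ₚ_
  infix 4 _≋_

  opaque
    _+ₚ_ _*ₚ_ : Poly F → Poly F → Poly F
    P +ₚ Q = _⊕_ F P Q
    P *ₚ Q = _⊗_ F P Q

  coeff : Poly F → ℕ → Carrier
  coeff []      n       = 0#
  coeff (a ∷ P) zero    = a
  coeff (a ∷ P) (suc n) = coeff P n

  record _≋_ (P Q : Poly F) : Set where
    constructor mk
    field at : ∀ n → coeff P n ≈ coeff Q n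
  open _≋_ public

  opaque
    unfolding _+ₚ_

    ⊗≡*ₚ : ∀ P Q → _⊗_ F P Q ≡ P *ₚ Q
    ⊗≡*ₚ P Q = ≡.refl

    Σₚ≡foldr : ∀ Ps → Σₚ F Ps ≡ List.foldr _+ₚ_ [] Ps
    Σₚ≡foldr Ps = ≡.refl

    +ₚ-identityˡ : ∀ P → [] +ₚ P ≋ P
    +ₚ-identityˡ P = mk λ n → refl

    *ₚ-zeroˡ : ∀ P → [] *ₚ P ≋ []
    *ₚ-zeroˡ P = mk λ n → refl

    coeff-+ : ∀ P Q n → coeff (P +ₚ Q) n ≈ coeff P n + coeff Q n
    coeff-+ []      Q       n       = sym (+-identityˡ _)
    coeff-+ (a ∷ P) []      n       = sym (+-identityʳ _)
    coeff-+ (a ∷ P) (b ∷ Q) zero    = refl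
    coeff-+ (a ∷ P) (b ∷ Q) (suc n) = coeff-+ P Q n

    coeff-map : ∀ a P n → coeff (List.map (a *_) P) n ≈ a * coeff P n
    coeff-map a []      n       = sym (zeroʳ a)
    coeff-map a (b ∷ P) zero    = refl
    coeff-map a (b ∷ P) (suc n) = coeff-map a P n

    coeff-*-zero : ∀ a P Q → coeff ((a ∷ P) *ₚ Q) 0 ≈ a * coeff Q 0
    coeff-*-zero a P Q = trans (coeff-+ (List.map (a *_) Q) _ 0) (trans (+-identityʳ _) (coeff-map a Q 0))

    coeff-*-suc : ∀ a P Q n → coeff ((a ∷ P) *ₚ Q) (suc n) ≈ a * coeff Q (suc n) + coeff (P *ₚ Q) n
    coeff-*-suc a P Q n = trans (coeff-+ (List.map (a *_) Q) _ (suc n)) (+-congʳ (coeff-map a Q (suc n)))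

    *ₚ-congˡ : ∀ P {Q Q′} → Q ≋ Q′ → P *ₚ Q ≋ P *ₚ Q′
    *ₚ-congˡ []      eq = mk λ n → refl
    *ₚ-congˡ (a ∷ P) {Q} {Q′} eq = mk λ where
      zero    → trans (coeff-*-zero a P Q) (trans (*-congˡ (at eq 0)) (sym (coeff-*-zero a P Q′)))
      (suc n) → trans (coeff-*-suc a P Q n) (trans (+-cong (*-congˡ (at eq (suc n))) (at (*ₚ-congˡ P eq) n)) (sym (coeff-*-suc a P Q′ n)))

    *ₚ-zero : ∀ P Q → (∀ n → coeff P n ≈ 0#) → ∀ n → coeff (P *ₚ Q) n ≈ 0#
    *ₚ-zero []      Q eq n       = refl
    *ₚ-zero (a ∷ P) Q eq zero    = trans (coeff-*-zero a P Q) (trans (*-congʳ (eq 0)) (zeroˡ _))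
    *ₚ-zero (a ∷ P) Q eq (suc n) = trans (coeff-*-suc a P Q n) (trans (+-cong (trans (*-congʳ (eq 0)) (zeroˡ _)) (*ₚ-zero P Q (λ n → eq (suc n)) n)) (+-identityˡ _))

    *ₚ-congʳ : ∀ P P′ Q → P ≋ P′ → P *ₚ Q ≋ P′ *ₚ Q
    *ₚ-congʳ []      P′       Q eq = mk λ n → sym (*ₚ-zero P′ Q (λ n → sym (at eq n)) n)
    *ₚ-congʳ (a ∷ P) []       Q eq = mk λ n → *ₚ-zero (a ∷ P) Q (at eq) n
    *ₚ-congʳ (a ∷ P) (b ∷ P′) Q eq = mk λ where
      zero    → trans (coeff-*-zero a P Q) (trans (*-congʳ (at eq 0)) (sym (coeff-*-zero b P′ Q)))
      (suc n) → trans (coeff-*-suc a P Q n) (trans (+-cong (*-congʳ (at eq 0)) (at (*ₚ-congʳ P P′ Q (mk λ n → at eq (suc n))) n)) (sym (coeff-*-suc b P′ Q n)))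

    *ₚ-distribʳ : ∀ R P Q → (P +ₚ Q) *ₚ R ≋ P *ₚ R +ₚ Q *ₚ R
    *ₚ-distribʳ R []      Q       = mk λ n → refl
    *ₚ-distribʳ R (a ∷ P) []      = mk λ n → sym (trans (coeff-+ ((a ∷ P) *ₚ R) [] n) (+-identityʳ _))
    *ₚ-distribʳ R (a ∷ P) (b ∷ Q) = mk λ where
      zero → begin
        coeff ((a + b ∷ P +ₚ Q) *ₚ R) 0  ≈⟨ coeff-*-zero (a + b) (P +ₚ Q) R ⟩
        (a + b) * coeff R 0              ≈⟨ distribʳ _ a b ⟩
        a * coeff R 0 + b * coeff R 0    ≈⟨ +-cong (coeff-*-zero a P R) (coeff-*-zero b Q R) ⟨
        coeff ((a ∷ P) *ₚ R) 0 + coeff ((b ∷ Q) *ₚ R) 0 ≈⟨ coeff-+ ((a ∷ P) *ₚ R) _ 0 ⟨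
        coeff ((a ∷ P) *ₚ R +ₚ (b ∷ Q) *ₚ R) 0 ∎
      (suc n) → begin
        coeff ((a + b ∷ P +ₚ Q) *ₚ R) (suc n)  ≈⟨ coeff-*-suc (a + b) (P +ₚ Q) R n ⟩
        (a + b) * coeff R (suc n) + coeff ((P +ₚ Q) *ₚ R) n  ≈⟨ +-cong (distribʳ _ a b) (trans (at (*ₚ-distribʳ R P Q) n) (coeff-+ (P *ₚ R) _ n)) ⟩
        (a * coeff R (suc n) + b * coeff R (suc n)) + (coeff (P *ₚ R) n + coeff (Q *ₚ R) n) ≈⟨ interchange _ _ _ _ ⟩
        (a * coeff R (suc n) + coeff (P *ₚ R) n) + (b * coeff R (suc n) + coeff (Q *ₚ R) n) ≈⟨ +-cong (coeff-*-suc a P R n) (coeff-*-suc b Q R n) ⟨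
        coeff ((a ∷ P) *ₚ R) (suc n) + coeff ((b ∷ Q) *ₚ R) (suc n) ≈⟨ coeff-+ ((a ∷ P) *ₚ R) _ (suc n) ⟨
        coeff ((a ∷ P) *ₚ R +ₚ (b ∷ Q) *ₚ R) (suc n) ∎

    coeff-*ʳ-zero : ∀ P b Q → coeff (P *ₚ (b ∷ Q)) 0 ≈ b * coeff P 0
    coeff-*ʳ-zero []      b Q = sym (zeroʳ b)
    coeff-*ʳ-zero (a ∷ P) b Q = trans (coeff-*-zero a P (b ∷ Q)) (*-comm a b)

    coeff-*ʳ-suc : ∀ P b Q n → coeff (P *ₚ (b ∷ Q)) (suc n) ≈ b * coeff P (suc n) + coeff (P *ₚ Q) n
    coeff-*ʳ-suc []      b Q n       = sym (trans (+-identityʳ _) (zeroʳ b))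
    coeff-*ʳ-suc (a ∷ P) b Q zero    = trans (coeff-*-suc a P (b ∷ Q) 0) (trans (+-comm _ _) (+-cong (coeff-*ʳ-zero P b Q) (sym (coeff-*-zero a P Q))))
    coeff-*ʳ-suc (a ∷ P) b Q (suc n) = trans (coeff-*-suc a P (b ∷ Q) (suc n)) (trans (+-congˡ (coeff-*ʳ-suc P b Q n))
      (trans (x∙yz≈y∙xz _ _ _) (+-congˡ (sym (coeff-*-suc a P Q n)))))

    *ₚ-zeroʳ : ∀ P n → coeff (P *ₚ []) n ≈ 0#
    *ₚ-zeroʳ []      n       = refl
    *ₚ-zeroʳ (a ∷ P) zero    = refl
    *ₚ-zeroʳ (a ∷ P) (suc n) = *ₚ-zeroʳ P n

    *ₚ-comm : ∀ P Q → P *ₚ Q ≋ Q *ₚ P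
    *ₚ-comm []      Q = mk λ n → sym (*ₚ-zeroʳ Q n)
    *ₚ-comm (a ∷ P) Q = mk λ where
      zero    → trans (coeff-*-zero a P Q) (sym (coeff-*ʳ-zero Q a P))
      (suc n) → trans (coeff-*-suc a P Q n) (trans (+-congˡ (at (*ₚ-comm P Q) n)) (sym (coeff-*ʳ-suc Q a P n)))

    map-*ₚ : ∀ a P Q n → coeff (List.map (a *_) P *ₚ Q) n ≈ a * coeff (P *ₚ Q) n
    map-*ₚ a []      Q n       = sym (zeroʳ a)
    map-*ₚ a (b ∷ P) Q zero    = trans (coeff-*-zero (a * b) (List.map (a *_) P) Q) (trans (*-assoc a b _) (*-congˡ (sym (coeff-*-zero b P Q))))
    map-*ₚ a (b ∷ P) Q (suc n) = trans (coeff-*-suc (a * b) (List.map (a *_) P) Q n) (trans (+-cong (*-assoc a b _) (map-*ₚ a P Q n))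
      (trans (sym (distribˡ a _ _)) (*-congˡ (sym (coeff-*-suc b P Q n)))))

    *ₚ-assoc : ∀ P Q R → (P *ₚ Q) *ₚ R ≋ P *ₚ (Q *ₚ R)
    *ₚ-assoc []      Q R = mk λ n → refl
    *ₚ-assoc (a ∷ P) Q R = mk λ where
      zero → begin
        coeff ((List.map (a *_) Q +ₚ (0# ∷ P *ₚ Q)) *ₚ R) 0  ≈⟨ at (*ₚ-distribʳ R (List.map (a *_) Q) (0# ∷ P *ₚ Q)) 0 ⟩
        coeff (List.map (a *_) Q *ₚ R +ₚ (0# ∷ P *ₚ Q) *ₚ R) 0 ≈⟨ coeff-+ (List.map (a *_) Q *ₚ R) _ 0 ⟩
        coeff (List.map (a *_) Q *ₚ R) 0 + coeff ((0# ∷ P *ₚ Q) *ₚ R) 0 ≈⟨ +-cong (map-*ₚ a Q R 0) (trans (coeff-*-zero 0# (P *ₚ Q) R) (zeroˡ _)) ⟩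
        a * coeff (Q *ₚ R) 0 + 0# ≈⟨ +-identityʳ _ ⟩
        a * coeff (Q *ₚ R) 0 ≈⟨ coeff-*-zero a P (Q *ₚ R) ⟨
        coeff ((a ∷ P) *ₚ (Q *ₚ R)) 0 ∎
      (suc n) → begin
        coeff ((List.map (a *_) Q +ₚ (0# ∷ P *ₚ Q)) *ₚ R) (suc n)  ≈⟨ at (*ₚ-distribʳ R (List.map (a *_) Q) (0# ∷ P *ₚ Q)) (suc n) ⟩
        coeff (List.map (a *_) Q *ₚ R +ₚ (0# ∷ P *ₚ Q) *ₚ R) (suc n) ≈⟨ coeff-+ (List.map (a *_) Q *ₚ R) _ (suc n) ⟩
        coeff (List.map (a *_) Q *ₚ R) (suc n) + coeff ((0# ∷ P *ₚ Q) *ₚ R) (suc n)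
          ≈⟨ +-cong (map-*ₚ a Q R (suc n)) (trans (coeff-*-suc 0# (P *ₚ Q) R n) (trans (+-congʳ (zeroˡ _)) (trans (+-identityˡ _) (at (*ₚ-assoc P Q R) n)))) ⟩
        a * coeff (Q *ₚ R) (suc n) + coeff (P *ₚ (Q *ₚ R)) n ≈⟨ coeff-*-suc a P (Q *ₚ R) n ⟨
        coeff ((a ∷ P) *ₚ (Q *ₚ R)) (suc n) ∎

    *ₚ-identityˡ : ∀ P → one F *ₚ P ≋ P
    *ₚ-identityˡ P = mk λ where
      zero    → trans (coeff-*-zero 1# [] P) (*-identityˡ _)
      (suc n) → trans (coeff-*-suc 1# [] P n) (trans (+-identityʳ _) (*-identityˡ _))

  ≋-isEquivalence : IsEquivalence _≋_
  ≋-isEquivalence = record { refl = mk λ n → refl ; sym = λ eq → mk λ n → sym (at eq n) ; trans = λ eq eq′ → mk λ n → trans (at eq n) (at eq′ n) }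

  module ≋ = IsEquivalence ≋-isEquivalence

  polySemiring : CommutativeSemiring 0ℓ 0ℓ
  polySemiring = record { Carrier = Poly F ; _≈_ = _≋_ ; _+_ = _+ₚ_ ; _*_ = _*ₚ_ ; 0# = [] ; 1# = one F
    ; isCommutativeSemiring = isCommutativeSemiringˡ record
      { +-isCommutativeMonoid = record { isMonoid = record { isSemigroup = record
          { isMagma = record { isEquivalence = ≋-isEquivalence
            ; ∙-cong = λ {P} {P′} {Q} {Q′} eq eq′ → mk λ n → trans (coeff-+ P Q n) (trans (+-cong (at eq n) (at eq′ n)) (sym (coeff-+ P′ Q′ n))) }
          ; assoc = λ P Q R → mk λ n → trans (coeff-+ (P +ₚ Q) R n) (trans (+-congʳ (coeff-+ P Q n)) (trans (+-assoc _ _ _)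
              (trans (+-congˡ (sym (coeff-+ Q R n))) (sym (coeff-+ P (Q +ₚ R) n))))) }
          ; identity = +ₚ-identityˡ , λ P → mk λ n → trans (coeff-+ P [] n) (+-identityʳ _) }
        ; comm = λ P Q → mk λ n → trans (coeff-+ P Q n) (trans (+-comm _ _) (sym (coeff-+ Q P n))) }
      ; *-isCommutativeMonoid = record { isMonoid = record { isSemigroup = record
          { isMagma = record { isEquivalence = ≋-isEquivalence
            ; ∙-cong = λ {P} {P′} {Q} {Q′} eq eq′ → ≋.trans (*ₚ-congʳ P P′ Q eq) (*ₚ-congˡ P′ eq′) }
          ; assoc = *ₚ-assoc }
          ; identity = *ₚ-identityˡ , λ P → ≋.trans (*ₚ-comm P (one F)) (*ₚ-identityˡ P) }
        ; comm = *ₚ-comm }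
      ; distribʳ = *ₚ-distribʳ
      ; zeroˡ = *ₚ-zeroˡ } }

  Vanishes : Poly F → ℕ → Set
  Vanishes P k = ∀ i → i ℕ.< k → coeff P i ≈ 0#

  opaque
    unfolding _+ₚ_

    *ₚ-vanishes : ∀ P Q k l → Vanishes P k → Vanishes Q l → Vanishes (P *ₚ Q) (k ℕ.+ l)
    *ₚ-vanishes []      Q k       l vP vQ i       i<   = refl
    *ₚ-vanishes (a ∷ P) Q zero    l vP vQ zero    i<l  = trans (coeff-*-zero a P Q) (trans (*-congˡ (vQ 0 i<l)) (zeroʳ a))
    *ₚ-vanishes (a ∷ P) Q zero    l vP vQ (suc i) i<l  = trans (coeff-*-suc a P Q i) (trans (+-cong (trans (*-congˡ (vQ (suc i) i<l)) (zeroʳ a))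
      (*ₚ-vanishes P Q 0 l (λ _ ()) vQ i (<-trans (n<1+n i) i<l))) (+-identityˡ _))
    *ₚ-vanishes (a ∷ P) Q (suc k) l vP vQ zero    i<   = trans (coeff-*-zero a P Q) (trans (*-congʳ (vP 0 z<s)) (zeroˡ _))
    *ₚ-vanishes (a ∷ P) Q (suc k) l vP vQ (suc i) i<   = trans (coeff-*-suc a P Q i) (trans (+-cong (trans (*-congʳ (vP 0 z<s)) (zeroˡ _))
      (*ₚ-vanishes P Q k l (λ j j<k → vP (suc j) (s<s j<k)) vQ i (≤-pred i<))) (+-identityˡ _))

    *ₚ-leading : ∀ P Q k l → Vanishes P k → Vanishes Q l → coeff (P *ₚ Q) (k ℕ.+ l) ≈ coeff P k * coeff Q l
    *ₚ-leading []      Q k       l       vP vQ = sym (zeroˡ _)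
    *ₚ-leading (a ∷ P) Q zero    zero    vP vQ = coeff-*-zero a P Q
    *ₚ-leading (a ∷ P) Q zero    (suc l) vP vQ = trans (coeff-*-suc a P Q l) (trans (+-congˡ (*ₚ-vanishes P Q 0 (suc l) (λ _ ()) vQ l (n<1+n l))) (+-identityʳ _))
    *ₚ-leading (a ∷ P) Q (suc k) l       vP vQ = trans (coeff-*-suc a P Q (k ℕ.+ l)) (trans (+-cong (trans (*-congʳ (vP 0 z<s)) (zeroˡ _))
      (*ₚ-leading P Q k l (λ j j<k → vP (suc j) (s<s j<k)) vQ)) (+-identityˡ _))

    isZero⇒coeff : ∀ {P} → IsZero F P → ∀ n → coeff P n ≈ 0#
    isZero⇒coeff []       n       = refl
    isZero⇒coeff (z ∷ zs) zero    = z
    isZero⇒coeff (z ∷ zs) (suc n) = isZero⇒coeff zs n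

    coeff⇒isZero : ∀ P → (∀ n → coeff P n ≈ 0#) → IsZero F P
    coeff⇒isZero []      z = []
    coeff⇒isZero (a ∷ P) z = z 0 ∷ coeff⇒isZero P λ n → z (suc n)

-- Power sums over a finite field

module FieldTheory (F : FiniteField) where

  open import Defs
  open Expansions using (module ListSums; module Binomials)
  open import Data.Nat as ℕ using (ℕ; zero; suc; _<_; _≤_; z<s; s≤s; NonZero)
  import Data.Nat.Properties as ℕₚ
  open import Data.Nat.DivMod using (_%_; _/_; m≡m%n+[m/n]*n; m%n<n)
  open import Data.Nat.Divisibility using (_∣_; divides; m%n≡0⇒n∣m; n∣m⇒m%n≡0)
  open import Data.Nat.Primality using (prime⇒irreducible)
  open import Data.Nat.Coprimality using (coprime-Bézout; Coprime)
  open import Data.Nat.GCD using (module Bézout)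
  open import Data.Fin as Fin using (Fin; zero; suc; punchIn; _≟_)
  open import Data.Fin.Properties using (punchIn-injective; punchInᵢ≢i; all?; ¬∀⟶∃¬; suc-injective)
  open import Data.Fin.Permutation using (Permutation; permutation)
  open import Data.List.Base as List using (List; []; _∷_; allFin; tabulate; length; replicate)
  open import Data.Product
  open import Data.Sum
  open import Data.Empty using (⊥; ⊥-elim)
  open import Function using (_∘_; id)
  open import Relation.Nullary
  import Relation.Binary.PropositionalEquality as ≡
  open ≡ using (_≡_)

  open FiniteField F hiding (p; f; q; zero)
  open import Algebra.Properties.Ring ring using (-‿injective; [y-z]x≈yx-zx; x∙y⁻¹≈ε⇒x≈y; -0#≈0#)
  open import Algebra.Properties.Semiring.Exp semiring
  open import Algebra.Properties.Semiring.Mult semiring renaming (_×_ to _·_)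
  open import Algebra.Properties.CommutativeSemiring.Exp commutativeSemiring using (^-distrib-*)
  open import Relation.Binary.Reasoning.Setoid setoid
  open import Algebra.Properties.Semiring.Sum semiring using (sum; sum-cong-≋; *-distribˡ-sum; ∑-distrib-+; sum-remove; sum-permute; sum-replicate)
  open ListSums commutativeSemiring using (∑)
  import Algebra.Properties.CommutativeMonoid.Sum *-commutativeMonoid as ∏

  opaque
    _≈?_ : ∀ x y → Dec (x ≈ y)
    x ≈? y with enum-surjective x | enum-surjective y
    ... | i , eᵢ≈x | j , eⱼ≈y with i ≟ j
    ...   | yes ≡.refl = yes (trans (sym eᵢ≈x) eⱼ≈y)
    ...   | no  i≢j    = no λ x≈y → i≢j (enum-injective i j (trans eᵢ≈x (trans x≈y (sym eⱼ≈y))))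

    *-cancel-0 : ∀ {x y} → ¬ (x ≈ 0#) → x * y ≈ 0# → y ≈ 0#
    *-cancel-0 {x} {y} x≉0 xy≈0 with inverse x x≉0
    ... | x⁻¹ , xx⁻¹≈1 = begin
      y               ≈⟨ *-identityˡ y ⟨
      1# * y          ≈⟨ *-congʳ (trans (*-comm x⁻¹ x) xx⁻¹≈1) ⟨
      (x⁻¹ * x) * y   ≈⟨ *-assoc x⁻¹ x y ⟩
      x⁻¹ * (x * y)   ≈⟨ *-congˡ xy≈0 ⟩
      x⁻¹ * 0#        ≈⟨ zeroʳ x⁻¹ ⟩
      0#              ∎

    *-nonzero : ∀ {x y} → ¬ (x ≈ 0#) → ¬ (y ≈ 0#) → ¬ (x * y ≈ 0#)
    *-nonzero x≉0 y≉0 xy≈0 = y≉0 (*-cancel-0 x≉0 xy≈0)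

    ^-nonzero : ∀ {x} k → ¬ (x ≈ 0#) → ¬ (x ^ k ≈ 0#)
    ^-nonzero zero    x≉0 = 1≉0
    ^-nonzero (suc k) x≉0 = *-nonzero x≉0 (^-nonzero k x≉0)

    fixed⇒0 : ∀ {a y} → ¬ (a ≈ 1#) → y ≈ a * y → y ≈ 0#
    fixed⇒0 {a} {y} a≉1 y≈ay = *-cancel-0 (λ a-1≈0 → a≉1 (x∙y⁻¹≈ε⇒x≈y a 1# a-1≈0)) (begin
      (a - 1#) * y      ≈⟨ [y-z]x≈yx-zx y a 1# ⟩
      a * y - 1# * y    ≈⟨ +-cong (sym y≈ay) (-‿cong (*-identityˡ y)) ⟩
      y - y             ≈⟨ -‿inverseʳ y ⟩
      0#                ∎)

  eval : List Carrier → Carrier → Carrier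
  eval []      x = 0#
  eval (a ∷ P) x = a + x * eval P x

  -- The quotient on division by x - r: its coefficients are the intermediate values of Horner's
  -- scheme.
  quot : Carrier → List Carrier → List Carrier
  quot r []          = []
  quot r (a ∷ [])    = []
  quot r (a ∷ b ∷ P) = eval (b ∷ P) r ∷ quot r (b ∷ P)

  opaque
    quot-length : ∀ r a P → length (quot r (a ∷ P)) ≡ length P
    quot-length r a []      = ≡.refl
    quot-length r a (b ∷ P) = ≡.cong suc (quot-length r b P)

    eval-quot : ∀ r P x → eval P x ≈ eval P r + (x - r) * eval (quot r P) x
    eval-quot r []          x = sym (trans (+-identityˡ _) (zeroʳ _))
    eval-quot r (a ∷ [])    x = trans (+-congˡ (zeroʳ x)) (sym (trans (+-cong (+-congˡ (zeroʳ r)) (zeroʳ _)) (+-identityʳ _)))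
    eval-quot r (a ∷ b ∷ P) x = begin
      a + x * eval (b ∷ P) x                           ≈⟨ +-congˡ (*-congˡ (eval-quot r (b ∷ P) x)) ⟩
      a + x * (e + (x - r) * Q)                        ≈⟨ +-congˡ (distribˡ x e _) ⟩
      a + (x * e + x * ((x - r) * Q))                  ≈⟨ +-congˡ (+-cong split (trans (sym (*-assoc x _ Q)) (trans (*-congʳ (*-comm x _)) (*-assoc _ x Q)))) ⟩
      a + ((r * e + (x - r) * e) + (x - r) * (x * Q))  ≈⟨ +-congˡ (+-assoc _ _ _) ⟩
      a + (r * e + ((x - r) * e + (x - r) * (x * Q)))  ≈⟨ +-assoc _ _ _ ⟨
      (a + r * e) + ((x - r) * e + (x - r) * (x * Q))  ≈⟨ +-congˡ (distribˡ (x - r) e _) ⟨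
      (a + r * e) + (x - r) * (e + x * Q)              ∎
      where
      e Q : Carrier
      e = eval (b ∷ P) r
      Q = eval (quot r (b ∷ P)) x
      split : x * e ≈ r * e + (x - r) * e
      split = sym (trans (sym (distribʳ e r (x - r))) (*-congʳ (trans (sym (+-assoc r x (- r))) (trans (+-congʳ (+-comm r x)) (trans (+-assoc x r (- r)) (trans (+-congˡ (-‿inverseʳ r)) (+-identityʳ x)))))))

    -- A list of length at most `m` has degree below `m`. One root is divided out; the others differ
    -- from it and so remain roots of the quotient.
    manyRoots : ∀ m (ρ : Fin m → Carrier) → (∀ i j → ρ i ≈ ρ j → i ≡ j) → ∀ P → length P ≤ m → (∀ i → eval P (ρ i) ≈ 0#) → ∀ x → eval P x ≈ 0#
    manyRoots m       ρ inj []      len       roots x = refl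
    manyRoots (suc m) ρ inj (a ∷ P) (s≤s len) roots x = trans (eval-quot (ρ zero) (a ∷ P) x) (trans (+-cong (roots zero)
      (trans (*-congˡ (manyRoots m (ρ ∘ suc) (λ i j eq → suc-injective (inj (suc i) (suc j) eq)) (quot (ρ zero) (a ∷ P))
        (≡.subst (_≤ m) (≡.sym (quot-length (ρ zero) a P)) len) roots′ x)) (zeroʳ _))) (+-identityˡ 0#))
      where
      roots′ : ∀ i → eval (quot (ρ zero) (a ∷ P)) (ρ (suc i)) ≈ 0#
      roots′ i = *-cancel-0 {ρ (suc i) - ρ zero} (λ z → case-suc (inj (suc i) zero (x∙y⁻¹≈ε⇒x≈y _ _ z)))
        (trans (sym (+-identityˡ _)) (trans (+-congʳ (sym (roots zero))) (trans (sym (eval-quot (ρ zero) (a ∷ P) (ρ (suc i)))) (roots (suc i)))))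
        where
        case-suc : ¬ (Fin.suc i ≡ zero)
        case-suc ()

  -- xᵏ⁺¹ − 1
  rootsOfUnity : ℕ → List Carrier
  rootsOfUnity k = - 1# ∷ replicate k 0# List.++ 1# ∷ []

  opaque
    eval-rootsOfUnity : ∀ k x → eval (rootsOfUnity k) x ≈ - 1# + x ^ suc k
    eval-rootsOfUnity k x = +-congˡ (*-congˡ (go k))
      where
      go : ∀ k → eval (replicate k 0# List.++ 1# ∷ []) x ≈ x ^ k
      go zero    = trans (+-congˡ (zeroʳ x)) (+-identityʳ 1#)
      go (suc k) = trans (+-identityˡ _) (*-congˡ (go k))

    length-rootsOfUnity : ∀ k → length (rootsOfUnity k) ≡ suc (suc k)
    length-rootsOfUnity k = ≡.cong suc (go k)
      where
      go : ∀ k → length (replicate k 0# List.++ 1# ∷ []) ≡ suc k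
      go zero    = ≡.refl
      go (suc k) = ≡.cong suc (go k)

    sum≈∑-tabulate : ∀ {n} {A : Set} (g : A → Carrier) (h : Fin n → A) → ∑ g (tabulate h) ≈ sum (λ i → g (h i))
    sum≈∑-tabulate {zero}  g h = refl
    sum≈∑-tabulate {suc n} g h = +-congˡ (sum≈∑-tabulate g (h ∘ suc))

  module Enumerated (m : ℕ) (e : Fin (suc m) → Carrier) (inj : ∀ i j → e i ≈ e j → i ≡ j) (surj : ∀ x → ∃ λ i → e i ≈ x) where

    index : Carrier → Fin (suc m)
    index x = proj₁ (surj x)

    e-index : ∀ x → e (index x) ≈ x
    e-index x = proj₂ (surj x)

    induced : (g h : Carrier → Carrier) → (∀ {x y} → x ≈ y → g x ≈ g y) → (∀ {x y} → x ≈ y → h x ≈ h y) → (∀ x → g (h x) ≈ x) → (∀ x → h (g x) ≈ x) → Permutation (suc m) (suc m)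
    induced g h g-cong h-cong gh hg = permutation (λ i → index (g (e i))) (λ i → index (h (e i)))
      (λ i → inj _ _ (trans (e-index _) (trans (g-cong (e-index _)) (gh (e i)))))
      (λ i → inj _ _ (trans (e-index _) (trans (h-cong (e-index _)) (hg (e i)))))

    scaling : ∀ a → ¬ (a ≈ 0#) → Permutation (suc m) (suc m)
    scaling a a≉0 = induced (a *_) (a⁻¹ *_) *-congˡ *-congˡ
        (λ x → trans (sym (*-assoc a a⁻¹ x)) (trans (*-congʳ aa⁻¹≈1) (*-identityˡ x)))
        (λ x → trans (sym (*-assoc a⁻¹ a x)) (trans (*-congʳ (trans (*-comm a⁻¹ a) aa⁻¹≈1)) (*-identityˡ x)))
      where
      a⁻¹ : Carrier
      a⁻¹ = proj₁ (inverse a a≉0)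
      aa⁻¹≈1 : a * a⁻¹ ≈ 1#
      aa⁻¹≈1 = proj₂ (inverse a a≉0)

    z₀ : Fin (suc m)
    z₀ = index 0#

    unit′ : Fin m → Carrier
    unit′ j = e (punchIn z₀ j)

    power : ℕ → Carrier
    power k = sum (λ i → e i ^ k)

    -- 1 is substituted for 0 in the product of all field elements.
    nz : Carrier → Carrier → Carrier
    nz x y with x ≈? 0#
    ... | yes _ = 1#
    ... | no  _ = y

    opaque
      nz-yes : ∀ {x} y → x ≈ 0# → nz x y ≈ 1#
      nz-yes {x} y x≈0 with x ≈? 0#
      ... | yes _  = refl
      ... | no x≉0 = ⊥-elim (x≉0 x≈0)

      nz-no : ∀ {x} y → ¬ (x ≈ 0#) → nz x y ≈ y
      nz-no {x} y x≉0 with x ≈? 0#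
      ... | yes x≈0 = ⊥-elim (x≉0 x≈0)
      ... | no  _   = refl

      unit′≉0 : ∀ j → ¬ (unit′ j ≈ 0#)
      unit′≉0 j u≈0 = punchInᵢ≢i z₀ j (inj _ _ (trans u≈0 (sym (e-index 0#))))

      -- Translation by 1 permutes the field, so adding 1 to every element leaves the sum of all
      -- elements unchanged.
      ×1≈0 : suc m · 1# ≈ 0#
      ×1≈0 = x+s≈s⇒x≈0 (begin
        suc m · 1# + sum e           ≈⟨ +-comm _ _ ⟩
        sum e + suc m · 1#           ≈⟨ +-congˡ (sym (sum-replicate (suc m))) ⟩
        sum e + sum {suc m} (λ _ → 1#) ≈⟨ ∑-distrib-+ e (λ _ → 1#) ⟨
        sum (λ i → e i + 1#)         ≈⟨ sum-cong-≋ (λ i → sym (e-index (e i + 1#))) ⟩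
        sum (λ i → e (index (e i + 1#))) ≈⟨ sum-permute e (induced (_+ 1#) (_- 1#) +-congʳ +-congʳ
             (λ x → trans (+-assoc x _ _) (trans (+-congˡ (-‿inverseˡ 1#)) (+-identityʳ x)))
             (λ x → trans (+-assoc x _ _) (trans (+-congˡ (-‿inverseʳ 1#)) (+-identityʳ x)))) ⟨
        sum e                        ∎)
        where
        x+s≈s⇒x≈0 : ∀ {x s} → x + s ≈ s → x ≈ 0#
        x+s≈s⇒x≈0 {x} {s} eq = trans (sym (+-identityʳ x)) (trans (+-congˡ (sym (-‿inverseʳ s))) (trans (sym (+-assoc x s (- s))) (trans (+-congʳ eq) (-‿inverseʳ s))))

      ∏-nonzero : ∀ {n} (g : Fin n → Carrier) → (∀ i → ¬ (g i ≈ 0#)) → ¬ (∏.sum g ≈ 0#)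
      ∏-nonzero {zero}  g g≉0 = 1≉0
      ∏-nonzero {suc n} g g≉0 = *-nonzero (g≉0 zero) (∏-nonzero (g ∘ suc) (g≉0 ∘ suc))

      -- Multiplication by `a` permutes the nonzero elements, so the factor a^m does not change
      -- their product.
      fermat : ∀ a → ¬ (a ≈ 0#) → a ^ m ≈ 1#
      fermat a a≉0 = cancel (begin
        a ^ m * ∏.sum h                  ≈⟨ *-congʳ (sym k-product) ⟩
        ∏.sum k * ∏.sum h                ≈⟨ ∏.∑-distrib-+ k h ⟨
        ∏.sum (λ i → k i * h i)          ≈⟨ ∏.sum-cong-≋ (λ i → step i (e i ≈? 0#)) ⟩
        ∏.sum (λ i → h (index (a * e i))) ≈⟨ ∏.sum-permute h (scaling a a≉0) ⟨
        ∏.sum h                          ∎) (∏-nonzero h h≉0)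
        where
        h k : Fin (suc m) → Carrier
        h i = nz (e i) (e i)
        k i = nz (e i) a
        h≉0 : ∀ i → ¬ (h i ≈ 0#)
        h≉0 i h≈0 with e i ≈? 0#
        ... | yes e≈0 = 1≉0 h≈0
        ... | no  e≉0 = e≉0 h≈0
        step : ∀ i → Dec (e i ≈ 0#) → k i * h i ≈ h (index (a * e i))
        step i (yes e≈0) = trans (*-cong (nz-yes a e≈0) (nz-yes (e i) e≈0)) (trans (*-identityˡ 1#)
          (sym (nz-yes _ (trans (e-index _) (trans (*-congˡ e≈0) (zeroʳ a))))))
        step i (no e≉0) = trans (*-cong (nz-no a e≉0) (nz-no (e i) e≉0)) (sym (trans (nz-no _ (λ z → *-nonzero a≉0 e≉0 (trans (sym (e-index _)) z))) (e-index _)))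
        k-product : ∏.sum k ≈ a ^ m
        k-product = trans (∏.sum-remove {i = z₀} k) (trans (*-cong (nz-yes a (e-index 0#)) (∏.sum-cong-≋ (λ j → nz-no a (unit′≉0 j))))
          (trans (*-identityˡ _) (∏.sum-replicate m)))
        cancel : ∀ {x s} → x * s ≈ s → ¬ (s ≈ 0#) → x ≈ 1#
        cancel {x} {s} xs≈s s≉0 with x ≈? 1#
        ... | yes x≈1 = x≈1
        ... | no  x≉1 = ⊥-elim (s≉0 (fixed⇒0 x≉1 (sym xs≈s)))

      ^-mod : ∀ {{_ : NonZero m}} a → ¬ (a ≈ 0#) → ∀ k → a ^ k ≈ a ^ (k % m)
      ^-mod a a≉0 k = begin
        a ^ k                              ≈⟨ ^-congʳ a (m≡m%n+[m/n]*n k m) ⟩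
        a ^ (k % m ℕ.+ k / m ℕ.* m)        ≈⟨ ^-homo-* a (k % m) _ ⟩
        a ^ (k % m) * a ^ (k / m ℕ.* m)    ≈⟨ *-congˡ (trans (^-congʳ a (ℕₚ.*-comm (k / m) m)) (trans (sym (^-assocʳ a m (k / m))) (trans (^-congˡ (k / m) (fermat a a≉0)) (1^ (k / m))))) ⟩
        a ^ (k % m) * 1#                   ≈⟨ *-identityʳ _ ⟩
        a ^ (k % m)                        ∎
        where
        1^ : ∀ k → 1# ^ k ≈ 1#
        1^ zero    = refl
        1^ (suc k) = trans (*-identityˡ _) (1^ k)

      -- Otherwise all m nonzero elements would be roots of x^r - 1 for the remainder r of `k`,
      -- where 0 < r < m.
      generator-exists : ∀ {{_ : NonZero m}} k → ¬ m ∣ k → ∃ λ a → ¬ (a ≈ 0#) × ¬ (a ^ k ≈ 1#)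
      generator-exists k m∤k with all? (λ j → (unit′ j ^ k) ≈? 1#)
      ... | no ¬all with ¬∀⟶∃¬ m _ (λ j → (unit′ j ^ k) ≈? 1#) ¬all
      ...   | j , uʲ≉1 = unit′ j , unit′≉0 j , uʲ≉1
      generator-exists k m∤k | yes all = ⊥-elim (excluded (k % m) (m%n<n k m) (λ z → m∤k (m%n≡0⇒n∣m k m z)) (λ j → trans (sym (^-mod (unit′ j) (unit′≉0 j) k)) (all j)))
        where
        excluded : ∀ r → r < m → ¬ (r ≡ 0) → (∀ j → unit′ j ^ r ≈ 1#) → ⊥
        excluded zero    r<m r≢0 h = r≢0 ≡.refl
        -- With too many roots the polynomial vanishes everywhere; at 0 this reads -1 = 0.
        excluded (suc r) r<m r≢0 h = 1≉0 (begin
          1#               ≈⟨ -‿injective (trans (sym (trans (+-congˡ (zeroˡ _)) (+-identityʳ _))) (trans (sym (eval-rootsOfUnity r 0#))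
                                (trans (manyRoots m unit′ (λ i j eq → punchIn-injective z₀ i j (inj _ _ eq)) (rootsOfUnity r)
                                  (≡.subst (_≤ m) (≡.sym (length-rootsOfUnity r)) r<m) (λ j → trans (eval-rootsOfUnity r (unit′ j)) (trans (+-congˡ (h j)) (-‿inverseˡ 1#))) 0#) (sym -0#≈0#)))) ⟩
          0#               ∎)

      -- Scaling by a suitable `a` permutes the summands and multiplies the sum by a^k, which is not
      -- 1.
      power-∤ : ∀ {{_ : NonZero m}} k → ¬ m ∣ k → power k ≈ 0#
      power-∤ k m∤k with generator-exists k m∤k
      ... | a , a≉0 , aᵏ≉1 = fixed⇒0 aᵏ≉1 (begin
        power k                           ≈⟨ sum-permute (λ i → e i ^ k) (scaling a a≉0) ⟩
        sum (λ i → e (index (a * e i)) ^ k) ≈⟨ sum-cong-≋ (λ i → trans (^-congˡ k (e-index _)) (^-distrib-* a (e i) k)) ⟩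
        sum (λ i → a ^ k * e i ^ k)       ≈⟨ *-distribˡ-sum (a ^ k) (λ i → e i ^ k) ⟨
        a ^ k * power k                   ∎)

      power-0 : power 0 ≈ 0#
      power-0 = trans (sum-replicate (suc m)) ×1≈0

      -- Each nonzero element contributes 1 and zero contributes 0, so the sum is m · 1 = -1.
      power-∣ : ∀ {{_ : NonZero m}} k → 0 < k → m ∣ k → ¬ (power k ≈ 0#)
      power-∣ (suc k) _ (divides d eq) pk≈0 = 1≉0 (begin
        1#                    ≈⟨ +-identityʳ 1# ⟨
        1# + 0#               ≈⟨ +-congˡ (trans (sym pk≈0) (trans (sum-remove {i = z₀} (λ i → e i ^ suc k)) (trans (+-cong (trans (*-congʳ (e-index 0#)) (zeroˡ _))
                                   (trans (sum-cong-≋ uᵏ≈1) (sum-replicate m))) (+-identityˡ _)))) ⟩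
        1# + m · 1#           ≈⟨ ×1≈0 ⟩
        0#                    ∎)
        where
        uᵏ≈1 : ∀ j → unit′ j ^ suc k ≈ 1#
        uᵏ≈1 j = trans (^-mod (unit′ j) (unit′≉0 j) (suc k)) (^-congʳ (unit′ j) (n∣m⇒m%n≡0 (suc k) m (divides d eq)))

  open FiniteField F using (p; f; q)

  σ : ℕ → Carrier
  σ k = ∑ (λ i → enum i ^ k) (allFin q)

  q₁ : ℕ
  q₁ = ℕ.pred (p ℕ.^ f)

  instance
    p-nonZero : NonZero p
    p-nonZero = ℕ.>-nonZero (ℕₚ.<-trans z<s 1<p)
      where open Binomials p-prime

  opaque
    q≡1+q₁ : q ≡ suc q₁
    q≡1+q₁ = ≡.trans q≡p^f (≡.sym (ℕₚ.suc-pred (p ℕ.^ f) {{ℕₚ.m^n≢0 p f}}))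

    0<q₁ : 0 < q₁
    0<q₁ = ℕₚ.≤-pred (≡.subst (2 ≤_) (≡.trans (≡.sym q≡p^f) q≡1+q₁) (ℕₚ.≤-trans (ℕₚ.≤-trans 1<p (ℕₚ.≤-reflexive (≡.sym (ℕₚ.*-identityʳ p)))) (ℕₚ.^-monoʳ-≤ p f≥1)))
      where open Binomials p-prime

  instance
    q₁-nonZero : NonZero q₁
    q₁-nonZero = ℕ.>-nonZero 0<q₁

  opaque
    -- The count of the enumeration has to be a successor before it can be pattern matched on.
    transport : ∀ {k} (e : Fin k → Carrier) → (∀ i j → e i ≈ e j → i ≡ j) → (∀ x → ∃ λ i → e i ≈ x) → ∀ {m} {{_ : NonZero m}} → k ≡ suc m →
      suc m · 1# ≈ 0# × (∀ n → ¬ m ∣ n → ∑ (λ i → e i ^ n) (allFin k) ≈ 0#) × ∑ (λ i → e i ^ 0) (allFin k) ≈ 0# ×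
      (∀ n → 0 < n → m ∣ n → ¬ (∑ (λ i → e i ^ n) (allFin k) ≈ 0#))
    transport e inj surj {m} ≡.refl = E.×1≈0 , (λ n m∤n → trans (sum≈∑-tabulate (λ i → e i ^ n) id) (E.power-∤ n m∤n)) ,
      trans (sum≈∑-tabulate (λ i → e i ^ 0) id) E.power-0 , λ n 0<n m∣n z → E.power-∣ n 0<n m∣n (trans (sym (sum≈∑-tabulate (λ i → e i ^ n) id)) z)
      where module E = Enumerated m e inj surj

    σ-∤ : ∀ n → ¬ q₁ ∣ n → σ n ≈ 0#
    σ-∤ = proj₁ (proj₂ (transport enum enum-injective enum-surjective q≡1+q₁))

    σ-0 : σ 0 ≈ 0#
    σ-0 = proj₁ (proj₂ (proj₂ (transport enum enum-injective enum-surjective q≡1+q₁)))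

    σ-∣ : ∀ n → 0 < n → q₁ ∣ n → ¬ (σ n ≈ 0#)
    σ-∣ = proj₂ (proj₂ (proj₂ (transport enum enum-injective enum-surjective q≡1+q₁)))

    p·1≈0 : p · 1# ≈ 0#
    p·1≈0 with (p · 1#) ≈? 0#
    ... | yes z = z
    ... | no ≉0 = ⊥-elim (^-nonzero f ≉0 (trans (sym (p^·1 f)) (trans (×-congˡ (≡.trans (≡.sym q≡p^f) q≡1+q₁)) (proj₁ (transport enum enum-injective enum-surjective q≡1+q₁)))))
      where
      p^·1 : ∀ k → (p ℕ.^ k) · 1# ≈ (p · 1#) ^ k
      p^·1 zero    = +-identityʳ 1#
      p^·1 (suc k) = trans (×1-homo-* p (p ℕ.^ k)) (*-congˡ (p^·1 k))

    multiple·1≈0 : ∀ {m} k → m · 1# ≈ 0# → (k ℕ.* m) · 1# ≈ 0#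
    multiple·1≈0 {m} k m·1≈0 = trans (×1-homo-* k m) (trans (*-congˡ m·1≈0) (zeroʳ _))

    -- `p` and `m` are coprime, so by Bézout 1 would vanish together with `p · 1#` and `m · 1#`.
    ·1-nonzero : ∀ m → ¬ p ∣ m → ¬ (m · 1# ≈ 0#)
    ·1-nonzero m p∤m m·1≈0 = contra (coprime-Bézout coprime)
      where
      coprime : Coprime p m
      coprime {d} (d∣p , d∣m) with prime⇒irreducible p-prime d∣p
      ... | inj₁ d≡1    = d≡1
      ... | inj₂ ≡.refl = ⊥-elim (p∤m d∣m)
      impossible : ∀ {a b} → suc a ≡ b → a · 1# ≈ 0# → b · 1# ≈ 0# → ⊥
      impossible ≡.refl a≈0 b≈0 = 1≉0 (trans (sym (+-identityʳ 1#)) (trans (+-congˡ (sym a≈0)) b≈0))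
      contra : Bézout.Identity 1 p m → ⊥
      contra (Bézout.+- x y eq) = impossible eq (multiple·1≈0 y m·1≈0) (multiple·1≈0 x p·1≈0)
      contra (Bézout.-+ x y eq) = impossible eq (multiple·1≈0 x p·1≈0) (multiple·1≈0 y m·1≈0)

-- Recursion for S_d(-k) in the degree d

module PowerSums (F : FiniteField) where

  open import Defs
  open Expansions
  open import Data.Nat as ℕ using (ℕ; zero; suc; s<s)
  import Data.Nat.Properties as ℕₚ
  open import Data.Fin using (Fin)
  open import Data.Vec as Vec using (Vec; toList)
  open import Data.List.Base as List using (List; []; _∷_; [_]; allFin)
  open import Data.Product using (_,_)
  open import Relation.Nullary
  import Relation.Binary.PropositionalEquality as ≡
  open ≡ using (_≡_)
  open import Algebra.Bundles using (CommutativeSemiring)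

  open FiniteField F using (Carrier; p; q; enum; p-prime; _≈_; _+_; _*_; 0#; 1#; semiring)
  module A = FiniteField F
  open Polynomials F
  open FieldTheory F
  module R = CommutativeSemiring polySemiring
  open ListSums polySemiring
  module ∑ᴬ = ListSums A.commutativeSemiring
  open Expansion polySemiring p-prime using (expand)
  open import Algebra.Properties.Semiring.Exp R.semiring
  open import Algebra.Properties.Semiring.Mult R.semiring
  open import Algebra.Properties.CommutativeSemiring.Exp polySemiring using (^-distrib-*)
  open import Algebra.Properties.Semiring.Exp A.semiring using () renaming (_^_ to _^ᴬ_)
  open import Algebra.Properties.Semiring.Mult A.semiring using () renaming (_×_ to _·_)
  open import Relation.Binary.Reasoning.Setoid R.setoid

  S : ℕ → ℕ → Poly F
  S = S- F

  T : Poly F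
  T = 0# ∷ 1# ∷ []

  opaque
    ^ₚ≋^ : ∀ P k → _^ₚ_ F P k ≋ P ^ k
    ^ₚ≋^ P zero    = R.refl
    ^ₚ≋^ P (suc k) = R.trans (R.reflexive (⊗≡*ₚ P (_^ₚ_ F P k))) (R.*-congˡ (^ₚ≋^ P k))

    coeff-× : ∀ m P n → coeff (m × P) n ≈ (m · 1#) * coeff P n
    coeff-× zero    P n = A.sym (A.zeroˡ _)
    coeff-× (suc m) P n = A.trans (coeff-+ P (m × P) n) (A.trans (A.+-cong (A.sym (A.*-identityˡ _)) (coeff-× m P n)) (A.sym (A.distribʳ _ 1# (m · 1#))))

    p×one≋0 : p × one F ≋ []
    p×one≋0 = mk λ n → A.trans (coeff-× p (one F) n) (A.trans (A.*-congʳ p·1≈0) (A.zeroˡ _))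

    cons≋ : ∀ c P → (c ∷ P) ≋ (T *ₚ P) +ₚ [ c ]
    cons≋ c P = mk λ where
      zero    → A.sym (A.trans (coeff-+ (T *ₚ P) [ c ] 0) (A.trans (A.+-congʳ (A.trans (coeff-*-zero 0# (1# ∷ []) P) (A.zeroˡ _))) (A.+-identityˡ c)))
      (suc n) → A.sym (A.trans (coeff-+ (T *ₚ P) [ c ] (suc n)) (A.trans (A.+-identityʳ _) (A.trans (coeff-*-suc 0# (1# ∷ []) P n)
                  (A.trans (A.+-cong (A.zeroˡ _) (at (R.*-identityˡ P) n)) (A.+-identityˡ _)))))

    const-^ : ∀ c k → [ c ] ^ k ≋ [ c ^ᴬ k ]
    const-^ c zero    = R.refl
    const-^ c (suc k) = R.trans (R.*-congˡ (const-^ c k)) (mk λ where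
      zero    → coeff-*-zero c [] _
      (suc n) → A.trans (coeff-*-suc c [] [ c ^ᴬ k ] n) (A.trans (A.+-cong (A.zeroʳ c) (at (*ₚ-zeroˡ [ c ^ᴬ k ]) n)) (A.+-identityˡ 0#)))

    const-∑ : ∀ {X : Set} (g : X → Carrier) xs → ∑ (λ x → [ g x ]) xs ≋ [ ∑ᴬ.∑ g xs ]
    const-∑ g []       = mk λ where
      zero    → A.refl
      (suc n) → A.refl
    const-∑ g (x ∷ xs) = R.trans (R.+-congˡ (const-∑ g xs)) (mk λ where
      zero    → coeff-+ [ g x ] _ 0
      (suc n) → A.trans (coeff-+ [ g x ] _ (suc n)) (A.+-identityˡ 0#))

  lift : ∀ {d} → Vec Carrier d → Poly F
  lift w = toList w List.++ [ 1# ]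

  opaque
    S≋∑ : ∀ d k → S d k ≋ ∑ (λ w → lift w ^ k) (allVecs F d)
    S≋∑ d k = R.trans (R.reflexive (Σₚ≡foldr (List.map (λ P → _^ₚ_ F P k) (monic F d)))) (R.trans (∑-map (λ P → _^ₚ_ F P k) lift (allVecs F d)) (∑-cong (λ w → ^ₚ≋^ (lift w) k) (allVecs F d)))

    S0≋one : ∀ k → S 0 k ≋ one F
    S0≋one k = R.trans (S≋∑ 0 k) (R.trans (R.+-identityʳ _) (1^ k))
      where
      1^ : ∀ k → one F ^ k ≋ one F
      1^ zero    = R.refl
      1^ (suc k) = R.trans (R.*-identityˡ _) (1^ k)

  term : ℕ → List ℕ → List ℕ → Poly F
  term d ks js = binom ks js × (T ^ val p js *ₚ (S d (val p js) *ₚ [ σ (val p (minus ks js)) ]))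

  opaque
    -- A monic polynomial of degree d + 1 is c + t w with w monic of degree d. After the expansion
    -- the sums over c and w separate, into `σ` and `S d`.
    S-suc : ∀ d ks → S (suc d) (val p ks) ≋ ∑ (term d ks) (subs ks)
    S-suc d ks = begin
      S (suc d) k                                                        ≈⟨ S≋∑ (suc d) k ⟩
      ∑ (λ w → lift w ^ k) (allVecs F (suc d))                           ≈⟨ ∑-concatMap (λ w → lift w ^ k) _ (allFin q) ⟩
      ∑ (λ i → ∑ (λ w → lift w ^ k) (List.map (enum i Vec.∷_) ws)) (allFin q) ≈⟨ ∑-cong (λ i → ∑-map (λ w → lift w ^ k) (enum i Vec.∷_) ws) (allFin q) ⟩
      ∑ (λ i → ∑ (λ w → (enum i ∷ lift w) ^ k) ws) (allFin q)            ≈⟨ ∑-cong (λ i → ∑-cong (λ w → R.trans (^-congˡ k (cons≋ (enum i) (lift w))) (expand p×one≋0 ks (T *ₚ lift w) [ enum i ])) ws) (allFin q) ⟩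
      ∑ (λ i → ∑ (λ w → ∑ (λ js → g js i w) (subs ks)) ws) (allFin q)    ≈⟨ ∑-cong (λ i → ∑-swap (λ w js → g js i w) ws (subs ks)) (allFin q) ⟩
      ∑ (λ i → ∑ (λ js → ∑ (g js i) ws) (subs ks)) (allFin q)            ≈⟨ ∑-swap (λ i js → ∑ (g js i) ws) (allFin q) (subs ks) ⟩
      ∑ (λ js → ∑ (λ i → ∑ (g js i) ws) (allFin q)) (subs ks)            ≈⟨ ∑-cong collect (subs ks) ⟩
      ∑ (term d ks) (subs ks)                                            ∎
      where
      k : ℕ
      k = val p ks
      ws : List (Vec Carrier d)
      ws = allVecs F d
      g : List ℕ → Fin q → Vec Carrier d → Poly F
      g js i w = binom ks js × ((T *ₚ lift w) ^ val p js *ₚ [ enum i ] ^ val p (minus ks js))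
      ∑-× : ∀ {X : Set} m (h : X → Poly F) xs → ∑ (λ x → m × h x) xs ≋ m × ∑ h xs
      ∑-× m h []       = R.sym (×0 m)
        where
        ×0 : ∀ m → m × [] ≋ []
        ×0 zero    = R.refl
        ×0 (suc m) = R.trans (R.+-identityˡ _) (×0 m)
      ∑-× m h (x ∷ xs) = R.trans (R.+-congˡ (∑-× m h xs)) (mk λ n → A.trans (coeff-+ (m × h x) _ n) (A.trans (A.+-cong (coeff-× m (h x) n) (coeff-× m _ n))
        (A.trans (A.sym (A.distribˡ (m · 1#) _ _)) (A.trans (A.*-congˡ (A.sym (coeff-+ (h x) _ n))) (A.sym (coeff-× m _ n))))))
      collect : ∀ js → ∑ (λ i → ∑ (g js i) ws) (allFin q) ≋ term d ks js
      collect js = begin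
        ∑ (λ i → ∑ (g js i) ws) (allFin q)   ≈⟨ ∑-cong (λ i → R.trans (∑-× m _ ws) (×-congʳ m (R.trans (∑-*ʳ _ _ ws) (R.*-congʳ (inner a))))) (allFin q) ⟩
        ∑ (λ i → m × ((T ^ a *ₚ S d a) *ₚ [ enum i ] ^ b)) (allFin q) ≈⟨ R.trans (∑-× m _ (allFin q)) (×-congʳ m (∑-*ˡ _ _ (allFin q))) ⟩
        m × ((T ^ a *ₚ S d a) *ₚ ∑ (λ i → [ enum i ] ^ b) (allFin q)) ≈⟨ ×-congʳ m (R.*-congˡ {x = T ^ a *ₚ S d a} (R.trans (∑-cong (λ i → const-^ (enum i) b) (allFin q)) (const-∑ (λ i → enum i ^ᴬ b) (allFin q)))) ⟩
        m × ((T ^ a *ₚ S d a) *ₚ [ σ b ])    ≈⟨ ×-congʳ m (R.*-assoc (T ^ a) (S d a) [ σ b ]) ⟩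
        term d ks js                         ∎
        where
        m a b : ℕ
        m = binom ks js
        a = val p js
        b = val p (minus ks js)
        inner : ∀ a → ∑ (λ w → (T *ₚ lift w) ^ a) ws ≋ T ^ a *ₚ S d a
        inner a = R.trans (∑-cong (λ w → ^-distrib-* T (lift w) a) ws) (R.trans (∑-*ˡ (T ^ a) (λ w → lift w ^ a) ws) (R.*-congˡ (R.sym (S≋∑ d a))))

    T-vanishes₁ : Vanishes T 1
    T-vanishes₁ zero    _         = A.refl
    T-vanishes₁ (suc i) (s<s ())

    T-vanishes : ∀ a → Vanishes (T ^ a) a
    T-vanishes zero    = λ i ()
    T-vanishes (suc a) = *ₚ-vanishes T (T ^ a) 1 a T-vanishes₁ (T-vanishes a)

    T-leading : ∀ a → coeff (T ^ a) a ≈ 1#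
    T-leading zero    = A.refl
    T-leading (suc a) = A.trans (*ₚ-leading T (T ^ a) 1 a T-vanishes₁ (T-vanishes a)) (A.trans (A.*-congˡ (T-leading a)) (A.*-identityˡ 1#))

    term-σ0 : ∀ d ks js → σ (val p (minus ks js)) ≈ 0# → ∀ n → coeff (term d ks js) n ≈ 0#
    term-σ0 d ks js σ≈0 n = A.trans (coeff-× (binom ks js) _ n) (A.trans (A.*-congˡ (at zero′ n)) (A.zeroʳ _))
      where
      zero′ : T ^ val p js *ₚ (S d (val p js) *ₚ [ σ (val p (minus ks js)) ]) ≋ []
      zero′ = R.trans (R.*-congˡ (R.trans (R.*-congˡ (mk λ { zero → σ≈0 ; (suc n) → A.refl })) (R.zeroʳ (S d (val p js))))) (R.zeroʳ (T ^ val p js))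

    term-S0 : ∀ d ks js → (∀ n → coeff (S d (val p js)) n ≈ 0#) → ∀ n → coeff (term d ks js) n ≈ 0#
    term-S0 d ks js S≈0 n = A.trans (coeff-× (binom ks js) _ n) (A.trans (A.*-congˡ (at zero′ n)) (A.zeroʳ _))
      where
      zero′ : T ^ val p js *ₚ (S d (val p js) *ₚ [ σ (val p (minus ks js)) ]) ≋ []
      S≋[] : S d (val p js) ≋ []
      S≋[] = mk S≈0
      zero′ = R.trans (R.*-congˡ (R.trans (R.*-congʳ S≋[]) (R.zeroˡ _))) (R.zeroʳ (T ^ val p js))

    inner-vanishes : ∀ d ks js w → Vanishes (S d (val p js)) w → Vanishes (S d (val p js) *ₚ [ σ (val p (minus ks js)) ]) w
    inner-vanishes d ks js w vS = ≡.subst (Vanishes (S d (val p js) *ₚ [ σ (val p (minus ks js)) ])) (ℕₚ.+-identityʳ w) (*ₚ-vanishes (S d (val p js)) [ σ (val p (minus ks js)) ] w 0 vS λ i ())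

    term-vanishes : ∀ d ks js w → Vanishes (S d (val p js)) w → Vanishes (term d ks js) (val p js ℕ.+ w)
    term-vanishes d ks js w vS i i< = A.trans (coeff-× (binom ks js) _ i) (A.trans (A.*-congˡ
      (*ₚ-vanishes (T ^ val p js) (S d (val p js) *ₚ [ σ (val p (minus ks js)) ]) (val p js) w (T-vanishes (val p js)) (inner-vanishes d ks js w vS) i i<)) (A.zeroʳ _))

    term-leading : ∀ d ks js w → Vanishes (S d (val p js)) w →
      coeff (term d ks js) (val p js ℕ.+ w) ≈ (binom ks js · 1#) * (coeff (S d (val p js)) w * σ (val p (minus ks js)))
    term-leading d ks js w vS = A.trans (coeff-× (binom ks js) _ _) (A.*-congˡ (A.trans
      (*ₚ-leading (T ^ val p js) (S d (val p js) *ₚ [ σ (val p (minus ks js)) ]) (val p js) w (T-vanishes (val p js)) (inner-vanishes d ks js w vS))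
      (A.trans (A.*-congʳ (T-leading (val p js))) (A.trans (A.*-identityˡ _)
        (≡.subst (λ m → coeff (S d (val p js) *ₚ [ c ]) m ≈ coeff (S d (val p js)) w * c) (ℕₚ.+-identityʳ w) (*ₚ-leading (S d (val p js)) [ c ] w 0 vS λ i ()))))))
      where
      c : Carrier
      c = σ (val p (minus ks js))

-- The order of S_d(-k) at t = 0

module Valuation (F : FiniteField) where

  open import Defs
  open Multisets
  open Expansions
  open import Data.Nat as ℕ using (ℕ; zero; suc; _<_; _≤_; z≤n; NonZero)
  import Data.Nat.Properties as ℕₚ
  open import Data.Nat.Divisibility using (_∣_; _∣?_; divides; ∣1⇒≡1)
  open import Data.Nat.Primality using (euclidsLemma)
  open import Data.Nat.Combinatorics using () renaming (_C_ to _choose_)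
  open import Data.List.Base as List using (List; []; _∷_; _++_)
  open import Data.List.Relation.Unary.All as All using (All; []; _∷_)
  open import Data.List.Relation.Unary.AllPairs using ([]; _∷_)
  open import Data.List.Relation.Unary.Any using (here; there)
  open import Data.List.Relation.Unary.Unique.Propositional using (Unique)
  open import Data.List.Membership.Propositional using (_∈_)
  open import Data.Product
  open import Data.Sum
  open import Data.Empty using (⊥; ⊥-elim)
  open import Function using (_∘_; id)
  open import Relation.Nullary
  open import Relation.Binary.Definitions using (tri<; tri≈; tri>)
  import Relation.Binary.PropositionalEquality as ≡
  open ≡ using (_≡_)

  open FiniteField F using (Carrier; p; f; f≥1; p-prime; _≈_; _+_; 0#)
  module A = FiniteField F
  open Polynomials F
  open FieldTheory F
  open PowerSums F hiding (module A)
  open Binomials p-prime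
  module ∑ₚ = ListSums polySemiring
  open ListSums A.commutativeSemiring

  instance
    f-nonZero : NonZero f
    f-nonZero = ℕ.>-nonZero f≥1

  open Compositions p f 1<p using (n; v; Conf; free; cons; tot; W; Λ⁺; module Λ⁺; _,_; low; improve; units; Digit; units₀-val; decompose;
    subs-unique; subs⁻; subs-split; subs-length; subs-digit; val-injective; carryFree)
  open Congruence n

  Composes : ∀ {d} → Conf d → List ℕ → Set
  Composes C ks = ∀ φ → tot φ C ≡ Σ[ φ ] (units 0 ks)

  record Optimal (d : ℕ) (ks : List ℕ) : Set where
    field
      C        : Conf d
      composes : Composes C ks
      minimal  : ∀ (C′ : Conf d) → Composes C′ ks → W C ≤ W C′
      vanishes : Vanishes (S d (val p ks)) (W C)
      leading  : ¬ (coeff (S d (val p ks)) (W C) ≈ 0#)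

  Incomposable : ℕ → List ℕ → Set
  Incomposable d ks = (∀ (C : Conf d) → ¬ Composes C ks) × (∀ i → coeff (S d (val p ks)) i ≈ 0#)

  flatten : ∀ {d} → Conf d → List ℕ
  flatten (free X)     = X
  flatten (cons Y _ C) = Y ++ flatten C

  opaque
    Σ-flatten : ∀ {d} φ (C : Conf d) → Σ[ φ ] (flatten C) ≡ tot φ C
    Σ-flatten φ (free X)     = ≡.refl
    Σ-flatten φ (cons Y _ C) = ≡.trans (Σ-++ φ Y (flatten C)) (≡.cong (Σ[ φ ] Y ℕ.+_) (Σ-flatten φ C))

    coeff-∑ : ∀ {X : Set} (g : X → Poly F) xs i → coeff (∑ₚ.∑ g xs) i ≈ ∑ (λ x → coeff (g x) i) xs
    coeff-∑ g []       i = A.refl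
    coeff-∑ g (x ∷ xs) i = A.trans (coeff-+ (g x) _ i) (A.+-congˡ (coeff-∑ g xs i))

    ∑-∈0 : ∀ {X : Set} (h : X → Carrier) xs → (∀ x → x ∈ xs → h x ≈ 0#) → ∑ h xs ≈ 0#
    ∑-∈0 h []       z = A.refl
    ∑-∈0 h (x ∷ xs) z = A.trans (A.+-cong (z x (here ≡.refl)) (∑-∈0 h xs λ y m → z y (there m))) (A.+-identityˡ 0#)

    ∑-single : ∀ {X : Set} (h : X → Carrier) xs → Unique xs → ∀ x₀ → x₀ ∈ xs → (∀ x → x ∈ xs → ¬ (x ≡ x₀) → h x ≈ 0#) → ∑ h xs ≈ h x₀
    ∑-single h (x ∷ xs) (x∉ ∷ u) .x (here ≡.refl) z =
      A.trans (A.+-congˡ (∑-∈0 h xs λ y m → z y (there m) λ y≡x → All.lookup x∉ m (≡.sym y≡x))) (A.+-identityʳ _)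
    ∑-single h (x ∷ xs) (x∉ ∷ u) x₀ (there m₀) z =
      A.trans (A.+-cong (z x (here ≡.refl) (All.lookup x∉ m₀)) (∑-single h xs u x₀ m₀ λ y m → z y (there m))) (A.+-identityˡ _)

    p∤binom : ∀ {ks js} → Digit ks → js ∈ subs ks → ¬ p ∣ binom ks js
    p∤binom {[]} [] (here ≡.refl) p∣1 = ℕₚ.<⇒≢ 1<p (≡.sym (∣1⇒≡1 p∣1))
    p∤binom {k ∷ ks} (k<p ∷ ds) m p∣b with subs⁻ {k} {ks} m
    ... | j , js , ≡.refl , j≤k , js∈ with euclidsLemma (k choose j) (binom ks js) p-prime p∣b
    ...   | inj₁ p∣C = p∤kCj k<p j≤k p∣C
    ...   | inj₂ p∣b′ = p∤binom ds js∈ p∣b′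

    ∣⇒≈ₙ0 : ∀ {m} → n ∣ m → m ≈ₙ 0
    ∣⇒≈ₙ0 (divides k eq) = 0 , k , ≡.trans (ℕₚ.+-identityʳ _) eq

    ≈ₙ0⇒∣ : ∀ {m} → m ≈ₙ 0 → n ∣ m
    ≈ₙ0⇒∣ {m} (s , t , eq) = ∣m+n∣m⇒∣n (≡.subst (n ∣_) (≡.trans (≡.sym eq) (ℕₚ.+-comm m _)) (divides t ≡.refl)) (divides s ≡.refl)
      where open import Data.Nat.Divisibility using (∣m+n∣m⇒∣n)

    base : ∀ ks → Optimal 0 ks
    base ks = record { C = free (units 0 ks) ; composes = λ φ → ≡.refl ; minimal = λ _ _ → z≤n ; vanishes = λ i ()
      ; leading = λ z → A.1≉0 (A.trans (A.sym (at (S0≋one (val p ks)) 0)) z) }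

    split-val : ∀ {ks js} → js ∈ subs ks → val p ks ≡ val p js ℕ.+ val p (minus ks js)
    split-val {ks} {js} m = ≡.trans (≡.sym (units₀-val ks)) (≡.trans (subs-split 0 ks m v) (≡.cong₂ ℕ._+_ (units₀-val js) (units₀-val (minus ks js))))

  module Inductive (d : ℕ) (rec : ∀ ks → Digit ks → Incomposable d ks ⊎ Optimal d ks) (ks : List ℕ) (ds : Digit ks) where

    -- `js` are the digits left for t w, and the complement is spent on the constant coefficient.
    -- `weight` is the order of the corresponding term of `S-suc`.
    record Candidate (js : List ℕ) : Set where
      field
        packet : Λ⁺ (units 0 (minus ks js))
        rest   : Optimal d js
      weight : ℕ
      weight = val p js ℕ.+ W (Optimal.C rest)
    open Candidate

    Blocked : List ℕ → Set
    Blocked js = (∀ i → coeff (term d ks js) i ≈ 0#) × (Λ⁺ (units 0 (minus ks js)) → ∀ (C : Conf d) → ¬ Composes C js)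

    opaque
      status : ∀ js → js ∈ subs ks → Blocked js ⊎ Candidate js
      status js m with 0⊎pos (val p (minus ks js))
      ... | inj₁ b≡0 = inj₁ (term-σ0 d ks js (A.trans (A.reflexive (≡.cong σ b≡0)) σ-0) ,
            λ l → ⊥-elim (ℕₚ.<⇒≢ (Λ⁺.nonempty l) (≡.sym (≡.trans (units₀-val (minus ks js)) b≡0))))
      ... | inj₂ 0<b with n ∣? val p (minus ks js)
      ...   | no n∤b = inj₁ (term-σ0 d ks js (σ-∤ _ n∤b) , λ l → ⊥-elim (n∤b (≡.subst (n ∣_) (units₀-val (minus ks js)) (≈ₙ0⇒∣ (Λ⁺.divisible l)))))
      ...   | yes n∣b with rec js (subs-digit ds m)
      ...     | inj₁ (none , S≈0) = inj₁ (term-S0 d ks js S≈0 , λ _ → none)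
      ...     | inj₂ opt = inj₂ (record { rest = opt ; packet = ≡.subst (0 <_) (≡.sym (units₀-val (minus ks js))) 0<b ,
                ≡.subst (_≈ₙ 0) (≡.sym (units₀-val (minus ks js))) (∣⇒≈ₙ0 n∣b) })

    Beaten : ℕ → List ℕ → Set
    Beaten w js = Blocked js ⊎ Σ (Candidate js) λ c → w ≤ weight c

    opaque
      weaken : ∀ {w w′ js} → w ≤ w′ → Beaten w′ js → Beaten w js
      weaken w≤w′ (inj₁ b)       = inj₁ b
      weaken w≤w′ (inj₂ (c , h)) = inj₂ (c , ℕₚ.≤-trans w≤w′ h)

      search : ∀ xs → (∀ {js} → js ∈ xs → js ∈ subs ks) → (∀ js → js ∈ xs → Blocked js) ⊎
        ∃ λ js → js ∈ xs × Σ (Candidate js) λ c → ∀ js′ → js′ ∈ xs → Beaten (weight c) js′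
      search [] sub = inj₁ λ js ()
      search (x ∷ xs) sub with search xs (sub ∘ there) | status x (sub (here ≡.refl))
      ... | inj₁ blocked | inj₁ b = inj₁ λ { js (here ≡.refl) → b ; js (there m) → blocked js m }
      ... | inj₁ blocked | inj₂ c = inj₂ (x , here ≡.refl , c , λ { js (here ≡.refl) → inj₂ (c , ℕₚ.≤-refl) ; js (there m) → inj₁ (blocked js m) })
      ... | inj₂ (js₀ , m₀ , c₀ , best) | inj₁ b = inj₂ (js₀ , there m₀ , c₀ , λ { js (here ≡.refl) → inj₁ b ; js (there m) → best js m })
      ... | inj₂ (js₀ , m₀ , c₀ , best) | inj₂ c with ℕₚ.≤-total (weight c₀) (weight c)
      ...   | inj₁ c₀≤c = inj₂ (js₀ , there m₀ , c₀ , λ { js (here ≡.refl) → inj₂ (c , c₀≤c) ; js (there m) → best js m })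
      ...   | inj₂ c≤c₀ = inj₂ (x , here ≡.refl , c , λ { js (here ≡.refl) → inj₂ (c , ℕₚ.≤-refl) ; js (there m) → weaken c≤c₀ (best js m) })

      separate : ∀ {Y} {l : Λ⁺ Y} (C : Conf d) → Composes (cons Y l C) ks → ∃ λ js → js ∈ subs ks × Composes C js × Λ⁺ (units 0 (minus ks js))
      separate {Y} {l} C comp with decompose 0 ks (flatten C) Y (λ φ → ≡.trans (ℕₚ.+-comm (Σ[ φ ] (flatten C)) _) (≡.trans (≡.cong (Σ[ φ ] Y ℕ.+_) (Σ-flatten φ C)) (comp φ)))
      ... | js , m , C≋ , Y≋ = js , m , (λ φ → ≡.trans (≡.sym (Σ-flatten φ C)) (C≋ φ)) , ≡.subst (0 <_) (Y≋ _) (Λ⁺.nonempty l) , ≡.subst (_≈ₙ 0) (Y≋ _) (Λ⁺.divisible l)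

      tot-val : ∀ {e js} (C : Conf e) → Composes C js → tot v C ≡ val p js
      tot-val {js = js} C comp = ≡.trans (comp _) (units₀-val js)

    conf : ∀ {js} → Candidate js → Conf (suc d)
    conf {js} c = cons (units 0 (minus ks js)) (packet c) (Optimal.C (rest c))

    opaque
      conf-composes : ∀ {js} (c : Candidate js) → js ∈ subs ks → Composes (conf c) ks
      conf-composes {js} c m φ = ≡.trans (≡.cong (Σ[ φ ] (units 0 (minus ks js)) ℕ.+_) (Optimal.composes (rest c) φ))
        (≡.trans (ℕₚ.+-comm (Σ[ φ ] (units 0 (minus ks js))) _) (≡.sym (subs-split 0 ks m φ)))

      conf-weight : ∀ {js} (c : Candidate js) → W (conf c) ≡ weight c
      conf-weight {js} c = ≡.cong (ℕ._+ W (Optimal.C (rest c))) (tot-val {js = js} (Optimal.C (rest c)) (Optimal.composes (rest c)))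

      none-optimal : (∀ js → js ∈ subs ks → Blocked js) → Incomposable (suc d) ks
      none-optimal blocked = (λ where
          (cons Y l C) comp → let js , m , compC , l′ = separate {Y} {l} C comp in proj₂ (blocked js m) l′ C compC) ,
        λ i → A.trans (at (S-suc d ks) i) (A.trans (coeff-∑ (term d ks) (subs ks) i) (∑-∈0 _ (subs ks) λ js m → proj₁ (blocked js m) i))

      beats : ∀ {w} → (∀ js → js ∈ subs ks → Beaten w js) → ∀ (C : Conf (suc d)) → Composes C ks → w ≤ W C
      beats {w} best (cons Y l C) comp with separate {Y} {l} C comp
      ... | js , m , compC , l′ with best js m
      ...   | inj₁ (_ , none) = ⊥-elim (none l′ C compC)
      ...   | inj₂ (c , w≤c) = ℕₚ.≤-trans w≤c (ℕₚ.+-mono-≤ (ℕₚ.≤-reflexive (≡.sym (tot-val {js = js} C compC))) (Optimal.minimal (rest c) C compC))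

      term-below : ∀ {w js} → Beaten w js → ∀ i → i < w → coeff (term d ks js) i ≈ 0#
      term-below (inj₁ (z , _)) i i<w = z i
      term-below {js = js} (inj₂ (c , w≤c)) i i<w = term-vanishes d ks js _ (Optimal.vanishes (rest c)) i (ℕₚ.<-≤-trans i<w w≤c)

      smaller-best-part : ∀ {w} → (∀ js → js ∈ subs ks → Beaten w js) → ∀ {js js′} → js ∈ subs ks → js′ ∈ subs ks →
        (c : Candidate js) → weight c ≡ w → (c′ : Candidate js′) → ¬ (val p (minus ks js) < val p (minus ks js′))
      smaller-best-part best {js} {js′} m m′ c cw c′ less with improve (packet c) (Optimal.C (rest c)) (λ N → ≡.subst (_< p ℕ.^ N) (≡.sym (conf-composes c m (low N))) (carryFree ds N))
            (packet c′) (Optimal.C (rest c′)) (λ φ → ≡.trans (conf-composes c′ m′ φ) (≡.sym (conf-composes c m φ)))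
            (≡.subst₂ _<_ (≡.sym (units₀-val (minus ks js))) (≡.sym (units₀-val (minus ks js′))) less)
      ... | C″ , same , cheaper = ℕₚ.<⇒≱ cheaper (ℕₚ.≤-trans (ℕₚ.≤-reflexive (≡.trans (conf-weight c) cw)) (beats best C″ (λ φ → ≡.trans (same φ) (conf-composes c m φ))))

      -- Different digit vectors leave different values for the weight-0 part, and whichever is
      -- smaller contradicts `smaller-best-part`.
      no-tie : ∀ {w} → (∀ js → js ∈ subs ks → Beaten w js) → ∀ {js js′} → js ∈ subs ks → js′ ∈ subs ks → ¬ (js ≡ js′) →
        (c : Candidate js) → weight c ≡ w → (c′ : Candidate js′) → weight c′ ≡ w → ⊥
      no-tie best {js} {js′} m m′ js≢js′ c cw c′ cw′ with ℕₚ.<-cmp (val p (minus ks js)) (val p (minus ks js′))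
      ... | tri< less _ _ = smaller-best-part best m m′ c cw c′ less
      ... | tri> _ _ more = smaller-best-part best m′ m c′ cw′ c more
      ... | tri≈ _ eq _ = js≢js′ (val-injective (≡.trans (subs-length ks m) (≡.sym (subs-length ks m′))) (subs-digit ds m) (subs-digit ds m′)
            (ℕₚ.+-cancelʳ-≡ (val p (minus ks js)) _ _ (≡.trans (≡.sym (split-val {ks} m)) (≡.trans (split-val {ks} m′) (≡.cong (val p js′ ℕ.+_) (≡.sym eq))))))

      optimal : ∀ js₀ → js₀ ∈ subs ks → (c₀ : Candidate js₀) → (∀ js → js ∈ subs ks → Beaten (weight c₀) js) → Optimal (suc d) ks
      optimal js₀ m₀ c₀ best = record { C = conf c₀ ; composes = conf-composes c₀ m₀
        ; minimal = λ C comp → ℕₚ.≤-trans (ℕₚ.≤-reflexive (conf-weight c₀)) (beats best C comp)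
        ; vanishes = λ i i< → A.trans (at (S-suc d ks) i) (A.trans (coeff-∑ (term d ks) (subs ks) i)
            (∑-∈0 _ (subs ks) λ js m → term-below (best js m) i (≡.subst (i <_) (conf-weight c₀) i<)))
        ; leading = λ z → lead (A.trans (A.sym at-w) (A.trans (A.reflexive (≡.cong (coeff (S (suc d) (val p ks))) (≡.sym (conf-weight c₀)))) z)) }
        where
        w : ℕ
        w = weight c₀
        others : ∀ js → js ∈ subs ks → ¬ (js ≡ js₀) → coeff (term d ks js) (weight c₀) ≈ 0#
        others js m js≢ with best js m
        ... | inj₁ (z , _) = z _
        ... | inj₂ (c , w≤c) with ℕₚ.m≤n⇒m<n∨m≡n w≤c
        ...   | inj₁ w<c = term-vanishes d ks js _ (Optimal.vanishes (rest c)) _ w<c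
        ...   | inj₂ w≡c = ⊥-elim (no-tie best m m₀ js≢ c (≡.sym w≡c) c₀ ≡.refl)
        at-w : coeff (S (suc d) (val p ks)) (weight c₀) ≈ coeff (term d ks js₀) (weight c₀)
        at-w = A.trans (at (S-suc d ks) _) (A.trans (coeff-∑ (term d ks) (subs ks) _) (∑-single _ (subs ks) (subs-unique ks) js₀ m₀ others))
        lead : ¬ (coeff (term d ks js₀) (weight c₀) ≈ 0#)
        -- The three factors are the binomial coefficient, prime to p digit by digit, the leading
        -- coefficient from degree d, and the power sum of a nonempty part.
        lead z = *-nonzero (·1-nonzero _ (p∤binom ds m₀)) (*-nonzero (Optimal.leading (rest c₀))
          (σ-∣ _ (≡.subst (0 <_) (units₀-val (minus ks js₀)) (Λ⁺.nonempty (packet c₀))) (≡.subst (n ∣_) (units₀-val (minus ks js₀)) (≈ₙ0⇒∣ (Λ⁺.divisible (packet c₀))))))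
          (A.trans (A.sym (term-leading d ks js₀ _ (Optimal.vanishes (rest c₀)))) z)

    solved : Incomposable (suc d) ks ⊎ Optimal (suc d) ks
    solved with search (subs ks) id
    ... | inj₁ blocked             = inj₁ (none-optimal blocked)
    ... | inj₂ (js , m , c , best) = inj₂ (optimal js m c best)

  valuation : ∀ d ks → Digit ks → Incomposable d ks ⊎ Optimal d ks
  valuation zero    ks ds = inj₂ (base ks)
  valuation (suc d) ks ds = Inductive.solved d (valuation d) ks ds

-- Comparison of S_d(-k) for different d

module Vanishing (F : FiniteField) where

  open import Defs
  open Multisets
  open Expansions
  open import Data.Nat as ℕ using (ℕ; zero; suc; _<_; _≤_; z<s; s<s; z≤n; _∸_; _<?_; _⊓_)
  import Data.Nat.Properties as ℕₚ
  open import Data.Nat.DivMod using (_%_; m%n<n; _/_)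
  open import Data.Fin as Fin using (Fin; zero; suc; toℕ)
  open import Data.Vec as Vec using (Vec; []; _∷_; lookup; toList)
  open import Data.Vec.Properties using (lookup-map; length-toList)
  open import Data.List.Base as List using (List; []; _∷_; applyUpTo; foldr; length; _++_)
  open import Data.Integer as ℤ using (ℤ; +_; ∣_∣)
  import Data.Integer.Properties as ℤₚ
  import Data.Rational as ℚ
  import Data.Rational.Properties as ℚₚ
  open import Data.Rational.Unnormalised as ℚᵘ using (ℚᵘ; mkℚᵘ; *<*)
  import Data.Rational.Unnormalised.Properties as ℚᵘₚ
  open import Data.Product
  open import Data.Sum
  open import Data.Empty using (⊥; ⊥-elim)
  open import Function using (_∘_)
  open import Function.Bundles using (_⇔_; mk⇔)
  open import Relation.Nullary
  open import Relation.Binary.Definitions using (tri<; tri≈; tri>)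
  import Relation.Binary.PropositionalEquality as ≡
  open ≡ using (_≡_)

  opaque
    /-<⇒ : ∀ a m b → (+ a) ℚ./ suc m ℚ.< (+ b) ℚ./ 1 → a < b ℕ.* suc m
    /-<⇒ a m b h = ≡.subst₂ _<_ (ℕₚ.*-identityʳ a) ≡.refl (ℤₚ.drop‿+<+ (≡.subst₂ ℤ._<_ (≡.sym (ℤₚ.pos-* a 1)) (≡.sym (ℤₚ.pos-* b (suc m)))
      (ℚᵘₚ.drop-*<* (ℚᵘₚ.<-respˡ-≃ (ℚₚ.toℚᵘ-fromℚᵘ (mkℚᵘ (+ a) m)) (ℚᵘₚ.<-respʳ-≃ (ℚₚ.toℚᵘ-fromℚᵘ (mkℚᵘ (+ b) 0)) (ℚₚ.toℚᵘ-mono-< h))))))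

    /-<⇐ : ∀ a m b → a < b ℕ.* suc m → (+ a) ℚ./ suc m ℚ.< (+ b) ℚ./ 1
    /-<⇐ a m b h = ℚₚ.toℚᵘ-cancel-< (ℚᵘₚ.<-respˡ-≃ (ℚᵘₚ.≃-sym (ℚₚ.toℚᵘ-fromℚᵘ (mkℚᵘ (+ a) m))) (ℚᵘₚ.<-respʳ-≃ (ℚᵘₚ.≃-sym (ℚₚ.toℚᵘ-fromℚᵘ (mkℚᵘ (+ b) 0)))
      (*<* (≡.subst₂ ℤ._<_ (ℤₚ.pos-* a 1) (ℤₚ.pos-* b (suc m)) (ℤ.+<+ (≡.subst (_< b ℕ.* suc m) (≡.sym (ℕₚ.*-identityʳ a)) h))))))

    minimum-≤ : ∀ (g : ℕ → ℕ) c m j → j < m → foldr _⊓_ c (applyUpTo g m) ≤ g j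
    minimum-≤ g c (suc m) zero    _         = ℕₚ.m⊓n≤m (g 0) _
    minimum-≤ g c (suc m) (suc j) (s<s j<m) = ℕₚ.≤-trans (ℕₚ.m⊓n≤n (g 0) _) (minimum-≤ (g ∘ suc) c m j j<m)

    minimum-glb : ∀ (g : ℕ → ℕ) c m a → a ≤ c → (∀ j → j < m → a ≤ g j) → a ≤ foldr _⊓_ c (applyUpTo g m)
    minimum-glb g c zero    a a≤c h = a≤c
    minimum-glb g c (suc m) a a≤c h = ℕₚ.⊓-glb (h 0 z<s) (minimum-glb (g ∘ suc) c m a a≤c λ j j<m → h (suc j) (s<s j<m))

  open FiniteField F using (p; f; f≥1; p-prime; q; q≡p^f; _≈_; _+_; _*_; 0#)
  module A = FiniteField F
  open Polynomials F
  open FieldTheory F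
  open PowerSums F hiding (module A)
  open Binomials p-prime
  open Valuation F hiding (module A)

  open Compositions p f 1<p using (n; v; ω; Conf; free; cons; tot; W; Λ⁺; module Λ⁺; _,_; tot-norm; Same; compose; pos-%; units; Digit; digits; norm≡digitSum)

  opaque
    norm-minl : ∀ ks → Digit ks → ∀ j → j < f → minl F (val p ks) ≤ Σ[ ω j ] (units 0 ks)
    norm-minl ks ds j j<f = ℕₚ.≤-trans (minimum-≤ _ _ f j j<f) (ℕₚ.≤-reflexive (≡.trans (≡.cong (λ b → digitSum b (val p ks ℕ.* p ℕ.^ j)) q≡p^f) (norm≡digitSum ds j j<f)))

    composable : ∀ d ks → Digit ks → d ℕ.* n ≤ minl F (val p ks) → ∃ λ (C : Conf d) → Composes C ks
    composable d ks ds h = compose d (units 0 ks) λ j → ℕₚ.≤-trans h (ℕₚ.≤-trans (norm-minl ks ds (j % f) (m%n<n j f)) (ℕₚ.≤-reflexive (Σ-cong (λ e → ≡.cong (p ℕ.^_) (pos-% j e)) (units 0 ks))))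

    composable⇒ : ∀ d ks → Digit ks → (C : Conf d) → Composes C ks → d ℕ.* n ≤ minl F (val p ks)
    composable⇒ d ks ds C comp = minimum-glb _ _ f (d ℕ.* n) (≡.subst (λ k → d ℕ.* n ≤ digitSum q k) (ℕₚ.*-identityʳ (val p ks)) (below 0 f≥1)) below
      where
      below : ∀ j → j < f → d ℕ.* n ≤ digitSum q (val p ks ℕ.* p ℕ.^ j)
      below j j<f = ℕₚ.≤-trans (tot-norm C j) (ℕₚ.≤-reflexive (≡.trans (comp (ω j)) (≡.trans (≡.sym (norm≡digitSum ds j j<f)) (≡.cong (λ b → digitSum b (val p ks ℕ.* p ℕ.^ j)) (≡.sym q≡p^f)))))

    -- Merging the first two parts brings everything after the first one place forward. When only
    -- the free part follows, it may be empty and the weight already 0; hence strictness only for 0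
    -- < d.
    merge : ∀ {d} (C : Conf (suc d)) → ∃ λ (C′ : Conf d) → Same C′ C × W C′ ≤ W C × (0 < d → W C′ < W C)
    merge (cons Y l (free X)) = free (Y ++ X) , (λ φ → Σ-++ φ Y X) , z≤n , λ ()
    merge (cons Y l (cons Z l′ C)) = cons (Y ++ Z) (≡.subst (0 <_) (≡.sym (Σ-++ v Y Z)) (ℕₚ.≤-trans (Λ⁺.nonempty l) (ℕₚ.m≤m+n _ _)) ,
          ≈ₙ-trans (≡⇒≈ₙ (Σ-++ v Y Z)) (≈ₙ-+ (Λ⁺.divisible l) (Λ⁺.divisible l′))) C ,
        (λ φ → ≡.trans (≡.cong (ℕ._+ tot φ C) (Σ-++ φ Y Z)) (ℕₚ.+-assoc (Σ[ φ ] Y) _ _)) , ℕₚ.<⇒≤ cheaper , λ _ → cheaper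
      where
      open Congruence n
      cheaper : tot v C ℕ.+ W C < (Σ[ v ] Z ℕ.+ tot v C) ℕ.+ (tot v C ℕ.+ W C)
      cheaper = ℕₚ.m<n+m _ (ℕₚ.<-≤-trans (Λ⁺.nonempty l′) (ℕₚ.m≤m+n _ _))

    mergeTo : ∀ d i (C : Conf (i ℕ.+ d)) → ∃ λ (C′ : Conf d) → Same C′ C × W C′ ≤ W C × (0 < d → 0 < i → W C′ < W C)
    mergeTo d zero    C = C , (λ φ → ≡.refl) , ℕₚ.≤-refl , λ _ ()
    mergeTo d (suc i) C with merge C
    ... | C₁ , same₁ , ≤₁ , <₁ with mergeTo d i C₁
    ...   | C₂ , same₂ , ≤₂ , _ = C₂ , (λ φ → ≡.trans (same₂ φ) (same₁ φ)) , ℕₚ.≤-trans ≤₂ ≤₁ ,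
            λ 0<d _ → ℕₚ.≤-<-trans ≤₂ (<₁ (ℕₚ.<-≤-trans 0<d (ℕₚ.m≤n+m d i)))

  -- For d = 0 the sum is 1 and its order 0, and later sums may have a constant term too; therefore
  -- `strictly` asks for 0 < d.
  record Exact (d k : ℕ) : Set where
    field
      V        : ℕ
      leading  : ¬ (coeff (S d k) V ≈ 0#)
      above    : ∀ d′ → d ≤ d′ → Vanishes (S d′ k) V
      strictly : 0 < d → ∀ d′ → d < d′ → Vanishes (S d′ k) (suc V)

  opaque
    exact : ∀ d k → d ℕ.* n ≤ minl F k → Exact d k
    exact d k h with digits k
    ... | ks , ds , ≡.refl with valuation d ks ds
    ...   | inj₁ (none , _) = ⊥-elim (none (proj₁ (composable d ks ds h)) (proj₂ (composable d ks ds h)))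
    ...   | inj₂ opt = record { V = W O.C ; leading = O.leading
          ; above = λ d′ d≤d′ → ≡.subst (λ e → Vanishes (S e (val p ks)) (W O.C)) (ℕₚ.m∸n+n≡m d≤d′) (λ j j< → beyond (d′ ∸ d) j (λ W′ _ W≤ → ℕₚ.<-≤-trans j< W≤))
          ; strictly = λ 0<d d′ d<d′ → ≡.subst (λ e → Vanishes (S e (val p ks)) (suc (W O.C))) (ℕₚ.m∸n+n≡m (ℕₚ.<⇒≤ d<d′))
              (λ j j< → beyond (d′ ∸ d) j (λ W′ W< _ → ℕₚ.<-≤-trans j< (W< 0<d (ℕₚ.m<n⇒0<n∸m d<d′)))) }
      where
      module O = Optimal opt
      beyond : ∀ i j → (∀ W′ → (0 < d → 0 < i → W O.C < W′) → W O.C ≤ W′ → j < W′) → coeff (S (i ℕ.+ d) (val p ks)) j ≈ 0#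
      beyond i j small with valuation (i ℕ.+ d) ks ds
      ... | inj₁ (_ , S≈0) = S≈0 j
      ... | inj₂ opt′ with mergeTo d i (Optimal.C opt′)
      ...   | C′ , same , ≤′ , <′ = Optimal.vanishes opt′ j (small (W (Optimal.C opt′)) (λ 0<d 0<i → ℕₚ.≤-<-trans minimal′ (<′ 0<d 0<i)) (ℕₚ.≤-trans minimal′ ≤′))
        where
        minimal′ : W O.C ≤ W C′
        minimal′ = O.minimal C′ λ φ → ≡.trans (same φ) (Optimal.composes opt′ φ)

    S-zero : ∀ d k → minl F k < d ℕ.* n → ∀ i → coeff (S d k) i ≈ 0#
    S-zero d k h with digits k
    ... | ks , ds , ≡.refl with valuation d ks ds
    ...   | inj₁ (_ , S≈0) = S≈0
    ...   | inj₂ opt = ⊥-elim (ℕₚ.<⇒≱ h (composable⇒ d ks ds (Optimal.C opt) (Optimal.composes opt)))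

  -- Trivial zeros and the dominating term

  ζₙ : List ℕ → ℕ → Poly F
  ζₙ = Z F

  summand : ℕ → List ℕ → ℕ → Poly F
  summand k ks d = S d k *ₚ ζₙ ks d

  opaque
    unfolding _+ₚ_

    ζₙ-∷ : ∀ k ks N → ζₙ (k ∷ ks) N ≡ foldr _+ₚ_ [] (applyUpTo (summand k ks) N)
    ζₙ-∷ k ks N = ≡.refl

  opaque
    partial-zero : ∀ (g : ℕ → Poly F) N i → (∀ d → d < N → coeff (g d) i ≈ 0#) → coeff (foldr _+ₚ_ [] (applyUpTo g N)) i ≈ 0#
    partial-zero g zero    i z = A.refl
    partial-zero g (suc N) i z = A.trans (coeff-+ (g 0) _ i) (A.trans (A.+-cong (z 0 z<s) (partial-zero (g ∘ suc) N i λ d d<N → z (suc d) (s<s d<N))) (A.+-identityˡ 0#))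

    partial-single : ∀ (g : ℕ → Poly F) N i d₀ → d₀ < N → (∀ d → d < N → ¬ (d ≡ d₀) → coeff (g d) i ≈ 0#) → coeff (foldr _+ₚ_ [] (applyUpTo g N)) i ≈ coeff (g d₀) i
    partial-single g (suc N) i zero     _          z = A.trans (coeff-+ (g 0) _ i) (A.trans (A.+-congˡ (partial-zero (g ∘ suc) N i λ d d<N → z (suc d) (s<s d<N) λ ())) (A.+-identityʳ _))
    partial-single g (suc N) i (suc d₀) (s<s d₀<N) z = A.trans (coeff-+ (g 0) _ i) (A.trans (A.+-cong (z 0 z<s λ ()) (partial-single (g ∘ suc) N i d₀ d₀<N λ d d<N d≢ → z (suc d) (s<s d<N) (d≢ ∘ ℕₚ.suc-injective))) (A.+-identityˡ _))

    *ₚ-zeroʳ′ : ∀ P Q → (∀ i → coeff Q i ≈ 0#) → ∀ i → coeff (P *ₚ Q) i ≈ 0#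
    *ₚ-zeroʳ′ P Q z i = A.trans (at (*ₚ-comm P Q) i) (*ₚ-zero Q P z i)

    short : ∀ ks N → N < length ks → ∀ i → coeff (ζₙ ks N) i ≈ 0#
    short (k ∷ ks) N (s<s N≤) i = A.trans (A.reflexive (≡.cong (λ P → coeff P i) (ζₙ-∷ k ks N)))
      (partial-zero _ N i λ d d<N → *ₚ-zeroʳ′ (S d k) (ζₙ ks d) (short ks d (ℕₚ.<-≤-trans d<N N≤)) i)

  -- `length ks` is r - i for the entry s_i, and the inequality L < r - i has been multiplied by n =
  -- q - 1.
  Trivial : List ℕ → Set
  Trivial []       = ⊥
  Trivial (k ∷ ks) = minl F k < length ks ℕ.* n ⊎ Trivial ks

  trivial? : ∀ ks → Dec (Trivial ks)
  trivial? []       = no λ ()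
  trivial? (k ∷ ks) with minl F k <? length ks ℕ.* n | trivial? ks
  ... | yes h | _     = yes (inj₁ h)
  ... | no _  | yes t = yes (inj₂ t)
  ... | no ¬h | no ¬t = no λ { (inj₁ h) → ¬h h ; (inj₂ t) → ¬t t }

  opaque
    -- For d below `length ks` the inner sum is empty, and from there on `S d k` vanishes by the
    -- norm bound; so each summand has a zero factor.
    trivial⇒zero : ∀ ks → Trivial ks → ∀ N i → coeff (ζₙ ks N) i ≈ 0#
    trivial⇒zero (k ∷ ks) t N i = A.trans (A.reflexive (≡.cong (λ P → coeff P i) (ζₙ-∷ k ks N))) (partial-zero _ N i λ d _ → each t d)
      where
      each : Trivial (k ∷ ks) → ∀ d → coeff (summand k ks d) i ≈ 0#
      each (inj₂ t) d = *ₚ-zeroʳ′ (S d k) (ζₙ ks d) (trivial⇒zero ks t d) i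
      each (inj₁ h) d with d <? length ks
      ... | yes d<  = *ₚ-zeroʳ′ (S d k) (ζₙ ks d) (short ks d d<) i
      ... | no  d≮  = *ₚ-zero (S d k) (ζₙ ks d) (S-zero d k (ℕₚ.<-≤-trans h (ℕₚ.*-monoˡ-≤ n (ℕₚ.≮⇒≥ d≮)))) i

  -- At t = 0 the term (d₁, …, d_r) = (r − 1, …, 1, 0) strictly dominates, provided r ≥ 2.
  record Dominated (ks : List ℕ) : Set where
    field
      order   : ℕ
      lower   : ∀ N → Vanishes (ζₙ ks N) order
      nonzero : ∀ N → N ≡ length ks ⊎ 2 ≤ length ks × length ks ≤ N → ¬ (coeff (ζₙ ks N) order ≈ 0#)

  opaque
    -- The inner sums enter at `N` equal to their length, where a single term survives. So strict
    -- growth is used only for d₁, and there r ≥ 2 makes the minimal value r - 1 positive.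
    dominated : ∀ ks → ¬ Trivial ks → Dominated ks
    dominated [] ¬t = record { order = 0 ; lower = λ N i () ; nonzero = λ { N (inj₁ _) z → A.1≉0 z ; N (inj₂ (() , _)) } }
    dominated (k ∷ ks) ¬t = record { order = E.V ℕ.+ D.order
        ; lower = λ N i i< → A.trans (A.reflexive (≡.cong (λ P → coeff P i) (ζₙ-∷ k ks N))) (partial-zero _ N i λ d _ → low d i i<)
        ; nonzero = λ N h z → *-nonzero E.leading (D.nonzero (length ks) (inj₁ ≡.refl)) (A.trans (A.sym (lead N h)) z) }
      where
      module E = Exact (exact (length ks) k (ℕₚ.≮⇒≥ (¬t ∘ inj₁)))
      module D = Dominated (dominated ks (¬t ∘ inj₂))
      low : ∀ d → Vanishes (summand k ks d) (E.V ℕ.+ D.order)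
      low d i i< with d <? length ks
      ... | yes d< = *ₚ-zeroʳ′ (S d k) (ζₙ ks d) (short ks d d<) i
      ... | no  d≮ = *ₚ-vanishes (S d k) (ζₙ ks d) E.V D.order (E.above d (ℕₚ.≮⇒≥ d≮)) (D.lower d) i i<
      others : ∀ N → N ≡ suc (length ks) ⊎ 2 ≤ suc (length ks) × suc (length ks) ≤ N → ∀ d → d < N → ¬ (d ≡ length ks) → coeff (summand k ks d) (E.V ℕ.+ D.order) ≈ 0#
      others N h d d<N d≢ with ℕₚ.<-cmp d (length ks)
      ... | tri< d< _ _ = *ₚ-zeroʳ′ (S d k) (ζₙ ks d) (short ks d d<) _
      ... | tri≈ _ d≡ _ = ⊥-elim (d≢ d≡)
      others N (inj₁ ≡.refl) d d<N d≢ | tri> _ _ d> = ⊥-elim (ℕₚ.<⇒≱ d> (ℕₚ.≤-pred d<N))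
      others N (inj₂ (2≤ , _)) d d<N d≢ | tri> _ _ d> = *ₚ-vanishes (S d k) (ζₙ ks d) (suc E.V) D.order (E.strictly (ℕₚ.≤-pred 2≤) d d>) (D.lower d) _ (ℕₚ.n<1+n _)
      lead : ∀ N → N ≡ suc (length ks) ⊎ 2 ≤ suc (length ks) × suc (length ks) ≤ N →
        coeff (ζₙ (k ∷ ks) N) (E.V ℕ.+ D.order) ≈ coeff (S (length ks) k) E.V * coeff (ζₙ ks (length ks)) D.order
      lead N h = A.trans (A.reflexive (≡.cong (λ P → coeff P (E.V ℕ.+ D.order)) (ζₙ-∷ k ks N)))
        (A.trans (partial-single _ N _ (length ks) (d₀<N h) (others N h)) (*ₚ-leading (S (length ks) k) (ζₙ ks (length ks)) E.V D.order (E.above (length ks) ℕₚ.≤-refl) (D.lower (length ks))))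
        where
        d₀<N : N ≡ suc (length ks) ⊎ 2 ≤ suc (length ks) × suc (length ks) ≤ N → length ks < N
        d₀<N (inj₁ ≡.refl)  = ℕₚ.n<1+n _
        d₀<N (inj₂ (_ , h)) = h

    ζ≡0⇒trivial : ∀ ks → 2 ≤ length ks → ζ≡0 F ks → Trivial ks
    ζ≡0⇒trivial ks 2≤r (N₀ , z) with trivial? ks
    ... | yes t = t
    ... | no ¬t = ⊥-elim (Dominated.nonzero (dominated ks ¬t) (N₀ ℕ.+ length ks) (inj₂ (2≤r , ℕₚ.m≤n+m _ N₀))
            (isZero⇒coeff (z (N₀ ℕ.+ length ks) (ℕₚ.m≤m+n N₀ _)) (Dominated.order (dominated ks ¬t))))

    trivial⇒ζ≡0 : ∀ ks → Trivial ks → ζ≡0 F ks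
    trivial⇒ζ≡0 ks t = 0 , λ N _ → coeff⇒isZero (ζₙ ks N) (trivial⇒zero ks t N)

    trivial⇒index : ∀ {r} (xs : Vec ℕ r) → Trivial (toList xs) → ∃ λ (i : Fin r) → minl F (lookup xs i) < (r ∸ suc (toℕ i)) ℕ.* n
    trivial⇒index {suc r} (x ∷ xs) (inj₁ h) = zero , ≡.subst (λ m → minl F x < m ℕ.* n) (length-toList xs) h
    trivial⇒index (x ∷ xs) (inj₂ t) with trivial⇒index xs t
    ... | i , h = suc i , h

    index⇒trivial : ∀ {r} (xs : Vec ℕ r) (i : Fin r) → minl F (lookup xs i) < (r ∸ suc (toℕ i)) ℕ.* n → Trivial (toList xs)
    index⇒trivial (x ∷ xs) zero    h = inj₁ (≡.subst (λ m → minl F x < m ℕ.* n) (≡.sym (length-toList xs)) h)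
    index⇒trivial (x ∷ xs) (suc i) h = inj₂ (index⇒trivial xs i h)

    L-unfold : ∀ k m M → M ≡ minl F k → q ≡ suc (suc m) → L F k ≡ (+ M) ℚ./ suc m
    L-unfold k m M M≡ eq with M≡ | q | eq
    ... | M≡′ | .(suc (suc m)) | ≡.refl = ≡.cong (λ a → (+ a) ℚ./ suc m) (≡.sym M≡′)

    L-eq : ∀ k m → q ≡ suc (suc m) → L F k ≡ (+ minl F k) ℚ./ suc m
    L-eq k m = L-unfold k m (minl F k) ≡.refl

    q≡2+ : q ≡ suc (suc (ℕ.pred n))
    q≡2+ = ≡.trans q≡1+q₁ (≡.cong suc (≡.sym (ℕₚ.suc-pred n)))

    L<⇒ : ∀ k b → L F k ℚ.< (+ b) ℚ./ 1 → minl F k < b ℕ.* n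
    L<⇒ k b h = ≡.subst (λ m → minl F k < b ℕ.* m) (ℕₚ.suc-pred n) (/-<⇒ (minl F k) (ℕ.pred n) b (≡.subst (ℚ._< (+ b) ℚ./ 1) (L-eq k (ℕ.pred n) q≡2+) h))

    L<⇐ : ∀ k b → minl F k < b ℕ.* n → L F k ℚ.< (+ b) ℚ./ 1
    L<⇐ k b h = ≡.subst (ℚ._< (+ b) ℚ./ 1) (≡.sym (L-eq k (ℕ.pred n) q≡2+)) (/-<⇐ (minl F k) (ℕ.pred n) b (≡.subst (λ m → minl F k < b ℕ.* m) (≡.sym (ℕₚ.suc-pred n)) h))

    -- For the last entry r - i is 0 and nothing lies below it, so the range of the index in the
    -- condition comes from the inequality itself.
    index<r : ∀ r i a → a < (r ∸ suc i) ℕ.* n → suc i ≤ r ∸ 1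
    index<r r i a h with suc i <? r
    index<r (suc r) i a h | yes (s<s i<r) = i<r
    ... | no i≮ = ⊥-elim (ℕₚ.<⇒≱ h (ℕₚ.≤-trans (ℕₚ.≤-reflexive (≡.cong (ℕ._* n) (ℕₚ.m≤n⇒m∸n≡0 (ℕₚ.≮⇒≥ i≮)))) z≤n))

  equivalence : ∀ (r : ℕ) → 2 ≤ r → (s : Vec ℤ r) → ζ≡0 F (negList F s) ⇔ TrivialZeroCondition F r s
  equivalence r 2≤r s = mk⇔ to from
    where
    xs : Vec ℕ r
    xs = Vec.map ∣_∣ s
    to : ζ≡0 F (negList F s) → TrivialZeroCondition F r s
    to z with trivial⇒index xs (ζ≡0⇒trivial (toList xs) (ℕₚ.≤-trans 2≤r (ℕₚ.≤-reflexive (≡.sym (length-toList xs)))) z)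
    ... | i , h = i , index<r r (toℕ i) _ h , L<⇐ ∣ lookup s i ∣ (r ∸ suc (toℕ i)) (≡.subst (λ k → minl F k < (r ∸ suc (toℕ i)) ℕ.* n) (lookup-map i ∣_∣ s) h)
    from : TrivialZeroCondition F r s → ζ≡0 F (negList F s)
    from (i , _ , h) = trivial⇒ζ≡0 (toList xs) (index⇒trivial xs i (≡.subst (λ k → minl F k < (r ∸ suc (toℕ i)) ℕ.* n) (≡.sym (lookup-map i ∣_∣ s)) (L<⇒ ∣ lookup s i ∣ (r ∸ suc (toℕ i)) h)))

open import Defs
open import Data.Nat using (ℕ; _≤_)
open import Data.Integer using (ℤ; _<_; 0ℤ)
open import Data.Vec using (Vec; lookup)
open import Data.Fin using (Fin)
open import Function.Bundles using (_⇔_)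

theorem2p10 : (F : FiniteField) (r : ℕ) → 2 ≤ r → (s : Vec ℤ r) →
    (∀ (i : Fin r) → lookup s i < 0ℤ) →
    (ζ≡0 F (negList F s) ⇔ TrivialZeroCondition F r s)
theorem2p10 F r 2≤r s _ = Vanishing.equivalence F r 2≤r s
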